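{- Let $a,k,d,e,f$ be integers with $1\le a\le k$, $1\le d\le k$, $1\le f\le d$, and either $e=d$ or $2e=d$. Let ${}_dB_{dk+e,\,da+f}(n)$ be the number of partitions of $n$ such that $$\phi_i+\phi_{i+1}<dk+e \ \text{ for all } i\ge 1,\qquad \phi_1<da+f,\qquad d\mid \phi_{2i}\ \text{ for all } i\ge 1.$$ Put $M=2dk+2e+d$. Then $\sum_{n\ge 0}{}_dB_{dk+e,\,da+f}(n)\,q^n$ equals: - if $f<e$: $$\frac{1}{(q^{2d};q^{2d})_\infty (q;q^2)_\infty}\left(\frac{1-q^{d-e+f}}{1-q^d}\,(q^{da+e},q^{2dk-da+e+d},q^{M};q^{M})_\infty+\frac{q^{d-e+f}-q^d}{1-q^d}\,(q^{d(a-1)+e},q^{2dk-da+e+2d},q^{M};q^{M})_\infty\right);$$ - if $f=e$: $$\frac{(q^{da+e},q^{2dk-da+e+d},q^{M};q^{M})_\infty}{(q^{2d};q^{2d})_\infty (q;q^2)_\infty};$$ - if $f>e$: $$\frac{1}{(q^{2d};q^{2d})_\infty (q;q^2)_\infty}\left(\frac{q^{f-e}-q^d}{1-q^d}\,(q^{da+e},q^{2dk-da+e+d},q^{M};q^{M})_\infty+\frac{1-q^{f-e}}{1-q^d}\,(q^{d(a+1)+e},q^{2dk-da+e},q^{M};q^{M})_\infty\right).$$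
   Context: A partition of a nonnegative integer $n$ is a finite non-increasing sequence of positive integers summing to $n$ (the empty partition is the unique partition of $0$). For a partition and an integer $i\ge1$, $\phi_i$ denotes the number of times $i$ occurs as a part (so $\phi_i\ge 0$). For $|q|<1$: $(a;q)_n=(1-a)(1-aq)\cdots(1-aq^{n-1})$, $(a;q)_\infty=\lim_{n\to\infty}(a;q)_n$, and $(a_1,\dots,a_r;q)_\infty=(a_1;q)_\infty\cdots(a_r;q)_\infty$. The identity is of formal power series in $q$ (equivalently of analytic functions for $|q|<1$). -}

module Defs where

open import Data.Bool.Base using (if_then_else_)
open import Data.Integer.Base as ℤ using (ℤ; +_; 0ℤ; 1ℤ)
import Data.Integer.Properties as ℤ
open import Data.List.Base using (List; []; _∷_; map; foldr; filter; length; upTo; concatMap; deduplicate)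
open import Data.List.Membership.Propositional using (_∈_; lose)
open import Data.List.Membership.Propositional.Properties using (∈-map⁺; ∈-concatMap⁺; ∈-upTo⁺; ∈-filter⁺; ∈-filter⁻; ∈-deduplicate⁺; ∈-deduplicate⁻)
open import Data.List.Properties using (≡-dec; filter-reject)
open import Data.List.Relation.Unary.All as All using (All; []; _∷_)
open import Data.List.Relation.Unary.Any using (here; there)
open import Data.List.Relation.Unary.Linked using (Linked; linked?)
open import Data.List.Relation.Unary.Unique.Propositional using (Unique)
open import Data.List.Relation.Unary.Unique.DecPropositional.Properties using (deduplicate-!)
open import Data.Nat.Base using (ℕ; zero; suc; _+_; _*_; _∸_; _≤_; _<_; _≥_; _>_; z≤n; s≤s)
open import Data.Nat.Divisibility using (_∣_; _∣?_; _∣0)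
open import Data.Nat.ListAction using (sum)
open import Data.Nat.Properties
open import Data.Product.Base using (_×_; _,_; proj₁; proj₂)
open import Data.Sum.Base using (inj₁; inj₂)
open import Function.Base using (_∘_)
open import Function.Bundles using (_⇔_; mk⇔)
open import Relation.Binary.PropositionalEquality
open import Relation.Nullary using (Dec; yes; no; does; contradiction)
open import Relation.Nullary.Decidable using (map′; _×-dec_)
open import Relation.Unary using (Pred; Decidable)
open import Level using (0ℓ)

record Enumeration {A : Set} (P : Pred A 0ℓ) : Set where
  field
    elements : List A
    unique   : Unique elements
    complete : ∀ x → x ∈ elements ⇔ P x

  cardinality : ℕ
  cardinality = length elements

IsPartition : ℕ → List ℕ → Set
IsPartition n p = Linked _≥_ p × All (_> 0) p × sum p ≡ n

φ : ℕ → List ℕ → ℕ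
φ i p = length (filter (_≟ i) p)

-- Partitions counted by ₔB_{κ,α}(n).
record Admissible (d κ α n : ℕ) (p : List ℕ) : Set where
  constructor admissible
  field
    isPartition : IsPartition n p
    adjacent    : ∀ i → i ≥ 1 → φ i p + φ (i + 1) p < κ
    ones        : φ 1 p < α
    evens       : ∀ i → i ≥ 1 → d ∣ φ (2 * i) p

-- A part never exceeds the sum, so only finitely many i matter.
φ-vanishes : ∀ i p → sum p < i → φ i p ≡ 0
φ-vanishes i []      _ = refl
φ-vanishes i (x ∷ p) s<i = trans
  (cong length (filter-reject (_≟ i) {x} {p} λ { refl → ≤⇒≯ (m≤m+n x (sum p)) s<i }))
  (φ-vanishes i p (≤-<-trans (m≤n+m (sum p) x) s<i))

all≥1? : ∀ {P : Pred ℕ 0ℓ} → Decidable P → ∀ N → (∀ i → N < i → P (suc N) → P i) →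
         Dec (∀ i → i ≥ 1 → P i)
all≥1? {P} P? N tail = map′ to (λ h {j} _ → h (suc j) (s≤s z≤n)) (allUpTo? (P? ∘ suc) (suc N))
  where
  to : (∀ {j} → j < suc N → P (suc j)) → ∀ i → i ≥ 1 → P i
  to h (suc j) _ with <-≤-connex j (suc N)
  ... | inj₁ j<  = h j<
  ... | inj₂ N<j = tail (suc j) (m<n⇒m<1+n N<j) (h ≤-refl)

admissible? : ∀ d κ α n → Decidable (Admissible d κ α n)
admissible? d κ α n p =
  map′ (λ (x , y , z , w) → admissible x y z w)
       (λ (admissible x y z w) → x , y , z , w)
       (  (linked? _≥?_ p ×-dec All.all? (_>? 0) p ×-dec (sum p ≟ n))
    ×-dec all≥1? (λ i → φ i p + φ (i + 1) p <? κ) (sum p) adjacent-tail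
    ×-dec (φ 1 p <? α)
    ×-dec all≥1? (λ i → d ∣? φ (2 * i) p) (sum p) evens-tail)
  where
  adjacent-tail : ∀ i → sum p < i → φ (suc (sum p)) p + φ (suc (sum p) + 1) p < κ →
                  φ i p + φ (i + 1) p < κ
  adjacent-tail i s<i h
    rewrite φ-vanishes i p s<i | φ-vanishes (i + 1) p (<-≤-trans s<i (m≤m+n i 1)) =
    ≤-<-trans z≤n h

  evens-tail : ∀ i → sum p < i → d ∣ φ (2 * suc (sum p)) p → d ∣ φ (2 * i) p
  evens-tail i s<i _
    rewrite φ-vanishes (2 * i) p (<-≤-trans s<i (m≤m+n i (i + 0))) = d ∣0

-- Lists of at most l positive integers with sum at most n.
boundedLists : ℕ → ℕ → List (List ℕ)
boundedLists zero    n = [] ∷ []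
boundedLists (suc l) n =
  [] ∷ concatMap (λ j → map (suc j ∷_) (boundedLists l (n ∸ suc j))) (upTo n)

∈-boundedLists : ∀ l n p → All (_> 0) p → sum p ≤ n → sum p ≤ l → p ∈ boundedLists l n
∈-boundedLists zero    n []          _        _   _  = here refl
∈-boundedLists zero    n (suc x ∷ p) _        _   ()
∈-boundedLists zero    n (zero ∷ p)  (() ∷ _) _   _
∈-boundedLists (suc l) n []          _        _   _  = here refl
∈-boundedLists (suc l) n (zero ∷ p)  (() ∷ _) _   _
∈-boundedLists (suc l) n (suc x ∷ p) (_ ∷ ps) s≤n (s≤s s≤l) =
  there (∈-concatMap⁺ (λ j → map (suc j ∷_) (boundedLists l (n ∸ suc j)))
    (lose (∈-upTo⁺ (≤-trans (m≤m+n (suc x) (sum p)) s≤n))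
      (∈-map⁺ (suc x ∷_)
        (∈-boundedLists l (n ∸ suc x) p ps
          (≤-trans (≤-reflexive (sym (m+n∸m≡n (suc x) (sum p)))) (∸-monoˡ-≤ (suc x) s≤n))
          (≤-trans (m≤n+m (sum p) x) s≤l)))))

enumeration : ∀ d κ α n → Enumeration (Admissible d κ α n)
enumeration d κ α n = record
  { elements = deduplicate _≟ᴸ_ hits
  ; unique   = deduplicate-! _≟ᴸ_ hits
  ; complete = λ p → mk⇔
      (λ p∈ → proj₂ (∈-filter⁻ P? {xs = boundedLists n n} (∈-deduplicate⁻ _≟ᴸ_ hits p∈)))
      (λ adm → ∈-deduplicate⁺ _≟ᴸ_ (∈-filter⁺ P? (candidate adm) adm))
  }
  where
  _≟ᴸ_ = ≡-dec _≟_
  P?   = admissible? d κ α n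
  hits = filter P? (boundedLists n n)

  candidate : ∀ {p} → Admissible d κ α n p → p ∈ boundedLists n n
  candidate {p} (admissible (_ , ps , s≡n) _ _ _) =
    ∈-boundedLists n n p ps (≤-reflexive s≡n) (≤-reflexive s≡n)

B : (d κ α : ℕ) → ℕ → ℕ
B d κ α n = Enumeration.cardinality (enumeration d κ α n)

-- Formal power series in q over ℤ, given by their coefficients.
Series : Set
Series = ℕ → ℤ

infix  4 _≈_
infixl 6 _⊕_ _⊖_
infixl 7 _⊛_ _⊘_
infix  9 q^_

_≈_ : Series → Series → Set
f ≈ g = ∀ n → f n ≡ g n

Σ< : ℕ → (ℕ → ℤ) → ℤ
Σ< zero    F = 0ℤ
Σ< (suc n) F = Σ< n F ℤ.+ F n

q^_ : ℕ → Series
(q^ m) n = if does (m ≟ n) then 1ℤ else 0ℤ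

𝟙 : Series
𝟙 = q^ 0

_⊕_ _⊖_ _⊛_ : Series → Series → Series
(f ⊕ g) n = f n ℤ.+ g n
(f ⊖ g) n = f n ℤ.- g n
(f ⊛ g) n = Σ< (suc n) (λ i → f i ℤ.* g (n ∸ i))

pow : Series → ℕ → Series
pow f zero    = 𝟙
pow f (suc n) = pow f n ⊛ f

genFun : (ℕ → ℕ) → Series
genFun c n = + c n

-- The q-adic limit of a sequence satisfying Convergent (see lim-limit);
-- it carries no meaning for other sequences.
lim : (ℕ → Series) → Series
lim F n = F (suc n) n

Convergent : (ℕ → Series) → Set
Convergent F = ∀ N n → n < N → F (suc N) n ≡ F N n

-- geometric f N = Σ_{j ≤ N} (1 - f)^j, which converges to 1/f whenever f
-- has constant term 1 (see ⊛-inverseʳ); only such f are inverted.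
geometric : Series → ℕ → Series
geometric f zero    = 𝟙
geometric f (suc N) = 𝟙 ⊕ (𝟙 ⊖ f) ⊛ geometric f N

inverse : Series → Series
inverse f = lim (geometric f)

_⊘_ : Series → Series → Series
f ⊘ g = f ⊛ inverse g

-- (a;b)_n, (a;b)_∞ and (a₁,…,aᵣ;b)_∞. The infinite products converge
-- whenever b has zero constant term (see poch-convergent).
poch : Series → Series → ℕ → Series
poch a b zero    = 𝟙
poch a b (suc n) = poch a b n ⊛ (𝟙 ⊖ a ⊛ pow b n)

poch∞ : Series → Series → Series
poch∞ a b = lim (poch a b)

pochs∞ : List Series → Series → Series
pochs∞ as b = foldr _⊛_ 𝟙 (map (λ a → poch∞ a b) as)

lim-limit : ∀ {F} → Convergent F → ∀ {N n} → n < N → F N n ≡ lim F n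
lim-limit {F} conv {suc N} {n} (s≤s n≤N) with m≤n⇒m<n∨m≡n n≤N
... | inj₂ refl = refl
... | inj₁ n<N  = trans (conv N n n<N) (lim-limit conv n<N)

Σ<-cong : ∀ n {F G} → (∀ i → i < n → F i ≡ G i) → Σ< n F ≡ Σ< n G
Σ<-cong zero    h = refl
Σ<-cong (suc n) h =
  cong₂ ℤ._+_ (Σ<-cong n (λ i i<n → h i (m<n⇒m<1+n i<n))) (h n ≤-refl)

Σ<-zero : ∀ n {F} → (∀ i → i < n → F i ≡ 0ℤ) → Σ< n F ≡ 0ℤ
Σ<-zero zero    h = refl
Σ<-zero (suc n) h =
  cong₂ ℤ._+_ (Σ<-zero n (λ i i<n → h i (m<n⇒m<1+n i<n))) (h n ≤-refl)

Σ<-head : ∀ n {F} → (∀ i → i < n → F (suc i) ≡ 0ℤ) → Σ< (suc n) F ≡ F 0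
Σ<-head zero    {F} h = ℤ.+-identityˡ (F 0)
Σ<-head (suc n) {F} h =
  trans (cong₂ ℤ._+_ (Σ<-head n (λ i i<n → h i (m<n⇒m<1+n i<n))) (h n ≤-refl))
        (ℤ.+-identityʳ (F 0))

Σ<-+ : ∀ n {F G} → Σ< n F ℤ.+ Σ< n G ≡ Σ< n (λ i → F i ℤ.+ G i)
Σ<-+ zero    = refl
Σ<-+ (suc n) {F} {G} = trans (interchange (Σ< n F) (F n) (Σ< n G) (G n))
                             (cong (ℤ._+ (F n ℤ.+ G n)) (Σ<-+ n))
  where
  open import Algebra.Properties.CommutativeSemigroup ℤ.+-commutativeSemigroup using (interchange)

⊛-cong : ∀ n f f′ g g′ → (∀ i → i ≤ n → f i ≡ f′ i) → (∀ i → i ≤ n → g i ≡ g′ i) →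
         (f ⊛ g) n ≡ (f′ ⊛ g′) n
⊛-cong n f f′ g g′ hf hg =
  Σ<-cong (suc n) λ { i (s≤s i≤n) → cong₂ ℤ._*_ (hf i i≤n) (hg (n ∸ i) (m∸n≤m n i)) }

⊛-identityˡ : ∀ f → 𝟙 ⊛ f ≈ f
⊛-identityˡ f n = trans (Σ<-head n (λ i _ → ℤ.*-zeroˡ (f (n ∸ suc i)))) (ℤ.*-identityˡ (f n))

𝟙-pos : ∀ {n} → 0 < n → 𝟙 n ≡ 0ℤ
𝟙-pos {suc n} _ = refl

⊛-identityʳ : ∀ f → f ⊛ 𝟙 ≈ f
⊛-identityʳ f n = trans (cong₂ ℤ._+_
    (Σ<-zero n (λ i i<n → trans (cong (f i ℤ.*_) (𝟙-pos (m<n⇒0<n∸m i<n))) (ℤ.*-zeroʳ (f i))))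
    (trans (cong (λ j → f n ℤ.* 𝟙 j) (n∸n≡0 n)) (ℤ.*-identityʳ (f n))))
  (ℤ.+-identityˡ (f n))

⊛-distribʳ : ∀ f g h → (f ⊛ h) ⊕ (g ⊛ h) ≈ (f ⊕ g) ⊛ h
⊛-distribʳ f g h n = trans (Σ<-+ (suc n))
  (Σ<-cong (suc n) (λ i _ → sym (ℤ.*-distribʳ-+ (h (n ∸ i)) (f i) (g i))))

geometric-stable : ∀ f → f 0 ≡ 1ℤ → ∀ N n → n ≤ N → geometric f (suc N) n ≡ geometric f N n
geometric-stable f f₀ zero zero z≤n rewrite f₀ = refl
geometric-stable f f₀ (suc N) n n≤ =
  cong (λ z → 𝟙 n ℤ.+ z) (Σ<-cong (suc n) term)
  where
  term : ∀ i → i < suc n → (𝟙 ⊖ f) i ℤ.* geometric f (suc N) (n ∸ i)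
                         ≡ (𝟙 ⊖ f) i ℤ.* geometric f N (n ∸ i)
  term zero    _ rewrite f₀ = refl
  term (suc i) (s≤s i<n) = cong ((𝟙 ⊖ f) (suc i) ℤ.*_) (geometric-stable f f₀ N (n ∸ suc i)
    (≤-trans (∸-monoˡ-≤ (suc i) n≤) (m∸n≤m N i)))

geometric-convergent : ∀ f → f 0 ≡ 1ℤ → Convergent (geometric f)
geometric-convergent f f₀ N n n<N = geometric-stable f f₀ N n (<⇒≤ n<N)

⊛-inverseʳ : ∀ f → f 0 ≡ 1ℤ → f ⊛ inverse f ≈ 𝟙
⊛-inverseʳ f f₀ n = ∙-cancelʳ (((𝟙 ⊖ f) ⊛ S) n) _ _ (begin
  (f ⊛ inverse f) n ℤ.+ ((𝟙 ⊖ f) ⊛ S) n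
    ≡⟨ cong (ℤ._+ ((𝟙 ⊖ f) ⊛ S) n) (⊛-cong n f f (inverse f) S (λ _ _ → refl) (λ i i≤n → sym (lim-limit (geometric-convergent f f₀) (s≤s i≤n)))) ⟩
  (f ⊛ S) n ℤ.+ ((𝟙 ⊖ f) ⊛ S) n
    ≡⟨ ⊛-distribʳ f (𝟙 ⊖ f) S n ⟩
  ((f ⊕ (𝟙 ⊖ f)) ⊛ S) n
    ≡⟨ ⊛-cong n (f ⊕ (𝟙 ⊖ f)) 𝟙 S S (λ i _ → f+[1-f] (f i) (𝟙 i)) (λ _ _ → refl) ⟩
  (𝟙 ⊛ S) n
    ≡⟨ ⊛-identityˡ S n ⟩
  S n
    ≡⟨ geometric-stable f f₀ (suc n) n (n≤1+n n) ⟨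
  𝟙 n ℤ.+ ((𝟙 ⊖ f) ⊛ S) n ∎)
  where
  open ≡-Reasoning
  open import Algebra.Properties.AbelianGroup ℤ.+-0-abelianGroup using (∙-cancelʳ)
  S = geometric f (suc n)
  f+[1-f] : ∀ x y → x ℤ.+ (y ℤ.- x) ≡ y
  f+[1-f] x y = begin
    x ℤ.+ (y ℤ.- x)     ≡⟨ ℤ.+-comm x (y ℤ.- x) ⟩
    y ℤ.- x ℤ.+ x       ≡⟨ ℤ.+-assoc y (ℤ.- x) x ⟩
    y ℤ.+ (ℤ.- x ℤ.+ x) ≡⟨ cong (λ z → y ℤ.+ z) (ℤ.+-inverseˡ x) ⟩
    y ℤ.+ 0ℤ            ≡⟨ ℤ.+-identityʳ y ⟩
    y                   ∎

pow-vanishes : ∀ b → b 0 ≡ 0ℤ → ∀ j n → n < j → pow b j n ≡ 0ℤ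
pow-vanishes b b₀ (suc j) n (s≤s n≤j) = Σ<-zero (suc n) term
  where
  term : ∀ i → i < suc n → pow b j i ℤ.* b (n ∸ i) ≡ 0ℤ
  term i (s≤s i≤n) with <-≤-connex i j
  ... | inj₁ i<j = trans (cong (ℤ._* b (n ∸ i)) (pow-vanishes b b₀ j i i<j)) (ℤ.*-zeroˡ (b (n ∸ i)))
  ... | inj₂ j≤i = trans (cong (pow b j i ℤ.*_) (trans (cong b (m≤n⇒m∸n≡0 (≤-trans n≤j j≤i))) b₀))
                         (ℤ.*-zeroʳ (pow b j i))

poch-convergent : ∀ a b → b 0 ≡ 0ℤ → Convergent (poch a b)
poch-convergent a b b₀ N n n<N =
  trans (⊛-cong n (poch a b N) (poch a b N) (𝟙 ⊖ a ⊛ pow b N) 𝟙 (λ _ _ → refl) factor) (⊛-identityʳ (poch a b N) n)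
  where
  vanish : ∀ m → m ≤ n → (a ⊛ pow b N) m ≡ 0ℤ
  vanish m m≤n = Σ<-zero (suc m) λ i _ →
    trans (cong (a i ℤ.*_) (pow-vanishes b b₀ N (m ∸ i) (≤-<-trans (m∸n≤m m i) (≤-<-trans m≤n n<N))))
          (ℤ.*-zeroʳ (a i))

  factor : ∀ m → m ≤ n → (𝟙 ⊖ a ⊛ pow b N) m ≡ 𝟙 m
  factor m m≤n = trans (cong (λ z → 𝟙 m ℤ.- z) (vanish m m≤n)) (ℤ.+-identityʳ (𝟙 m))

{-# OPTIONS --safe #-}

-- Write φ_{2i} = d m_i and sum out the odd multiplicities: the generating function becomes
-- 1/(q;q²)_∞ times a sum over m₁, m₂, … ≤ k whose first factor 1 - q^min(α, K - d m₁), K = dk+e, is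
-- the only one involving α = da+f.  It is affine in q^α between consecutive values ≡ e (mod d), which
-- reduces everything to f = e.  There, peeling off m₁, m₂, … gives a linear recursion whose solution
-- is explicit: up to a factor 1/(q^{2d(j+1)};q^{2d})_∞, with Gaussian binomials in base q^d and
-- M = 2K+d, it is V^{2j}_{da+e}, where
--   V^s_A = Σ_n (-1)^n [s+n choose n] q^{sKn + M n(n-1)/2} (q^{(M-A)n} - q^{Mn + A(s+1+n)}),
--   V^s_{A+d} - V^s_A = q^{(s+1)A} (1 - q^{(s+1)d}) V^{s+1}_{K-A}.
-- The hypothesis e = d or 2e = d is what makes the recursion start correctly, through V^s_0 = 0 or
-- V^s_{-e} = -q^{-(s+1)e} V^s_e.  Finally V^0_A is a theta series, evaluated by Jacobi's triple product.
-- All limits are avoided by working modulo q^N for arbitrary N.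
module Submission where

open import Algebra.Bundles using (CommutativeRing)
import Algebra.Properties.CommutativeSemigroup
open import Algebra.Solver.Ring.AlmostCommutativeRing using (fromCommutativeRing; _-Raw-AlmostCommutative⟶_; Induced-equivalence)
open import Data.Bool.Base using (if_then_else_)
open import Data.Integer.Base as ℤ using (ℤ; +_; -[1+_]; 0ℤ; 1ℤ)
import Data.Integer.Properties as ℤ
open import Data.Integer.Tactic.RingSolver using () renaming (solve-∀ to ℤ-solve-∀)
open import Data.List.Base using (List; []; _∷_; _++_; map; replicate; length; filter)
open import Data.List.Membership.Propositional using (_∈_)
open import Data.List.Membership.Propositional.Properties using (∈-map⁺; ∈-map⁻; ∈-++⁺ˡ; ∈-++⁺ʳ; ∈-++⁻)
open import Data.List.Membership.Propositional.Properties.WithK using (unique∧set⇒bag)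
open import Data.List.Properties using (length-++; length-map; length-replicate; filter-++; filter-all; filter-none; ++-cancelʳ)
open import Data.List.Relation.Binary.BagAndSetEquality using (∼bag⇒↭)
open import Data.List.Relation.Binary.Permutation.Propositional.Properties using (↭-length)
open import Data.List.Relation.Unary.All as All using (All; []; _∷_)
import Data.List.Relation.Unary.All.Properties as All
open import Data.List.Relation.Unary.AllPairs using (AllPairs; []; _∷_)
import Data.List.Relation.Unary.AllPairs.Properties as AllPairs
open import Data.List.Relation.Unary.Any using (here)
open import Data.List.Relation.Unary.Linked.Properties using (AllPairs⇒Linked; Linked⇒AllPairs)
open import Data.List.Relation.Unary.Unique.Propositional using (Unique)
import Data.List.Relation.Unary.Unique.Propositional.Properties as Unique
open import Data.Maybe.Base using (just; nothing)
open import Data.Nat.Base as ℕ using (ℕ; zero; suc; _∸_; _⊓_; _≤_; _<_; _≥_; _>_; z≤n; s≤s)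
open import Data.Nat.Divisibility using (_∣_; _∣?_; divides; ∣m+n∣m⇒∣n; ∣⇒≤)
open import Data.Nat.ListAction using (sum)
open import Data.Nat.ListAction.Properties using (sum-++)
import Data.Nat.Properties as ℕ
open import Data.Nat.Tactic.RingSolver using (solve-∀)
open import Data.Sum.Base using (_⊎_; inj₁; inj₂; [_,_]′)
open import Function.Base using (_∘_)
open import Function.Bundles using (Equivalence; mk⇔)
open import Level using (0ℓ)
open import Relation.Binary.Definitions using (WeaklyDecidable; tri<; tri≈; tri>)
open import Relation.Binary.PropositionalEquality as ≡ using (_≡_; _≢_; ≢-sym)
open import Relation.Nullary using (Dec; yes; no; does; ¬_; contradiction)
open import Relation.Nullary.Decidable using (_→-dec_; dec-false)

-- The peeling recursion expresses stage j through stage j + 1, so it has no initial value; what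
-- singles out its solution is that both sides tend to 1 as j grows. Modulo q^N both are equal to 1
-- once j ≥ N, and induction descends from there to j = 0. The recursion is closed on the parameters
-- da + e with 0 ≤ a ≤ k, because every K - d m has this form; other residues f occur only at the
-- outermost stage. Since A ↦ K - A exchanges the residues 0 and e mod d, removing one odd and one
-- even part takes two steps of V, through the multiples of d and back. This is why only even s
-- appear in the solution, while both parities are needed in its verification. Two boundary cases
-- lie at the ends of the range of a. For f < e and a = 1 the index 0 is needed, which the recursion
-- covers. For f > e and a = k the index k + 1 is needed: there the bound on φ_1 already follows
-- from φ_1 + φ_2 < K, and the symmetry A ↔ M - A of the product gives the same value. Denominators
-- are cleared throughout, so that the argument works in any commutative ring with a nilpotent q.

module IntegerCoefficients (R : CommutativeRing 0ℓ 0ℓ) where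
  open CommutativeRing R
  open import Algebra.Properties.Ring ring using (-‿distribˡ-*; -‿distribʳ-*; -0#≈0#; -‿involutive; -‿+-comm)
  open import Algebra.Properties.Semiring.Mult.TCOptimised semiring using (_×_; ×-homo-+; ×1-homo-*; 1+×)
  open import Algebra.Properties.CommutativeSemigroup +-commutativeSemigroup using (interchange)
  open import Relation.Binary.Reasoning.Setoid setoid

  -- Equality in an abstract ring is not decidable, so the solver takes its coefficients from ℤ,
  -- through the canonical homomorphism into the ring.
  ⟦_⟧ℤ : ℤ → Carrier
  ⟦ + n ⟧ℤ      = n × 1#
  ⟦ -[1+ n ] ⟧ℤ = - (suc n × 1#)

  ⟦⊖⟧ : ∀ m n → ⟦ m ℤ.⊖ n ⟧ℤ ≈ m × 1# - n × 1#
  ⟦⊖⟧ m       zero    = sym (trans (+-congˡ -0#≈0#) (+-identityʳ _))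
  ⟦⊖⟧ zero    (suc n) = sym (+-identityˡ _)
  ⟦⊖⟧ (suc m) (suc n) = begin
    ⟦ suc m ℤ.⊖ suc n ⟧ℤ                   ≡⟨ ≡.cong ⟦_⟧ℤ (ℤ.[1+m]⊖[1+n]≡m⊖n m n) ⟩
    ⟦ m ℤ.⊖ n ⟧ℤ                           ≈⟨ ⟦⊖⟧ m n ⟩
    m × 1# - n × 1#                      ≈⟨ +-identityˡ _ ⟨
    0# + (m × 1# - n × 1#)               ≈⟨ +-congʳ (-‿inverseʳ 1#) ⟨
    (1# - 1#) + (m × 1# - n × 1#)        ≈⟨ interchange 1# (- 1#) (m × 1#) (- (n × 1#)) ⟩
    (1# + m × 1#) + (- 1# - n × 1#)      ≈⟨ +-congˡ (-‿+-comm 1# (n × 1#)) ⟩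
    (1# + m × 1#) - (1# + n × 1#)        ≈⟨ +-cong (1+× m 1#) (-‿cong (1+× n 1#)) ⟨
    suc m × 1# - suc n × 1#              ∎

  ⟦-⟧ : ∀ i → ⟦ ℤ.- i ⟧ℤ ≈ - ⟦ i ⟧ℤ
  ⟦-⟧ (+ zero)   = sym -0#≈0#
  ⟦-⟧ (+ suc n)  = refl
  ⟦-⟧ -[1+ n ]   = sym (-‿involutive _)

  ⟦+⟧ : ∀ i j → ⟦ i ℤ.+ j ⟧ℤ ≈ ⟦ i ⟧ℤ + ⟦ j ⟧ℤ
  ⟦+⟧ (+ m)    (+ n)    = ×-homo-+ 1# m n
  ⟦+⟧ (+ m)    -[1+ n ] = ⟦⊖⟧ m (suc n)
  ⟦+⟧ -[1+ m ] (+ n)    = trans (⟦⊖⟧ n (suc m)) (+-comm _ _)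
  ⟦+⟧ -[1+ m ] -[1+ n ] = begin
    - (suc (suc (m ℕ.+ n)) × 1#)    ≡⟨ ≡.cong (λ z → - (z × 1#)) (ℕ.+-suc (suc m) n) ⟨
    - ((suc m ℕ.+ suc n) × 1#)      ≈⟨ -‿cong (×-homo-+ 1# (suc m) (suc n)) ⟩
    - (suc m × 1# + suc n × 1#)     ≈⟨ -‿+-comm _ _ ⟨
    - (suc m × 1#) - (suc n × 1#)   ∎

  ⟦+*⟧ : ∀ m j → ⟦ + m ℤ.* j ⟧ℤ ≈ ⟦ + m ⟧ℤ * ⟦ j ⟧ℤ
  ⟦+*⟧ m (+ n)    = trans (reflexive (≡.cong ⟦_⟧ℤ (≡.sym (ℤ.pos-* m n)))) (×1-homo-* m n)
  ⟦+*⟧ m -[1+ n ] = begin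
    ⟦ + m ℤ.* -[1+ n ] ⟧ℤ           ≡⟨ ≡.cong ⟦_⟧ℤ (ℤ.neg-distribʳ-* (+ m) (+ suc n)) ⟨
    ⟦ ℤ.- (+ m ℤ.* + suc n) ⟧ℤ      ≈⟨ ⟦-⟧ (+ m ℤ.* + suc n) ⟩
    - ⟦ + m ℤ.* + suc n ⟧ℤ          ≈⟨ -‿cong (⟦+*⟧ m (+ suc n)) ⟩
    - (⟦ + m ⟧ℤ * ⟦ + suc n ⟧ℤ)     ≈⟨ -‿distribʳ-* _ _ ⟩
    ⟦ + m ⟧ℤ * ⟦ -[1+ n ] ⟧ℤ        ∎

  ⟦*⟧ : ∀ i j → ⟦ i ℤ.* j ⟧ℤ ≈ ⟦ i ⟧ℤ * ⟦ j ⟧ℤ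
  ⟦*⟧ (+ m)    j = ⟦+*⟧ m j
  ⟦*⟧ -[1+ m ] j = begin
    ⟦ -[1+ m ] ℤ.* j ⟧ℤ             ≡⟨ ≡.cong ⟦_⟧ℤ (ℤ.neg-distribˡ-* (+ suc m) j) ⟨
    ⟦ ℤ.- (+ suc m ℤ.* j) ⟧ℤ        ≈⟨ ⟦-⟧ (+ suc m ℤ.* j) ⟩
    - ⟦ + suc m ℤ.* j ⟧ℤ            ≈⟨ -‿cong (⟦+*⟧ (suc m) j) ⟩
    - (⟦ + suc m ⟧ℤ * ⟦ j ⟧ℤ)       ≈⟨ -‿distribˡ-* _ _ ⟩
    ⟦ -[1+ m ] ⟧ℤ * ⟦ j ⟧ℤ          ∎

  morphism : ℤ.+-*-rawRing -Raw-AlmostCommutative⟶ fromCommutativeRing R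
  morphism = record
    { ⟦_⟧ = ⟦_⟧ℤ ; +-homo = ⟦+⟧ ; *-homo = ⟦*⟧ ; -‿homo = ⟦-⟧ ; 0-homo = refl ; 1-homo = refl }

  coefficient≟ : WeaklyDecidable (Induced-equivalence morphism)
  coefficient≟ i j with i ℤ.≟ j
  ... | yes i≡j = just (reflexive (≡.cong ⟦_⟧ℤ i≡j))
  ... | no  _   = nothing

  open import Algebra.Solver.Ring ℤ.+-*-rawRing (fromCommutativeRing R) morphism coefficient≟ public
    using (Polynomial; solve; _:=_; _:+_; _:*_; _:-_; :-_; con)

  :0 :1 : ∀ {n} → Polynomial n
  :0 = con (+ 0)
  :1 = con (+ 1)

-- Division by units, and auxiliary arithmetic

module Division (R : CommutativeRing 0ℓ 0ℓ) where
  open CommutativeRing R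
  open IntegerCoefficients R
  open import Relation.Binary.Reasoning.Setoid setoid

  divide : ∀ D D⁻¹ G P → D * D⁻¹ ≈ 1# → D * G ≈ P → G ≈ P * D⁻¹
  divide D D⁻¹ G P D-inv DG≈P = begin
    G                        ≈⟨ *-identityʳ G ⟨
    G * 1#                  ≈⟨ *-congˡ D-inv ⟨
    G * (D * D⁻¹)          ≈⟨ solve 3 (λ D D⁻¹ G → G :* (D :* D⁻¹) := D :* G :* D⁻¹) refl D D⁻¹ G ⟩
    D * G * D⁻¹            ≈⟨ *-congʳ DG≈P ⟩
    P * D⁻¹                 ∎

  -- The conclusion keeps the shape in which the theorem writes its quotients, with `1# * D⁻¹` for
  -- `𝟙 ⊘ denom` and `y` for 1 - q^d.
  divide-combination : ∀ D D⁻¹ y y⁻¹ G x z P P′ → D * D⁻¹ ≈ 1# → y * y⁻¹ ≈ 1# →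
    y * (D * G) ≈ x * P + z * P′ → G ≈ (1# * D⁻¹) * ((x * y⁻¹) * P + (z * y⁻¹) * P′)
  divide-combination D D⁻¹ y y⁻¹ G x z P P′ D-inv y-inv h = begin
    G
      ≈⟨ divide D D⁻¹ G _ D-inv (divide y y⁻¹ (D * G) _ y-inv h) ⟩
    (x * P + z * P′) * y⁻¹ * D⁻¹
      ≈⟨ solve 6 (λ x z P P′ y⁻¹ D⁻¹ → (x :* P :+ z :* P′) :* y⁻¹ :* D⁻¹ := (:1 :* D⁻¹) :* ((x :* y⁻¹) :* P :+ (z :* y⁻¹) :* P′)) refl x z P P′ y⁻¹ D⁻¹ ⟩
    (1# * D⁻¹) * ((x * y⁻¹) * P + (z * y⁻¹) * P′) ∎

-- This is n(n-1)/2, the exponent in theta series, rather than n(n+1)/2.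
tri : ℕ → ℕ
tri zero    = 0
tri (suc n) = tri n ℕ.+ n

-- In contrast to `2 * n`, it unfolds to two successors, so a recursion over the parts advances by
-- one odd and one even part definitionally.
double : ℕ → ℕ
double zero    = 0
double (suc n) = suc (suc (double n))

double≡2* : ∀ n → double n ≡ 2 ℕ.* n
double≡2* zero    = ≡.refl
double≡2* (suc n) = ≡.trans (≡.cong (λ z → suc (suc z)) (double≡2* n)) (≡.sym (ℕ.*-suc 2 n))

m≤double : ∀ m → m ≤ double m
m≤double zero    = z≤n
m≤double (suc m) = s≤s (ℕ.m≤n⇒m≤1+n (m≤double m))

2∣double : ∀ n → 2 ∣ double n
2∣double n = divides n (≡.trans (double≡2* n) (ℕ.*-comm 2 n))

2∤1+double : ∀ n → ¬ 2 ∣ suc (double n)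
2∤1+double n 2∣1+2n = contradiction
  (∣⇒≤ (∣m+n∣m⇒∣n (≡.subst (2 ∣_) (ℕ.+-comm 1 (double n)) 2∣1+2n) (2∣double n))) λ { (s≤s ()) }

-- Both inequalities amount to `m + o < n`.
<-∸-swap : ∀ {m n o} → m < n ∸ o → o < n ∸ m
<-∸-swap {m} {n} {o} m<n∸o = ℕ.m+n≤o⇒m≤o∸n (suc o) (≡.subst (λ z → suc z ≤ n) (ℕ.+-comm m o)
  (ℕ.m≤o∸n⇒m+n≤o (suc m) (ℕ.<⇒≤ (ℕ.m∸n≢0⇒n<m λ n∸o≡0 → ℕ.n≮0 (≡.subst (m <_) n∸o≡0 m<n∸o))) m<n∸o))

-- The implication is vacuous for odd i, which lets a single recursion treat odd and even parts.
Allowed : ℕ → ℕ → ℕ → Set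
Allowed d i m = 2 ∣ i → d ∣ m

allowed? : ∀ d i m → Dec (Allowed d i m)
allowed? d i m = (2 ∣? i) →-dec (d ∣? m)

-- Powers of q in a ring where q^N vanishes

record TruncatedPowers (R : CommutativeRing 0ℓ 0ℓ) (N : ℕ) : Set where
  open CommutativeRing R
  field
    q^_         : ℕ → Carrier
    q^-0        : q^ 0 ≈ 1#
    q^-+        : ∀ m n → q^ (m ℕ.+ n) ≈ q^ m * q^ n
    q^-vanishes : ∀ m → N ≤ m → q^ m ≈ 0#

module TruncatedSeries (R : CommutativeRing 0ℓ 0ℓ) (N : ℕ) (powers : TruncatedPowers R N) where
  open CommutativeRing R
  open TruncatedPowers powers
  open IntegerCoefficients R
  open import Relation.Binary.Reasoning.Setoid setoid
  open import Algebra.Properties.Ring ring using (-0#≈0#)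

  q^-cong : ∀ {m n} → m ≡ n → q^ m ≈ q^ n
  q^-cong ≡.refl = refl

  q^-split : ∀ {m} n p → m ≡ n ℕ.+ p → q^ m ≈ q^ n * q^ p
  q^-split n p eq = trans (q^-cong eq) (q^-+ n p)

  ∑ : ℕ → (ℕ → Carrier) → Carrier
  ∑ zero    f = 0#
  ∑ (suc n) f = ∑ n f + f n

  ∑-cong< : ∀ n {f g} → (∀ i → i < n → f i ≈ g i) → ∑ n f ≈ ∑ n g
  ∑-cong< zero    h = refl
  ∑-cong< (suc n) h = +-cong (∑-cong< n (λ i i<n → h i (ℕ.m<n⇒m<1+n i<n))) (h n ℕ.≤-refl)

  ∑-cong : ∀ n {f g} → (∀ i → f i ≈ g i) → ∑ n f ≈ ∑ n g
  ∑-cong n h = ∑-cong< n (λ i _ → h i)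

  ∑-+ : ∀ n f g → ∑ n (λ i → f i + g i) ≈ ∑ n f + ∑ n g
  ∑-+ zero    f g = sym (+-identityˡ 0#)
  ∑-+ (suc n) f g = trans (+-congʳ (∑-+ n f g))
    (solve 4 (λ a b c d → (a :+ b) :+ (c :+ d) := (a :+ c) :+ (b :+ d)) refl (∑ n f) (∑ n g) (f n) (g n))

  ∑-* : ∀ n c f → c * ∑ n f ≈ ∑ n (λ i → c * f i)
  ∑-* zero    c f = zeroʳ c
  ∑-* (suc n) c f = trans (distribˡ c (∑ n f) (f n)) (+-congʳ (∑-* n c f))

  ∑-zero : ∀ n {f} → (∀ i → f i ≈ 0#) → ∑ n f ≈ 0#
  ∑-zero zero    h = refl
  ∑-zero (suc n) h = trans (+-cong (∑-zero n h) (h n)) (+-identityˡ 0#)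

  ∑-head : ∀ n f → ∑ (suc n) f ≈ f 0 + ∑ n (λ i → f (suc i))
  ∑-head zero    f = +-comm 0# (f 0)
  ∑-head (suc n) f = trans (+-congʳ (∑-head n f)) (+-assoc _ _ _)

  ∑-shift : ∀ n f → f 0 ≈ 0# → f n ≈ 0# → ∑ n f ≈ ∑ n (λ i → f (suc i))
  ∑-shift n f f0 fn = begin
    ∑ n f                            ≈⟨ +-identityʳ _ ⟨
    ∑ n f + 0#                       ≈⟨ +-congˡ fn ⟨
    ∑ (suc n) f                      ≈⟨ ∑-head n f ⟩
    f 0 + ∑ n (λ i → f (suc i))      ≈⟨ +-congʳ f0 ⟩
    0# + ∑ n (λ i → f (suc i))       ≈⟨ +-identityˡ _ ⟩
    ∑ n (λ i → f (suc i))            ∎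

  σ : ℕ → Carrier
  σ zero    = 1#
  σ (suc n) = - σ n

  -- Gaussian binomials in base q^d

  module Gaussian (d : ℕ) where

    private
      X : ℕ → Carrier
      X n = q^ (n ℕ.* d)

      X-+ : ∀ m n → X (m ℕ.+ n) ≈ X m * X n
      X-+ m n = q^-split _ _ (ℕ.*-distribʳ-+ d m n)

    -- [ s + n choose n ] in base q^d.
    gauss : ℕ → ℕ → Carrier
    gauss zero    n       = 1#
    gauss (suc s) zero    = 1#
    gauss (suc s) (suc n) = gauss s (suc n) + X (suc s) * gauss (suc s) n

    gauss-0 : ∀ s → gauss s 0 ≈ 1#
    gauss-0 zero    = refl
    gauss-0 (suc s) = refl

    -- The two ratio rules, with denominators cleared. They need each other: after the Pascal
    -- recursion, the rules at (s , n) together trade one of the two summands for a multiple of the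
    -- other, and the coefficients add up to 1 - q^((s+n+2)d).
    gauss-sucʳ : ∀ s n → (1# - q^ (suc n ℕ.* d)) * gauss s (suc n) ≈ (1# - q^ (suc (s ℕ.+ n) ℕ.* d)) * gauss s n
    gauss-sucˡ : ∀ s n → (1# - q^ (suc s ℕ.* d)) * gauss (suc s) n ≈ (1# - q^ (suc (s ℕ.+ n) ℕ.* d)) * gauss s n

    gauss-sucʳ zero    n = refl
    gauss-sucʳ (suc s) n = begin
      (1# - X (suc n)) * (gauss s (suc n) + X (suc s) * gauss (suc s) n)
        ≈⟨ solve 4 (λ x y g h → (:1 :- x) :* (g :+ y :* h) := (:1 :- x) :* g :+ (:1 :- x) :* y :* h) refl _ _ _ _ ⟩
      (1# - X (suc n)) * gauss s (suc n) + (1# - X (suc n)) * X (suc s) * gauss (suc s) n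
        ≈⟨ +-congʳ (trans (gauss-sucʳ s n) (sym (gauss-sucˡ s n))) ⟩
      (1# - X (suc s)) * gauss (suc s) n + (1# - X (suc n)) * X (suc s) * gauss (suc s) n
        ≈⟨ solve 3 (λ x y h → (:1 :- y) :* h :+ (:1 :- x) :* y :* h := (:1 :- y :* x) :* h) refl _ _ _ ⟩
      (1# - X (suc s) * X (suc n)) * gauss (suc s) n
        ≈⟨ *-congʳ (+-congˡ (-‿cong (trans (q^-cong (≡.cong (ℕ._* d) (≡.cong suc (≡.sym (ℕ.+-suc s n))))) (X-+ (suc s) (suc n))))) ⟨
      (1# - X (suc (suc s ℕ.+ n))) * gauss (suc s) n ∎

    gauss-sucˡ s zero    = *-cong (+-congˡ (-‿cong (q^-cong (≡.cong (ℕ._* d) (≡.cong suc (≡.sym (ℕ.+-identityʳ s))))))) (sym (gauss-0 s))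
    gauss-sucˡ s (suc n) = begin
      (1# - X (suc s)) * (gauss s (suc n) + X (suc s) * gauss (suc s) n)
        ≈⟨ solve 3 (λ y g h → (:1 :- y) :* (g :+ y :* h) := (:1 :- y) :* g :+ y :* ((:1 :- y) :* h)) refl _ _ _ ⟩
      (1# - X (suc s)) * gauss s (suc n) + X (suc s) * ((1# - X (suc s)) * gauss (suc s) n)
        ≈⟨ +-congˡ (*-congˡ (trans (gauss-sucˡ s n) (sym (gauss-sucʳ s n)))) ⟩
      (1# - X (suc s)) * gauss s (suc n) + X (suc s) * ((1# - X (suc n)) * gauss s (suc n))
        ≈⟨ solve 3 (λ x y h → (:1 :- y) :* h :+ y :* ((:1 :- x) :* h) := (:1 :- y :* x) :* h) refl _ _ _ ⟩
      (1# - X (suc s) * X (suc n)) * gauss s (suc n)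
        ≈⟨ *-congʳ (+-congˡ (-‿cong (X-+ (suc s) (suc n)))) ⟨
      (1# - X (suc (s ℕ.+ suc n))) * gauss s (suc n) ∎

    -- Shifting the x-part by one index, gauss-sucʳ and gauss-sucˡ bring both parts to the common factor
    -- 1 - q^((s+1)d).
    gauss-step : ∀ s (x y : ℕ → ℕ) → N ≤ x (suc N) →
      ∑ (suc N) (λ n → σ n * gauss s n * ((1# - q^ (n ℕ.* d)) * q^ (x n) + (1# - q^ (suc (s ℕ.+ n) ℕ.* d)) * q^ (y n)))
        ≈ (1# - q^ (suc s ℕ.* d)) * ∑ (suc N) (λ n → σ n * gauss (suc s) n * (q^ (y n) - q^ (x (suc n))))
    gauss-step s x y N≤x = begin
      ∑ (suc N) (λ n → σ n * gauss s n * ((1# - X n) * q^ (x n) + (1# - X (suc (s ℕ.+ n))) * q^ (y n)))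
        ≈⟨ ∑-cong (suc N) (λ n → distribˡ _ _ _) ⟩
      ∑ (suc N) (λ n → α n + β n)
        ≈⟨ ∑-+ (suc N) α β ⟩
      ∑ (suc N) α + ∑ (suc N) β
        -- The shift loses nothing at either end: the term 0 contains 1 - q^0, and the exponent at N
        -- + 1 is at least `N`.
        ≈⟨ +-congʳ (∑-shift (suc N) α α0 αN) ⟩
      ∑ (suc N) (λ n → α (suc n)) + ∑ (suc N) β
        ≈⟨ ∑-+ (suc N) (λ n → α (suc n)) β ⟨
      ∑ (suc N) (λ n → α (suc n) + β n)
        ≈⟨ ∑-cong (suc N) term ⟩
      ∑ (suc N) (λ n → (1# - X (suc s)) * (σ n * gauss (suc s) n * (q^ (y n) - q^ (x (suc n)))))
        ≈⟨ ∑-* (suc N) _ _ ⟨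
      (1# - X (suc s)) * ∑ (suc N) (λ n → σ n * gauss (suc s) n * (q^ (y n) - q^ (x (suc n)))) ∎
      where
      α β : ℕ → Carrier
      α n = σ n * gauss s n * ((1# - X n) * q^ (x n))
      β n = σ n * gauss s n * ((1# - X (suc (s ℕ.+ n))) * q^ (y n))

      α0 : α 0 ≈ 0#
      α0 = begin
        σ 0 * gauss s 0 * ((1# - X 0) * q^ (x 0)) ≈⟨ *-congˡ (*-congʳ (+-congˡ (-‿cong q^-0))) ⟩
        σ 0 * gauss s 0 * ((1# - 1#) * q^ (x 0))  ≈⟨ solve 2 (λ a b → a :* ((:1 :- :1) :* b) := :0) refl _ _ ⟩
        0# ∎

      αN : α (suc N) ≈ 0#
      αN = trans (*-congˡ (trans (*-congˡ (q^-vanishes _ N≤x)) (zeroʳ _))) (zeroʳ _)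

      term : ∀ n → α (suc n) + β n ≈ (1# - X (suc s)) * (σ n * gauss (suc s) n * (q^ (y n) - q^ (x (suc n))))
      term n = begin
        - σ n * gauss s (suc n) * ((1# - X (suc n)) * q^ (x (suc n))) + σ n * gauss s n * ((1# - X (suc (s ℕ.+ n))) * q^ (y n))
          ≈⟨ solve 7 (λ c g t u h v w → :- c :* g :* (t :* u) :+ c :* h :* (v :* w) := c :* (v :* h) :* w :- c :* (t :* g) :* u) refl _ _ _ _ _ _ _ ⟩
        σ n * ((1# - X (suc (s ℕ.+ n))) * gauss s n) * q^ (y n) - σ n * ((1# - X (suc n)) * gauss s (suc n)) * q^ (x (suc n))
          ≈⟨ +-cong (*-congʳ (*-congˡ (sym (gauss-sucˡ s n)))) (-‿cong (*-congʳ (*-congˡ (trans (gauss-sucʳ s n) (sym (gauss-sucˡ s n)))))) ⟩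
        σ n * ((1# - X (suc s)) * gauss (suc s) n) * q^ (y n) - σ n * ((1# - X (suc s)) * gauss (suc s) n) * q^ (x (suc n))
          ≈⟨ solve 5 (λ c t g u v → c :* (t :* g) :* u :- c :* (t :* g) :* v := t :* (c :* g :* (u :- v))) refl _ _ _ _ _ ⟩
        (1# - X (suc s)) * (σ n * gauss (suc s) n * (q^ (y n) - q^ (x (suc n)))) ∎

  -- Finite products and q-shifted factorials

  ∏ : ℕ → (ℕ → Carrier) → Carrier
  ∏ zero    f = 1#
  ∏ (suc n) f = ∏ n f * f n

  ∏-cong : ∀ n {f g} → (∀ i → f i ≈ g i) → ∏ n f ≈ ∏ n g
  ∏-cong zero    h = refl
  ∏-cong (suc n) h = *-cong (∏-cong n h) (h n)

  ∏-head : ∀ n f → ∏ (suc n) f ≈ f 0 * ∏ n (λ i → f (suc i))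
  ∏-head zero    f = *-comm 1# (f 0)
  ∏-head (suc n) f = trans (*-congʳ (∏-head n f)) (*-assoc _ _ _)

  ∏-* : ∀ n f g → ∏ n (λ i → f i * g i) ≈ ∏ n f * ∏ n g
  ∏-* zero    f g = sym (*-identityˡ 1#)
  ∏-* (suc n) f g = trans (*-congʳ (∏-* n f g))
    (solve 4 (λ a b c d → (a :* b) :* (c :* d) := (a :* c) :* (b :* d)) refl (∏ n f) (∏ n g) (f n) (g n))

  1-q^-vanishes : ∀ {m} → N ≤ m → 1# - q^ m ≈ 1#
  1-q^-vanishes N≤m = trans (+-congˡ (trans (-‿cong (q^-vanishes _ N≤m)) -0#≈0#)) (+-identityʳ 1#)

  *q^-vanishes : ∀ c {m} → N ≤ m → c * q^ m ≈ 0#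
  *q^-vanishes c N≤m = trans (*-congˡ (q^-vanishes _ N≤m)) (zeroʳ c)

  -- (q^a ; q^M)_n
  qpoch : ℕ → ℕ → ℕ → Carrier
  qpoch M a n = ∏ n (λ i → 1# - q^ (a ℕ.+ M ℕ.* i))

  -- Each factor subtracts a power q^(a + M i) from 1, and q^x times that power already vanishes.
  qpoch-absorbed : ∀ M x a n → N ≤ x ℕ.+ a → q^ x * qpoch M a n ≈ q^ x
  qpoch-absorbed M x a zero    _ = *-identityʳ _
  qpoch-absorbed M x a (suc n) h = begin
    q^ x * (qpoch M a n * (1# - q^ b))   ≈⟨ solve 3 (λ x p b → x :* (p :* (:1 :- b)) := x :* p :- p :* (x :* b)) refl _ _ _ ⟩
    q^ x * qpoch M a n - qpoch M a n * (q^ x * q^ b)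
      ≈⟨ +-cong (qpoch-absorbed M x a n h) (-‿cong (trans (*-congˡ (sym (q^-+ x b))) (*q^-vanishes _ N≤x+b))) ⟩
    q^ x - 0#                            ≈⟨ +-congˡ -0#≈0# ⟩
    q^ x + 0#                            ≈⟨ +-identityʳ _ ⟩
    q^ x                                 ∎
    where
    b = a ℕ.+ M ℕ.* n
    N≤x+b : N ≤ x ℕ.+ b
    N≤x+b = ℕ.≤-trans h (ℕ.+-monoʳ-≤ x (ℕ.m≤m+n a _))

  -- Jacobi's triple product modulo q^N

  module JacobiTripleProduct (M : ℕ) (1≤M : 1 ≤ M) where

    private
      m≤M*m : ∀ m → m ≤ M ℕ.* m
      m≤M*m m = ℕ.≤-trans (ℕ.≤-reflexive (≡.sym (ℕ.*-identityˡ m))) (ℕ.*-monoˡ-≤ m 1≤M)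

      -- (q^(M l) ; q^M)_∞ modulo q^N
      ph : ℕ → Carrier
      ph l = qpoch M (M ℕ.* l) (suc N)

      ph-suc : ∀ l → ph l ≈ (1# - q^ (M ℕ.* l)) * ph (suc l)
      ph-suc l = begin
        ph l
          ≈⟨ ∏-head N _ ⟩
        (1# - q^ (M ℕ.* l ℕ.+ M ℕ.* 0)) * ∏ N (λ i → 1# - q^ (M ℕ.* l ℕ.+ M ℕ.* suc i))
          ≈⟨ *-cong (+-congˡ (-‿cong (q^-cong (e₀ M l)))) (∏-cong N (λ i → +-congˡ (-‿cong (q^-cong (e₁ M l i))))) ⟩
        (1# - q^ (M ℕ.* l)) * qpoch M (M ℕ.* suc l) N
          -- The factor that restores the length `suc N` is 1, its exponent being at least `N`.
          ≈⟨ *-congˡ (trans (*-congˡ (1-q^-vanishes N≤)) (*-identityʳ _)) ⟨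
        (1# - q^ (M ℕ.* l)) * ph (suc l) ∎
        where
        e₀ : ∀ M l → M ℕ.* l ℕ.+ M ℕ.* 0 ≡ M ℕ.* l
        e₀ = solve-∀
        e₁ : ∀ M l i → M ℕ.* l ℕ.+ M ℕ.* suc i ≡ M ℕ.* suc l ℕ.+ M ℕ.* i
        e₁ = solve-∀
        N≤ : N ≤ M ℕ.* suc l ℕ.+ M ℕ.* N
        N≤ = ℕ.≤-trans (m≤M*m N) (ℕ.m≤n+m _ _)

      -- `ph (suc l)` plays the part of 1/(q^M ; q^M)_l, scaled by (q^M ; q^M)_∞ so that nothing has
      -- to be inverted; `ph-0` is then the convention that this reciprocal is 0 at l = -1.
      ph-0 : ph 0 ≈ 0#
      ph-0 = begin
        ph 0                               ≈⟨ ph-suc 0 ⟩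
        (1# - q^ (M ℕ.* 0)) * ph 1         ≈⟨ *-congʳ (+-congˡ (-‿cong (trans (q^-cong (ℕ.*-zeroʳ M)) q^-0))) ⟩
        (1# - 1#) * ph 1                   ≈⟨ solve 1 (λ x → (:1 :- :1) :* x := :0) refl _ ⟩
        0#                                 ∎

      ph-expand : ∀ l → ph (suc l) ≈ ph l + q^ (M ℕ.* l) * ph (suc l)
      ph-expand l = trans
        (solve 2 (λ x p → p := (:1 :- x) :* p :+ x :* p) refl (q^ (M ℕ.* l)) (ph (suc l)))
        (+-congʳ (sym (ph-suc l)))

      -- Summation by parts: `ph-expand` splits every weight, and in the half with `ph l` the term l
      -- = 0 drops out and the index moves by one. Both Euler's sum and the theta sum acquire their
      -- product factors in this way.
      ∑-ph : ∀ n (a : ℕ → Carrier) →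
        ∑ (suc n) (λ l → a l * ph (suc l)) ≈
          ∑ n (λ l → a (suc l) * ph (suc l)) + ∑ (suc n) (λ l → a l * q^ (M ℕ.* l) * ph (suc l))
      ∑-ph n a = begin
        ∑ (suc n) (λ l → a l * ph (suc l))
          ≈⟨ ∑-cong (suc n) (λ l → trans (*-congˡ (ph-expand l)) (trans (distribˡ _ _ _) (+-congˡ (sym (*-assoc _ _ _))))) ⟩
        ∑ (suc n) (λ l → a l * ph l + a l * q^ (M ℕ.* l) * ph (suc l))
          ≈⟨ ∑-+ (suc n) _ _ ⟩
        ∑ (suc n) (λ l → a l * ph l) + ∑ (suc n) (λ l → a l * q^ (M ℕ.* l) * ph (suc l))
          ≈⟨ +-congʳ (trans (∑-head n _) (trans (+-congʳ (trans (*-congˡ ph-0) (zeroʳ _))) (+-identityˡ _))) ⟩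
        ∑ n (λ l → a (suc l) * ph (suc l)) + ∑ (suc n) (λ l → a l * q^ (M ℕ.* l) * ph (suc l)) ∎

    private
      -- Euler's expansion of (q^B ; q^M)_∞ (q^M ; q^M)_∞, to be evaluated by iterating B ↦ B + M.
      S : ℕ → Carrier
      S B = ∑ (suc N) (λ l → σ l * q^ (M ℕ.* tri l ℕ.+ B ℕ.* l) * ph (suc l))

      -- In `∑-ph`, the factor q^(M l) of the second half turns B into B + M, while the shifted half
      -- becomes - q^B times the same sum; its missing last term vanishes because B(N + 1) ≥ N.
      S-step : ∀ B → 1 ≤ B → S B ≈ (1# - q^ B) * S (B ℕ.+ M)
      S-step B 1≤B = begin
        S B
          ≈⟨ ∑-ph N _ ⟩
        ∑ N (λ l → a (suc l) * ph (suc l)) + ∑ (suc N) (λ l → a l * q^ (M ℕ.* l) * ph (suc l))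
          ≈⟨ +-cong (trans (sym (+-identityʳ _)) (+-congˡ (sym last)))
                    (∑-cong (suc N) (λ l → *-congʳ (trans (*-assoc _ _ _) (*-congˡ (sym (q^-split _ _ (e₂ M B l (tri l)))))))) ⟩
        ∑ (suc N) (λ l → a (suc l) * ph (suc l)) + S (B ℕ.+ M)
          ≈⟨ +-congʳ (trans (∑-cong (suc N) first) (sym (∑-* (suc N) _ _))) ⟩
        - q^ B * S (B ℕ.+ M) + S (B ℕ.+ M)
          ≈⟨ solve 2 (λ b s → :- b :* s :+ s := (:1 :- b) :* s) refl _ _ ⟩
        (1# - q^ B) * S (B ℕ.+ M) ∎
        where
        a : ℕ → Carrier
        a l = σ l * q^ (M ℕ.* tri l ℕ.+ B ℕ.* l)

        e₂ : ∀ M B l t → M ℕ.* t ℕ.+ (B ℕ.+ M) ℕ.* l ≡ M ℕ.* t ℕ.+ B ℕ.* l ℕ.+ M ℕ.* l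
        e₂ = solve-∀

        e₃ : ∀ M B l t → M ℕ.* (t ℕ.+ l) ℕ.+ B ℕ.* suc l ≡ B ℕ.+ (M ℕ.* t ℕ.+ (B ℕ.+ M) ℕ.* l)
        e₃ = solve-∀

        last : a (suc N) * ph (suc N) ≈ 0#
        last = trans (*-congʳ (*q^-vanishes _ (ℕ.≤-trans (ℕ.≤-trans (ℕ.n≤1+n N) (ℕ.m≤n*m (suc N) B {{ℕ.>-nonZero 1≤B}})) (ℕ.m≤n+m _ _)))) (zeroˡ _)

        first : ∀ l → a (suc l) * ph (suc l) ≈ - q^ B * (σ l * q^ (M ℕ.* tri l ℕ.+ (B ℕ.+ M) ℕ.* l) * ph (suc l))
        first l = trans (*-congʳ (*-congˡ (q^-split _ _ (e₃ M B l (tri l)))))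
          (solve 4 (λ s b x p → :- s :* (b :* x) :* p := :- b :* (s :* x :* p)) refl _ _ _ _)

      S-iterate : ∀ B n → 1 ≤ B → S B ≈ qpoch M B n * S (B ℕ.+ M ℕ.* n)
      S-iterate B zero    1≤B = trans (reflexive (≡.cong S (≡.sym (e M B)))) (sym (*-identityˡ _))
        where
        e : ∀ M B → B ℕ.+ M ℕ.* 0 ≡ B
        e = solve-∀
      S-iterate B (suc n) 1≤B = begin
        S B
          ≈⟨ S-iterate B n 1≤B ⟩
        qpoch M B n * S (B ℕ.+ M ℕ.* n)
          ≈⟨ *-congˡ (S-step (B ℕ.+ M ℕ.* n) (ℕ.≤-trans 1≤B (ℕ.m≤m+n _ _))) ⟩
        qpoch M B n * ((1# - q^ (B ℕ.+ M ℕ.* n)) * S (B ℕ.+ M ℕ.* n ℕ.+ M))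
          ≈⟨ *-assoc _ _ _ ⟨
        qpoch M B (suc n) * S (B ℕ.+ M ℕ.* n ℕ.+ M)
          ≈⟨ *-congˡ (reflexive (≡.cong S (e M B n))) ⟩
        qpoch M B (suc n) * S (B ℕ.+ M ℕ.* suc n) ∎
        where
        e : ∀ M B n → B ℕ.+ M ℕ.* n ℕ.+ M ≡ B ℕ.+ M ℕ.* suc n
        e = solve-∀

      -- Every term with l ≥ 1 contains q^(B l) and vanishes.
      S-large : ∀ B → N ≤ B → S B ≈ ph 1
      S-large B N≤B = begin
        S B                                              ≈⟨ ∑-head N _ ⟩
        1# * q^ (M ℕ.* 0 ℕ.+ B ℕ.* 0) * ph 1 + _          ≈⟨ +-cong (*-congʳ (*-congˡ (trans (q^-cong (e M B)) q^-0))) (∑-zero N (λ l → trans (*-congʳ (*q^-vanishes _ (N≤ l))) (zeroˡ _))) ⟩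
        1# * 1# * ph 1 + 0#                              ≈⟨ solve 1 (λ p → :1 :* :1 :* p :+ :0 := p) refl _ ⟩
        ph 1                                             ∎
        where
        e : ∀ M B → M ℕ.* 0 ℕ.+ B ℕ.* 0 ≡ 0
        e = solve-∀
        N≤ : ∀ l → N ≤ M ℕ.* tri (suc l) ℕ.+ B ℕ.* suc l
        N≤ l = ℕ.≤-trans N≤B (ℕ.≤-trans (ℕ.m≤m*n B (suc l)) (ℕ.m≤n+m _ _))

    euler : ∀ B → 1 ≤ B → S B ≈ qpoch M B N * qpoch M (M ℕ.* 1) (suc N)
    euler B 1≤B = trans (S-iterate B N 1≤B) (*-congˡ (S-large (B ℕ.+ M ℕ.* N) (ℕ.≤-trans (m≤M*m N) (ℕ.m≤n+m _ _))))

    module _ (A B : ℕ) (1≤A : 1 ≤ A) (1≤B : 1 ≤ B) (A+B≡M : A ℕ.+ B ≡ M) where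

      -- M i(i-1)/2 + B i at the possibly negative integer i = l - n.
      private
        E : ℕ → ℕ → ℕ
        E l       zero    = M ℕ.* tri l ℕ.+ B ℕ.* l
        E zero    (suc n) = M ℕ.* tri (suc n) ℕ.+ A ℕ.* suc n
        E (suc l) (suc n) = E l n

        -- With i = l - n, passing from i to i - 1 changes M i(i-1)/2 + B i by - M(i-1) - B, which
        -- is A - M i since A + B = M.
        E-shift : ∀ l n → E l (suc n) ℕ.+ M ℕ.* l ≡ E l n ℕ.+ (A ℕ.+ M ℕ.* n)
        E-shift zero    zero    = e M A B
          where
          e : ∀ M A B → M ℕ.* 0 ℕ.+ A ℕ.* 1 ℕ.+ M ℕ.* 0 ≡ M ℕ.* 0 ℕ.+ B ℕ.* 0 ℕ.+ (A ℕ.+ M ℕ.* 0)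
          e = solve-∀
        E-shift zero    (suc n) = e M A n (tri n)
          where
          e : ∀ M A n t → M ℕ.* (t ℕ.+ n ℕ.+ suc n) ℕ.+ A ℕ.* suc (suc n) ℕ.+ M ℕ.* 0 ≡ M ℕ.* (t ℕ.+ n) ℕ.+ A ℕ.* suc n ℕ.+ (A ℕ.+ M ℕ.* suc n)
          e = solve-∀
        E-shift (suc l) zero    = e M A+B≡M
          where
          e′ : ∀ A B l t → (A ℕ.+ B) ℕ.* t ℕ.+ B ℕ.* l ℕ.+ (A ℕ.+ B) ℕ.* suc l ≡ (A ℕ.+ B) ℕ.* (t ℕ.+ l) ℕ.+ B ℕ.* suc l ℕ.+ (A ℕ.+ (A ℕ.+ B) ℕ.* 0)
          e′ = solve-∀
          e : ∀ M → A ℕ.+ B ≡ M → M ℕ.* tri l ℕ.+ B ℕ.* l ℕ.+ M ℕ.* suc l ≡ M ℕ.* (tri l ℕ.+ l) ℕ.+ B ℕ.* suc l ℕ.+ (A ℕ.+ M ℕ.* 0)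
          e _ ≡.refl = e′ A B l (tri l)
        E-shift (suc l) (suc n) = ≡.trans (e₁ (E l (suc n)) M l) (≡.trans (≡.cong (ℕ._+ M) (E-shift l n)) (e₂ (E l n) A M n))
          where
          e₁ : ∀ x M l → x ℕ.+ M ℕ.* suc l ≡ x ℕ.+ M ℕ.* l ℕ.+ M
          e₁ = solve-∀
          e₂ : ∀ x A M n → x ℕ.+ (A ℕ.+ M ℕ.* n) ℕ.+ M ≡ x ℕ.+ (A ℕ.+ M ℕ.* suc n)
          e₂ = solve-∀

        E-diagonal : ∀ n l → E (n ℕ.+ l) n ≡ M ℕ.* tri l ℕ.+ B ℕ.* l
        E-diagonal zero    l = ≡.refl
        E-diagonal (suc n) l = E-diagonal n l

        E-bound : ∀ l n → n ≤ E l n ℕ.+ l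
        E-bound l       zero    = z≤n
        E-bound zero    (suc n) = ℕ.≤-trans (ℕ.m≤n*m (suc n) A {{ℕ.>-nonZero 1≤A}}) (ℕ.≤-trans (ℕ.m≤n+m _ (M ℕ.* tri (suc n))) (ℕ.m≤m+n _ 0))
        E-bound (suc l) (suc n) = ℕ.≤-trans (s≤s (E-bound l n)) (ℕ.≤-reflexive (≡.sym (ℕ.+-suc _ l)))

        -- The theta terms of index i = l - n ≥ - n, weighted by (q^(M(l+1)) ; q^M)_∞: passing from n to n + 1
        -- multiplies the sum by 1 - q^(A+Mn), and the weights tend to 1 as n grows.
        Q : ℕ → Carrier
        Q n = ∑ (n ℕ.+ suc N) (λ l → σ (l ℕ.+ n) * q^ (E l n) * ph (suc l))

        σ-+-suc : ∀ l n → σ (l ℕ.+ suc n) ≈ - σ (l ℕ.+ n)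
        σ-+-suc l n = reflexive (≡.cong σ (ℕ.+-suc l n))

        σ-suc-+-suc : ∀ l n → σ (suc l ℕ.+ suc n) ≈ σ (l ℕ.+ n)
        σ-suc-+-suc l n = trans (-‿cong (σ-+-suc l n)) (solve 1 (λ x → :- (:- x) := x) refl _)

        -- In `∑-ph` the shifted half is `Q n`, since E depends only on l - n; by `E-shift` the
        -- other half is - q^(A + M n) times `Q n`, up to a top term whose exponent is beyond `N`.
        Q-step : ∀ n → Q (suc n) ≈ Q n * (1# - q^ (A ℕ.+ M ℕ.* n))
        Q-step n = begin
          Q (suc n)
            ≈⟨ ∑-ph (n ℕ.+ suc N) _ ⟩
          ∑ (n ℕ.+ suc N) (λ l → σ (suc l ℕ.+ suc n) * q^ (E l n) * ph (suc l))
            + ∑ (suc n ℕ.+ suc N) (λ l → σ (l ℕ.+ suc n) * q^ (E l (suc n)) * q^ (M ℕ.* l) * ph (suc l))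
            ≈⟨ +-cong (∑-cong (n ℕ.+ suc N) (λ l → *-congʳ (*-congʳ (σ-suc-+-suc l n)))) (∑-cong (suc n ℕ.+ suc N) second) ⟩
          Q n + ∑ (suc n ℕ.+ suc N) (λ l → - x * (σ (l ℕ.+ n) * q^ (E l n) * ph (suc l)))
            ≈⟨ +-congˡ (∑-* (suc n ℕ.+ suc N) (- x) _) ⟨
          Q n + - x * (Q n + σ (n ℕ.+ suc N ℕ.+ n) * q^ (E (n ℕ.+ suc N) n) * ph (suc (n ℕ.+ suc N)))
            ≈⟨ +-congˡ (*-congˡ (trans (+-congˡ (trans (*-congʳ (*q^-vanishes _ N≤E)) (zeroˡ _))) (+-identityʳ _))) ⟩
          Q n + - x * Q n
            ≈⟨ solve 2 (λ r x → r :+ :- x :* r := r :* (:1 :- x)) refl _ _ ⟩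
          Q n * (1# - x) ∎
          where
          x = q^ (A ℕ.+ M ℕ.* n)
          second : ∀ l → σ (l ℕ.+ suc n) * q^ (E l (suc n)) * q^ (M ℕ.* l) * ph (suc l)
                       ≈ - x * (σ (l ℕ.+ n) * q^ (E l n) * ph (suc l))
          second l = begin
            σ (l ℕ.+ suc n) * q^ (E l (suc n)) * q^ (M ℕ.* l) * ph (suc l)
              ≈⟨ *-congʳ (trans (*-assoc _ _ _) (*-cong (σ-+-suc l n) (trans (sym (q^-+ _ _)) (q^-split _ _ (E-shift l n))))) ⟩
            - σ (l ℕ.+ n) * (q^ (E l n) * x) * ph (suc l)
              ≈⟨ solve 4 (λ s e x p → :- s :* (e :* x) :* p := :- x :* (s :* e :* p)) refl _ _ _ _ ⟩
            - x * (σ (l ℕ.+ n) * q^ (E l n) * ph (suc l)) ∎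
          N≤E : N ≤ E (n ℕ.+ suc N) n
          N≤E = ℕ.≤-trans (ℕ.n≤1+n N) (ℕ.≤-trans (ℕ.≤-trans (ℕ.m≤n*m (suc N) B {{ℕ.>-nonZero 1≤B}}) (ℕ.m≤n+m _ _)) (ℕ.≤-reflexive (≡.sym (E-diagonal n (suc N)))))

        Q-iterate : ∀ n → Q n ≈ S B * qpoch M A n
        Q-iterate zero    = trans (∑-cong (suc N) (λ l → *-congʳ (*-congʳ (reflexive (≡.cong σ (ℕ.+-identityʳ l)))))) (sym (*-identityʳ _))
        Q-iterate (suc n) = trans (Q-step n) (trans (*-congʳ (Q-iterate n)) (*-assoc _ _ _))

        W : ℕ → Carrier
        W n = ∑ (n ℕ.+ suc N) (λ l → σ (l ℕ.+ n) * q^ (E l n))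

        -- By `E-bound`, the exponent of each term and the first exponent in its weight add up to at
        -- least `N`, so the weight is absorbed.
        Q≈W : Q N ≈ W N
        Q≈W = ∑-cong (N ℕ.+ suc N) λ l → trans (*-assoc _ _ _) (*-congˡ (qpoch-absorbed M (E l N) (M ℕ.* suc l) (suc N)
          (ℕ.≤-trans (E-bound l N) (ℕ.+-monoʳ-≤ (E l N) (ℕ.≤-trans (ℕ.n≤1+n l) (m≤M*m (suc l)))))))

        -- Raising n by one only adds the theta term of index - (n + 1), found at l = 0.
        W-sum : ∀ n → W n ≈ W 0 + ∑ n (λ i → - σ i * q^ (E 0 (suc i)))
        W-sum zero    = sym (+-identityʳ _)
        W-sum (suc n) = begin
          W (suc n)
            ≈⟨ ∑-head (n ℕ.+ suc N) _ ⟩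
          - σ n * q^ (E 0 (suc n)) + ∑ (n ℕ.+ suc N) (λ l → σ (suc l ℕ.+ suc n) * q^ (E l n))
            ≈⟨ +-congˡ (trans (∑-cong (n ℕ.+ suc N) (λ l → *-congʳ (σ-suc-+-suc l n))) (W-sum n)) ⟩
          - σ n * q^ (E 0 (suc n)) + (W 0 + ∑ n (λ i → - σ i * q^ (E 0 (suc i))))
            ≈⟨ solve 3 (λ a b c → a :+ (b :+ c) := b :+ (c :+ a)) refl _ _ _ ⟩
          W 0 + ∑ (suc n) (λ i → - σ i * q^ (E 0 (suc i))) ∎

      -- `Q N` is evaluated twice: absorbing its weights leaves the theta series, and iterating
      -- `Q-step` from `Q 0`, which is `S B`, gives the product. Each summand pairs the indices n
      -- and - (n + 1).
      jacobi : ∑ (suc N) (λ n → σ n * (q^ (M ℕ.* tri n ℕ.+ B ℕ.* n) - q^ (M ℕ.* tri (suc n) ℕ.+ A ℕ.* suc n)))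
             ≈ qpoch M A N * (qpoch M B N * qpoch M (M ℕ.* 1) (suc N))
      jacobi = begin
        ∑ (suc N) (λ n → σ n * (q^ (E n 0) - q^ (E 0 (suc n))))
          ≈⟨ ∑-cong (suc N) (λ n → solve 3 (λ s x y → s :* (x :- y) := s :* x :+ :- s :* y) refl _ _ _) ⟩
        ∑ (suc N) (λ n → σ n * q^ (E n 0) + - σ n * q^ (E 0 (suc n)))
          ≈⟨ ∑-+ (suc N) _ _ ⟩
        ∑ (suc N) (λ n → σ n * q^ (E n 0)) + (∑ N (λ n → - σ n * q^ (E 0 (suc n))) + - σ N * q^ (E 0 (suc N)))
          ≈⟨ +-cong (∑-cong (suc N) (λ l → *-congʳ (reflexive (≡.cong σ (≡.sym (ℕ.+-identityʳ l))))))
                    (trans (+-congˡ (*q^-vanishes _ N≤E)) (+-identityʳ _)) ⟩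
        W 0 + ∑ N (λ n → - σ n * q^ (E 0 (suc n)))
          ≈⟨ W-sum N ⟨
        W N
          ≈⟨ Q≈W ⟨
        Q N
          ≈⟨ Q-iterate N ⟩
        S B * qpoch M A N
          ≈⟨ *-comm _ _ ⟩
        qpoch M A N * S B
          ≈⟨ *-congˡ (euler B 1≤B) ⟩
        qpoch M A N * (qpoch M B N * qpoch M (M ℕ.* 1) (suc N)) ∎
        where
        N≤E : N ≤ E 0 (suc N)
        N≤E = ℕ.≤-trans (ℕ.n≤1+n N) (ℕ.≤-trans (E-bound 0 (suc N)) (ℕ.≤-reflexive (ℕ.+-identityʳ _)))

  -- The theta sums V and their step relations

  module ThetaSums (K d : ℕ) (1≤K : 1 ≤ K) where
    open Gaussian d

    M : ℕ
    M = 2 ℕ.* K ℕ.+ d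

    private
      weight : ℕ → ℕ → ℕ
      weight s n = s ℕ.* K ℕ.* n ℕ.+ M ℕ.* tri n

    -- The argument B stands for M - A.
    V : ℕ → ℕ → ℕ → Carrier
    V s A B = ∑ (suc N) (λ n → σ n * gauss s n *
      (q^ (weight s n ℕ.+ B ℕ.* n) - q^ (weight s n ℕ.+ M ℕ.* n ℕ.+ A ℕ.* (suc s ℕ.+ n))))

    V-zero : ∀ s → V s 0 M ≈ 0#
    V-zero s = ∑-zero (suc N) λ n → trans
      (*-congˡ (trans (+-congʳ (q^-cong (≡.sym (ℕ.+-identityʳ _)))) (-‿inverseʳ _))) (zeroʳ _)

    private
      N≤[K+c]*suc[N] : ∀ b c → N ≤ b ℕ.+ (K ℕ.+ c) ℕ.* suc N
      N≤[K+c]*suc[N] b c = ℕ.≤-trans (ℕ.n≤1+n N) (ℕ.≤-trans (ℕ.m≤n*m (suc N) (K ℕ.+ c) {{ℕ.>-nonZero (ℕ.≤-trans 1≤K (ℕ.m≤m+n K c))}}) (ℕ.m≤n+m _ b))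

    -- Replacing A by A + d divides the first power by q^(nd) and multiplies the second by
    -- q^((s+1+n)d). The difference thus carries the factors 1 - q^(nd) and 1 - q^((s+1+n)d), which
    -- `gauss-step` converts into Gaussian binomials for s + 1.
    V-step : ∀ s A A′ → A ℕ.+ A′ ≡ K →
      V s (A ℕ.+ d) (K ℕ.+ A′) ≈
        V s A (K ℕ.+ A′ ℕ.+ d) + q^ (suc s ℕ.* A) * ((1# - q^ (suc s ℕ.* d)) * V (suc s) A′ (K ℕ.+ d ℕ.+ A))
    V-step s A A′ A+A′≡K = begin
      V s (A ℕ.+ d) (K ℕ.+ A′)
        ≈⟨ ∑-cong (suc N) difference ⟩
      ∑ (suc N) (λ n → t n + u n)
        ≈⟨ ∑-+ (suc N) t u ⟩
      V s A (K ℕ.+ A′ ℕ.+ d) + ∑ (suc N) u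
        ≈⟨ +-congˡ (gauss-step s x y (N≤[K+c]*suc[N] (weight s (suc N)) A′)) ⟩
      V s A (K ℕ.+ A′ ℕ.+ d) + (1# - q^ (suc s ℕ.* d)) * ∑ (suc N) (λ n → σ n * gauss (suc s) n * (q^ (y n) - q^ (x (suc n))))
        ≈⟨ +-congˡ (*-congˡ (trans (∑-cong (suc N) shifted) (sym (∑-* (suc N) _ _)))) ⟩
      V s A (K ℕ.+ A′ ℕ.+ d) + (1# - q^ (suc s ℕ.* d)) * (q^ (suc s ℕ.* A) * V (suc s) A′ (K ℕ.+ d ℕ.+ A))
        ≈⟨ +-congˡ (solve 3 (λ a b c → a :* (b :* c) := b :* (a :* c)) refl _ _ _) ⟩
      V s A (K ℕ.+ A′ ℕ.+ d) + q^ (suc s ℕ.* A) * ((1# - q^ (suc s ℕ.* d)) * V (suc s) A′ (K ℕ.+ d ℕ.+ A)) ∎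
      where
      x y : ℕ → ℕ
      x n = weight s n ℕ.+ (K ℕ.+ A′) ℕ.* n
      y n = weight s n ℕ.+ M ℕ.* n ℕ.+ A ℕ.* (suc s ℕ.+ n)

      t u : ℕ → Carrier
      t n = σ n * gauss s n * (q^ (weight s n ℕ.+ (K ℕ.+ A′ ℕ.+ d) ℕ.* n) - q^ (y n))
      u n = σ n * gauss s n * ((1# - q^ (n ℕ.* d)) * q^ (x n) + (1# - q^ (suc (s ℕ.+ n) ℕ.* d)) * q^ (y n))

      e₁ : ∀ w K A′ d n → w ℕ.+ (K ℕ.+ A′ ℕ.+ d) ℕ.* n ≡ w ℕ.+ (K ℕ.+ A′) ℕ.* n ℕ.+ n ℕ.* d
      e₁ = solve-∀

      e₂ : ∀ w A d s n → w ℕ.+ (A ℕ.+ d) ℕ.* (suc s ℕ.+ n) ≡ w ℕ.+ A ℕ.* (suc s ℕ.+ n) ℕ.+ suc (s ℕ.+ n) ℕ.* d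
      e₂ = solve-∀

      difference : ∀ n → σ n * gauss s n * (q^ (x n) - q^ (weight s n ℕ.+ M ℕ.* n ℕ.+ (A ℕ.+ d) ℕ.* (suc s ℕ.+ n))) ≈ t n + u n
      difference n = begin
        σ n * gauss s n * (q^ (x n) - q^ (weight s n ℕ.+ M ℕ.* n ℕ.+ (A ℕ.+ d) ℕ.* (suc s ℕ.+ n)))
          ≈⟨ *-congˡ (+-congˡ (-‿cong (q^-split _ _ (e₂ (weight s n ℕ.+ M ℕ.* n) A d s n)))) ⟩
        σ n * gauss s n * (q^ (x n) - q^ (y n) * q^ (suc (s ℕ.+ n) ℕ.* d))
          ≈⟨ solve 5 (λ g x y a b → g :* (x :- y :* b) := g :* (x :* a :- y) :+ g :* ((:1 :- a) :* x :+ (:1 :- b) :* y)) refl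
               (σ n * gauss s n) (q^ (x n)) (q^ (y n)) (q^ (n ℕ.* d)) (q^ (suc (s ℕ.+ n) ℕ.* d)) ⟩
        σ n * gauss s n * (q^ (x n) * q^ (n ℕ.* d) - q^ (y n)) + u n
          ≈⟨ +-congʳ (*-congˡ (+-congʳ (q^-split _ _ (e₁ (weight s n) K A′ d n)))) ⟨
        t n + u n ∎

      e₃ : ∀ A A′ d s n t →
        s ℕ.* (A ℕ.+ A′) ℕ.* n ℕ.+ (2 ℕ.* (A ℕ.+ A′) ℕ.+ d) ℕ.* t ℕ.+ (2 ℕ.* (A ℕ.+ A′) ℕ.+ d) ℕ.* n ℕ.+ A ℕ.* (suc s ℕ.+ n)
          ≡ suc s ℕ.* A ℕ.+ (suc s ℕ.* (A ℕ.+ A′) ℕ.* n ℕ.+ (2 ℕ.* (A ℕ.+ A′) ℕ.+ d) ℕ.* t ℕ.+ (A ℕ.+ A′ ℕ.+ d ℕ.+ A) ℕ.* n)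
      e₃ = solve-∀

      e₄ : ∀ A A′ d s n t →
        s ℕ.* (A ℕ.+ A′) ℕ.* suc n ℕ.+ (2 ℕ.* (A ℕ.+ A′) ℕ.+ d) ℕ.* (t ℕ.+ n) ℕ.+ (A ℕ.+ A′ ℕ.+ A′) ℕ.* suc n
          ≡ suc s ℕ.* A ℕ.+ (suc s ℕ.* (A ℕ.+ A′) ℕ.* n ℕ.+ (2 ℕ.* (A ℕ.+ A′) ℕ.+ d) ℕ.* t ℕ.+ (2 ℕ.* (A ℕ.+ A′) ℕ.+ d) ℕ.* n ℕ.+ A′ ℕ.* (suc (suc s) ℕ.+ n))
      e₄ = solve-∀

      y≡ : ∀ n → y n ≡ suc s ℕ.* A ℕ.+ (weight (suc s) n ℕ.+ (K ℕ.+ d ℕ.+ A) ℕ.* n)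
      y≡ n = ≡.subst (λ K → s ℕ.* K ℕ.* n ℕ.+ (2 ℕ.* K ℕ.+ d) ℕ.* tri n ℕ.+ (2 ℕ.* K ℕ.+ d) ℕ.* n ℕ.+ A ℕ.* (suc s ℕ.+ n)
          ≡ suc s ℕ.* A ℕ.+ (suc s ℕ.* K ℕ.* n ℕ.+ (2 ℕ.* K ℕ.+ d) ℕ.* tri n ℕ.+ (K ℕ.+ d ℕ.+ A) ℕ.* n))
        A+A′≡K (e₃ A A′ d s n (tri n))

      x≡ : ∀ n → x (suc n) ≡ suc s ℕ.* A ℕ.+ (weight (suc s) n ℕ.+ M ℕ.* n ℕ.+ A′ ℕ.* (suc (suc s) ℕ.+ n))
      x≡ n = ≡.subst (λ K → s ℕ.* K ℕ.* suc n ℕ.+ (2 ℕ.* K ℕ.+ d) ℕ.* (tri n ℕ.+ n) ℕ.+ (K ℕ.+ A′) ℕ.* suc n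
          ≡ suc s ℕ.* A ℕ.+ (suc s ℕ.* K ℕ.* n ℕ.+ (2 ℕ.* K ℕ.+ d) ℕ.* tri n ℕ.+ (2 ℕ.* K ℕ.+ d) ℕ.* n ℕ.+ A′ ℕ.* (suc (suc s) ℕ.+ n)))
        A+A′≡K (e₄ A A′ d s n (tri n))

      shifted : ∀ n → σ n * gauss (suc s) n * (q^ (y n) - q^ (x (suc n)))
        ≈ q^ (suc s ℕ.* A) * (σ n * gauss (suc s) n * (q^ (weight (suc s) n ℕ.+ (K ℕ.+ d ℕ.+ A) ℕ.* n) - q^ (weight (suc s) n ℕ.+ M ℕ.* n ℕ.+ A′ ℕ.* (suc (suc s) ℕ.+ n))))
      shifted n = trans (*-congˡ (+-cong (q^-split _ _ (y≡ n)) (-‿cong (q^-split _ _ (x≡ n)))))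
        (solve 4 (λ g a x y → g :* (a :* x :- a :* y) := a :* (g :* (x :- y))) refl _ _ _ _)

    -- V-step at the formal parameter A = - e, where V s (- e) = - q^(- (s + 1) e) V s e by the
    -- symmetry of the theta sum, with the denominator q^((s + 1) e) cleared.
    V-half : ∀ s e → 2 ℕ.* e ≡ d →
      (1# + q^ (suc s ℕ.* e)) * V s e (2 ℕ.* K ℕ.+ e) ≈ (1# - q^ (suc s ℕ.* d)) * V (suc s) (K ℕ.+ e) (K ℕ.+ e)
    V-half s e 2e≡d = begin
      (1# + q^ (suc s ℕ.* e)) * V s e (2 ℕ.* K ℕ.+ e)
        ≈⟨ ∑-* (suc N) _ _ ⟩
      ∑ (suc N) (λ n → (1# + q^ (suc s ℕ.* e)) * (σ n * gauss s n * (q^ (y n) - q^ (z n))))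
        ≈⟨ ∑-cong (suc N) regroup ⟩
      ∑ (suc N) (λ n → σ n * gauss s n * ((1# - q^ (n ℕ.* d)) * q^ (x n) + (1# - q^ (suc (s ℕ.+ n) ℕ.* d)) * q^ (y n)))
        ≈⟨ gauss-step s x y (ℕ.≤-trans (N≤[K+c]*suc[N] (weight s (suc N)) (K ℕ.+ 0 ℕ.+ e)) (ℕ.≤-trans (ℕ.≤-reflexive (e₀ (weight s (suc N)) K e N)) (ℕ.m≤m+n _ _))) ⟩
      (1# - q^ (suc s ℕ.* d)) * ∑ (suc N) (λ n → σ n * gauss (suc s) n * (q^ (y n) - q^ (x (suc n))))
        ≈⟨ *-congˡ (∑-cong (suc N) (λ n → *-congˡ (+-cong (q^-cong (y≡ s K e n (M ℕ.* tri n))) (-‿cong (q^-cong (x≡ n)))))) ⟩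
      (1# - q^ (suc s ℕ.* d)) * V (suc s) (K ℕ.+ e) (K ℕ.+ e) ∎
      where
      x y z : ℕ → ℕ
      y n = weight s n ℕ.+ (2 ℕ.* K ℕ.+ e) ℕ.* n
      x n = y n ℕ.+ suc s ℕ.* e
      z n = weight s n ℕ.+ M ℕ.* n ℕ.+ e ℕ.* (suc s ℕ.+ n)

      e₀ : ∀ w K e N → w ℕ.+ (K ℕ.+ (K ℕ.+ 0 ℕ.+ e)) ℕ.* suc N ≡ w ℕ.+ (2 ℕ.* K ℕ.+ e) ℕ.* suc N
      e₀ = solve-∀

      e₁ : ∀ w K e s n → w ℕ.+ (2 ℕ.* K ℕ.+ 2 ℕ.* e) ℕ.* n ℕ.+ e ℕ.* (suc s ℕ.+ n)
        ≡ w ℕ.+ (2 ℕ.* K ℕ.+ e) ℕ.* n ℕ.+ suc s ℕ.* e ℕ.+ n ℕ.* (2 ℕ.* e)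
      e₁ = solve-∀

      z≡ : ∀ n → z n ≡ x n ℕ.+ n ℕ.* d
      z≡ n = ≡.subst (λ d → weight s n ℕ.+ (2 ℕ.* K ℕ.+ d) ℕ.* n ℕ.+ e ℕ.* (suc s ℕ.+ n) ≡ x n ℕ.+ n ℕ.* d) 2e≡d (e₁ (weight s n) K e s n)

      e₂ : ∀ e s n → suc (s ℕ.+ n) ℕ.* (2 ℕ.* e) ≡ n ℕ.* (2 ℕ.* e) ℕ.+ (suc s ℕ.* e ℕ.+ suc s ℕ.* e)
      e₂ = solve-∀

      d≡ : ∀ n → suc (s ℕ.+ n) ℕ.* d ≡ n ℕ.* d ℕ.+ (suc s ℕ.* e ℕ.+ suc s ℕ.* e)
      d≡ n = ≡.subst (λ d → suc (s ℕ.+ n) ℕ.* d ≡ n ℕ.* d ℕ.+ (suc s ℕ.* e ℕ.+ suc s ℕ.* e)) 2e≡d (e₂ e s n)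

      y≡ : ∀ s K e n w → s ℕ.* K ℕ.* n ℕ.+ w ℕ.+ (2 ℕ.* K ℕ.+ e) ℕ.* n ≡ suc s ℕ.* K ℕ.* n ℕ.+ w ℕ.+ (K ℕ.+ e) ℕ.* n
      y≡ = solve-∀

      e₃ : ∀ s K e d n t → s ℕ.* K ℕ.* suc n ℕ.+ (2 ℕ.* K ℕ.+ d) ℕ.* (t ℕ.+ n) ℕ.+ (2 ℕ.* K ℕ.+ e) ℕ.* suc n ℕ.+ suc s ℕ.* e
        ≡ suc s ℕ.* K ℕ.* n ℕ.+ (2 ℕ.* K ℕ.+ d) ℕ.* t ℕ.+ (2 ℕ.* K ℕ.+ d) ℕ.* n ℕ.+ (K ℕ.+ e) ℕ.* (suc (suc s) ℕ.+ n)
      e₃ = solve-∀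

      x≡ : ∀ n → x (suc n) ≡ weight (suc s) n ℕ.+ M ℕ.* n ℕ.+ (K ℕ.+ e) ℕ.* (suc (suc s) ℕ.+ n)
      x≡ n = e₃ s K e d n (tri n)

      regroup : ∀ n → (1# + q^ (suc s ℕ.* e)) * (σ n * gauss s n * (q^ (y n) - q^ (z n))) ≈
        σ n * gauss s n * ((1# - q^ (n ℕ.* d)) * q^ (x n) + (1# - q^ (suc (s ℕ.+ n) ℕ.* d)) * q^ (y n))
      regroup n = begin
        (1# + q^ (suc s ℕ.* e)) * (σ n * gauss s n * (q^ (y n) - q^ (z n)))
          ≈⟨ *-congˡ (*-congˡ (+-congˡ (-‿cong (trans (q^-split _ _ (z≡ n)) (*-congʳ (q^-+ (y n) _)))))) ⟩
        (1# + q^ (suc s ℕ.* e)) * (σ n * gauss s n * (q^ (y n) - q^ (y n) * q^ (suc s ℕ.* e) * q^ (n ℕ.* d)))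
          ≈⟨ solve 4 (λ g y f d → (:1 :+ f) :* (g :* (y :- y :* f :* d)) := g :* ((:1 :- d) :* (y :* f) :+ (:1 :- d :* (f :* f)) :* y)) refl
              (σ n * gauss s n) (q^ (y n)) (q^ (suc s ℕ.* e)) (q^ (n ℕ.* d)) ⟩
        σ n * gauss s n * ((1# - q^ (n ℕ.* d)) * (q^ (y n) * q^ (suc s ℕ.* e)) + (1# - q^ (n ℕ.* d) * (q^ (suc s ℕ.* e) * q^ (suc s ℕ.* e))) * q^ (y n))
          ≈⟨ *-congˡ (+-cong (*-congˡ (q^-+ (y n) _)) (*-congʳ (+-congˡ (-‿cong (trans (q^-split _ _ (d≡ n)) (*-congˡ (q^-+ _ _))))))) ⟨
        σ n * gauss s n * ((1# - q^ (n ℕ.* d)) * q^ (x n) + (1# - q^ (suc (s ℕ.+ n) ℕ.* d)) * q^ (y n)) ∎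

    -- All exponents reach `N` through s K n or A(s + 1 + n), except that of the first power at n =
    -- 0, which is 0.
    V-large : ∀ s A B → N ≤ s → 1 ≤ A → V s A B ≈ 1#
    V-large s A B N≤s 1≤A = begin
      V s A B                          ≈⟨ ∑-head N _ ⟩
      1# * gauss s 0 * (q^ (s ℕ.* K ℕ.* 0 ℕ.+ M ℕ.* 0 ℕ.+ B ℕ.* 0) - q^ (weight s 0 ℕ.+ M ℕ.* 0 ℕ.+ A ℕ.* (suc s ℕ.+ 0))) + _
        ≈⟨ +-cong (*-cong (*-congˡ (gauss-0 s)) (trans (+-congʳ (trans (q^-cong (e₀ (s ℕ.* K) M B)) q^-0)) (1-q^-vanishes N≤₀)))
                  (∑-zero N (λ n → trans (*-congˡ (trans (+-cong (q^-vanishes _ (N≤₁ n)) (-‿cong (q^-vanishes _ (N≤₂ n)))) (-‿inverseʳ 0#))) (zeroʳ _))) ⟩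
      1# * 1# * 1# + 0#                ≈⟨ solve 0 (:1 :* :1 :* :1 :+ :0 := :1) refl ⟩
      1#                               ∎
      where
      e₀ : ∀ x M B → x ℕ.* 0 ℕ.+ M ℕ.* 0 ℕ.+ B ℕ.* 0 ≡ 0
      e₀ = solve-∀
      N≤₀ : N ≤ weight s 0 ℕ.+ M ℕ.* 0 ℕ.+ A ℕ.* (suc s ℕ.+ 0)
      N≤₀ = ℕ.≤-trans (ℕ.≤-trans N≤s (ℕ.≤-trans (ℕ.m≤m+n s 0) (ℕ.n≤1+n _))) (ℕ.≤-trans (ℕ.m≤n*m (suc s ℕ.+ 0) A {{ℕ.>-nonZero 1≤A}}) (ℕ.m≤n+m _ _))
      N≤w : ∀ n → N ≤ weight s (suc n)
      N≤w n = ℕ.≤-trans N≤s (ℕ.≤-trans (ℕ.m≤m*n s K {{ℕ.>-nonZero 1≤K}}) (ℕ.≤-trans (ℕ.m≤m*n (s ℕ.* K) (suc n)) (ℕ.m≤m+n _ _)))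
      N≤₁ : ∀ n → N ≤ weight s (suc n) ℕ.+ B ℕ.* suc n
      N≤₁ n = ℕ.≤-trans (N≤w n) (ℕ.m≤m+n _ _)
      N≤₂ : ∀ n → N ≤ weight s (suc n) ℕ.+ M ℕ.* suc n ℕ.+ A ℕ.* (suc s ℕ.+ suc n)
      N≤₂ n = ℕ.≤-trans (N≤w n) (ℕ.≤-trans (ℕ.m≤m+n _ _) (ℕ.m≤m+n _ _))

    -- At s = 0 the Gaussian binomials are 1, and the two powers are the theta terms of index n and
    -- - (n + 1).
    V-product : ∀ A B → 1 ≤ A → 1 ≤ B → A ℕ.+ B ≡ M →
      V 0 A B ≈ qpoch M A N * (qpoch M B N * qpoch M (M ℕ.* 1) (suc N))
    V-product A B 1≤A 1≤B A+B≡M = trans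
      (∑-cong (suc N) λ n → *-cong (*-identityʳ _) (+-congˡ (-‿cong (q^-cong (e M A n (tri n))))))
      (JacobiTripleProduct.jacobi M (ℕ.≤-trans 1≤A (ℕ.≤-trans (ℕ.m≤m+n A B) (ℕ.≤-reflexive A+B≡M))) A B 1≤A 1≤B A+B≡M)
      where
      e : ∀ M A n t → M ℕ.* t ℕ.+ M ℕ.* n ℕ.+ A ℕ.* suc n ≡ M ℕ.* (t ℕ.+ n) ℕ.+ A ℕ.* suc n
      e = solve-∀

  -- Indicator sums and cancellation of 1 + q^c

  indicator : {P : Set} → Dec P → Carrier → Carrier
  indicator P? x = if does P? then x else 0#

  indicator-yes : {P : Set} (P? : Dec P) → P → ∀ {x} → indicator P? x ≈ x
  indicator-yes (yes _)  _ = refl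
  indicator-yes (no ¬p)  p = contradiction p ¬p

  indicator-no : {P : Set} (P? : Dec P) → ¬ P → ∀ {x} → indicator P? x ≈ 0#
  indicator-no (yes p) ¬p = contradiction p ¬p
  indicator-no (no _)  _  = refl

  ∑-indicator-< : ∀ n p (f : ℕ → Carrier) → n ≤ p → ∑ p (λ m → indicator (m ℕ.<? n) (f m)) ≈ ∑ n f
  ∑-indicator-< n zero    f z≤n = refl
  ∑-indicator-< n (suc p) f n≤  with ℕ.m≤n⇒m<n∨m≡n n≤
  ... | inj₁ (s≤s n≤p) = trans (+-cong (∑-indicator-< n p f n≤p) (indicator-no (p ℕ.<? n) (ℕ.≤⇒≯ n≤p))) (+-identityʳ _)
  ... | inj₂ ≡.refl    = ∑-cong< (suc p) (λ i i< → indicator-yes (i ℕ.<? suc p) i<)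

  ∑-indicator-≟ : ∀ n t (f : ℕ → Carrier) → t < n → ∑ n (λ m → indicator (m ℕ.≟ t) (f m)) ≈ f t
  ∑-indicator-≟ (suc n) t f t<1+n with ℕ.m≤n⇒m<n∨m≡n t<1+n
  ... | inj₁ (s≤s t<n) = trans (+-cong (∑-indicator-≟ n t f t<n) (indicator-no (n ℕ.≟ t) (≢-sym (ℕ.<⇒≢ t<n)))) (+-identityʳ _)
  ... | inj₂ ≡.refl    = trans
    (+-cong (trans (∑-cong< n (λ i i<n → indicator-no (i ℕ.≟ n) (ℕ.<⇒≢ i<n))) (∑-zero n (λ _ → refl))) (indicator-yes (n ℕ.≟ n) ≡.refl))
    (+-identityˡ _)

  -- q^c is nilpotent.
  1+q^-cancel : ∀ c x y → 1 ≤ c → (1# + q^ c) * x ≈ (1# + q^ c) * y → x ≈ y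
  1+q^-cancel c x y 1≤c h = x-y≈0⇒x≈y (trans (expand N) (trans (*-congʳ (*q^-vanishes _ (ℕ.m≤n*m N c {{ℕ.>-nonZero 1≤c}}))) (zeroˡ _)))
    where
    x-y≈0⇒x≈y : x - y ≈ 0# → x ≈ y
    x-y≈0⇒x≈y eq = trans (solve 2 (λ x y → x := (x :- y) :+ y) refl x y) (trans (+-congʳ eq) (+-identityˡ y))
    -- By `h`, multiplication by q^c acts on x - y as - 1, and this can be repeated until the power
    -- vanishes.
    expand : ∀ n → x - y ≈ σ n * q^ (c ℕ.* n) * (x - y)
    expand zero    = sym (trans (*-congʳ (trans (*-congˡ (trans (q^-cong (ℕ.*-zeroʳ c)) q^-0)) (*-identityˡ 1#))) (*-identityˡ _))
    expand (suc n) = begin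
      x - y
        ≈⟨ expand n ⟩
      σ n * q^ (c ℕ.* n) * (x - y)
        ≈⟨ solve 5 (λ s p c x y → s :* p :* (x :- y) := s :* p :* ((:1 :+ c) :* x :- (:1 :+ c) :* y) :+ :- s :* (c :* p) :* (x :- y)) refl
            (σ n) (q^ (c ℕ.* n)) (q^ c) x y ⟩
      σ n * q^ (c ℕ.* n) * ((1# + q^ c) * x - (1# + q^ c) * y) + - σ n * (q^ c * q^ (c ℕ.* n)) * (x - y)
        ≈⟨ +-cong (trans (*-congˡ (trans (+-congʳ h) (-‿inverseʳ _))) (zeroʳ _)) (*-congʳ (*-congˡ (sym (q^-split _ _ (ℕ.*-suc c n))))) ⟩
      0# + σ (suc n) * q^ (c ℕ.* suc n) * (x - y)
        ≈⟨ +-identityˡ _ ⟩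
      σ (suc n) * q^ (c ℕ.* suc n) * (x - y) ∎

  -- Generating functions by smallest part

  module GeneratingFunctions (k d e : ℕ) (1≤d : 1 ≤ d) (1≤e : 1 ≤ e) (e≤d : e ≤ d)
                             (e-cond : (e ≡ d) ⊎ (2 ℕ.* e ≡ d)) where

    K : ℕ
    K = d ℕ.* k ℕ.+ e

    private
      1≤K : 1 ≤ K
      1≤K = ℕ.≤-trans 1≤e (ℕ.m≤n+m e _)

    open ThetaSums K d 1≤K

    -- Partitions with parts in [ j , j + L ), fewer than α of them equal to j.
    gf : ℕ → ℕ → ℕ → Carrier
    gf zero    j zero    = 0#
    gf zero    j (suc α) = 1#
    gf (suc L) j zero    = 0#
    -- Exactly `α` parts j leave room for fewer than K - α parts j + 1; for α ≥ K the truncated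
    -- bound is 0 and the summand vanishes.
    gf (suc L) j (suc α) = gf (suc L) j α + indicator (allowed? d j α) (q^ (α ℕ.* j) * gf L (suc j) (K ∸ α))

    private
      K∸d* : ∀ m → m ≤ k → K ∸ d ℕ.* m ≡ d ℕ.* (k ∸ m) ℕ.+ e
      K∸d* m m≤k = ≡.trans (ℕ.+-∸-comm e (ℕ.*-monoʳ-≤ d m≤k)) (≡.cong (ℕ._+ e) (≡.sym (ℕ.*-distribˡ-∸ d k m)))

      <suc[k] : ∀ t → t ℕ.* d < K → t < suc k
      <suc[k] t td<K = ℕ.*-cancelʳ-< d t (suc k) (ℕ.<-≤-trans td<K (ℕ.≤-trans (ℕ.+-monoʳ-≤ (d ℕ.* k) e≤d)
        (ℕ.≤-reflexive (≡.trans (ℕ.+-comm (d ℕ.* k) d) (≡.cong (d ℕ.+_) (ℕ.*-comm d k))))))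

    -- The multiplicities are the multiples d m below β; as β ≤ dk + e and e ≤ d, they all have m ≤
    -- k.
    gf-even : ∀ L j β → 2 ∣ j → β ≤ K →
      gf (suc L) j β ≈ ∑ (suc k) (λ m → indicator (d ℕ.* m ℕ.<? β) (q^ (d ℕ.* m ℕ.* j) * gf L (suc j) (K ∸ d ℕ.* m)))
    gf-even L j zero    2∣j _   = sym (∑-zero (suc k) (λ m → indicator-no (d ℕ.* m ℕ.<? 0) (λ ()) {q^ (d ℕ.* m ℕ.* j) * gf L (suc j) (K ∸ d ℕ.* m)}))
    gf-even L j (suc β) 2∣j β<K = extend (d ∣? β)
      where
      F : ℕ → Carrier
      F m = q^ (d ℕ.* m ℕ.* j) * gf L (suc j) (K ∸ d ℕ.* m)

      extend : Dec (d ∣ β) → gf (suc L) j (suc β) ≈ ∑ (suc k) (λ m → indicator (d ℕ.* m ℕ.<? suc β) (F m))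
      extend (no d∤β) = begin
        gf (suc L) j (suc β)
          ≈⟨ +-cong (gf-even L j β 2∣j (ℕ.<⇒≤ β<K)) (indicator-no (allowed? d j β) (λ ok → d∤β (ok 2∣j))) ⟩
        ∑ (suc k) (λ m → indicator (d ℕ.* m ℕ.<? β) (F m)) + 0#
          ≈⟨ +-identityʳ _ ⟩
        ∑ (suc k) (λ m → indicator (d ℕ.* m ℕ.<? β) (F m))
          ≈⟨ ∑-cong (suc k) term ⟩
        ∑ (suc k) (λ m → indicator (d ℕ.* m ℕ.<? suc β) (F m)) ∎
        where
        term : ∀ m → indicator (d ℕ.* m ℕ.<? β) (F m) ≈ indicator (d ℕ.* m ℕ.<? suc β) (F m)
        term m with ℕ.<-≤-connex (d ℕ.* m) β
        ... | inj₁ dm<β = trans (indicator-yes (d ℕ.* m ℕ.<? β) dm<β) (sym (indicator-yes (d ℕ.* m ℕ.<? suc β) (ℕ.m<n⇒m<1+n dm<β)))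
        ... | inj₂ β≤dm = trans (indicator-no (d ℕ.* m ℕ.<? β) (ℕ.≤⇒≯ β≤dm)) (sym (indicator-no (d ℕ.* m ℕ.<? suc β) λ { (s≤s dm≤β) →
          d∤β (divides m (≡.trans (ℕ.≤-antisym β≤dm dm≤β) (ℕ.*-comm d m))) }))
      extend (yes (divides t β≡td)) = begin
        gf (suc L) j (suc β)
          ≈⟨ +-cong (gf-even L j β 2∣j (ℕ.<⇒≤ β<K)) (indicator-yes (allowed? d j β) (λ _ → divides t β≡td)) ⟩
        ∑ (suc k) (λ m → indicator (d ℕ.* m ℕ.<? β) (F m)) + q^ (β ℕ.* j) * gf L (suc j) (K ∸ β)
          ≡⟨ ≡.cong (λ z → ∑ (suc k) (λ m → indicator (d ℕ.* m ℕ.<? β) (F m)) + q^ (z ℕ.* j) * gf L (suc j) (K ∸ z)) (≡.sym dt≡β) ⟩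
        ∑ (suc k) (λ m → indicator (d ℕ.* m ℕ.<? β) (F m)) + F t
          ≈⟨ +-congˡ (∑-indicator-≟ (suc k) t F (<suc[k] t (≡.subst (_< K) β≡td β<K))) ⟨
        ∑ (suc k) (λ m → indicator (d ℕ.* m ℕ.<? β) (F m)) + ∑ (suc k) (λ m → indicator (m ℕ.≟ t) (F m))
          ≈⟨ ∑-+ (suc k) _ _ ⟨
        ∑ (suc k) (λ m → indicator (d ℕ.* m ℕ.<? β) (F m) + indicator (m ℕ.≟ t) (F m))
          ≈⟨ ∑-cong (suc k) term ⟩
        ∑ (suc k) (λ m → indicator (d ℕ.* m ℕ.<? suc β) (F m)) ∎
        where
        dt≡β : d ℕ.* t ≡ β
        dt≡β = ≡.trans (ℕ.*-comm d t) (≡.sym β≡td)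

        term : ∀ m → indicator (d ℕ.* m ℕ.<? β) (F m) + indicator (m ℕ.≟ t) (F m) ≈ indicator (d ℕ.* m ℕ.<? suc β) (F m)
        term m with ℕ.<-cmp m t
        ... | tri< m<t m≢t _ = trans
          (+-cong (indicator-yes (d ℕ.* m ℕ.<? β) dm<β) (indicator-no (m ℕ.≟ t) m≢t))
          (trans (+-identityʳ _) (sym (indicator-yes (d ℕ.* m ℕ.<? suc β) (ℕ.m<n⇒m<1+n dm<β))))
          where
          dm<β : d ℕ.* m < β
          dm<β = ℕ.<-≤-trans (ℕ.*-monoʳ-< d {{ℕ.>-nonZero 1≤d}} m<t) (ℕ.≤-reflexive dt≡β)
        ... | tri≈ _ ≡.refl _ = trans
          (+-cong (indicator-no (d ℕ.* m ℕ.<? β) (λ dm<β → ℕ.<⇒≢ dm<β dt≡β)) (indicator-yes (m ℕ.≟ m) ≡.refl))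
          (trans (+-identityˡ _) (sym (indicator-yes (d ℕ.* m ℕ.<? suc β) (s≤s (ℕ.≤-reflexive dt≡β)))))
        ... | tri> m≮t m≢t t<m = trans
          (+-cong (indicator-no (d ℕ.* m ℕ.<? β) (λ dm<β → ℕ.<-asym dm<β β<dm)) (indicator-no (m ℕ.≟ t) m≢t))
          (trans (+-identityʳ _) (sym (indicator-no (d ℕ.* m ℕ.<? suc β) (λ { (s≤s dm≤β) → ℕ.≤⇒≯ dm≤β β<dm }))))
          where
          β<dm : β < d ℕ.* m
          β<dm = ℕ.≤-<-trans (ℕ.≤-reflexive (≡.sym dt≡β)) (ℕ.*-monoʳ-< d {{ℕ.>-nonZero 1≤d}} t<m)

    -- If j + 1 occurs d m times, the multiplicity of j ranges freely below min(α, K - d m), a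
    -- geometric sum that the factor 1 - q^j closes up.
    gf-odd : ∀ L j α → ¬ 2 ∣ j → 2 ∣ suc j →
      (1# - q^ j) * gf (suc (suc L)) j α ≈
        ∑ (suc k) (λ m → (1# - q^ (j ℕ.* (α ⊓ (K ∸ d ℕ.* m)))) * (q^ (d ℕ.* m ℕ.* suc j) * gf L (suc (suc j)) (K ∸ d ℕ.* m)))
    gf-odd L j zero    2∤j 2∣1+j = trans (zeroʳ _) (sym (∑-zero (suc k) λ m → trans
      (*-congʳ (trans (+-congˡ (-‿cong (trans (q^-cong (ℕ.*-zeroʳ j)) q^-0))) (-‿inverseʳ 1#))) (zeroˡ _)))
    gf-odd L j (suc α) 2∤j 2∣1+j = begin
      (1# - q^ j) * (gf (suc (suc L)) j α + indicator (allowed? d j α) (q^ (α ℕ.* j) * gf (suc L) (suc j) (K ∸ α)))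
        ≈⟨ *-congˡ (+-congˡ (indicator-yes (allowed? d j α) (λ 2∣j → contradiction 2∣j 2∤j))) ⟩
      (1# - q^ j) * (gf (suc (suc L)) j α + q^ (α ℕ.* j) * gf (suc L) (suc j) (K ∸ α))
        ≈⟨ solve 4 (λ c g p h → c :* (g :+ p :* h) := c :* g :+ c :* p :* h) refl _ _ _ _ ⟩
      (1# - q^ j) * gf (suc (suc L)) j α + (1# - q^ j) * q^ (α ℕ.* j) * gf (suc L) (suc j) (K ∸ α)
        ≈⟨ +-cong (gf-odd L j α 2∤j 2∣1+j) (trans (*-congˡ (gf-even L (suc j) (K ∸ α) 2∣1+j (ℕ.m∸n≤m K α))) (∑-* (suc k) _ _)) ⟩
      ∑ (suc k) (λ m → (1# - q^ (j ℕ.* (α ⊓ (K ∸ d ℕ.* m)))) * F m) + ∑ (suc k) (λ m → (1# - q^ j) * q^ (α ℕ.* j) * indicator (d ℕ.* m ℕ.<? K ∸ α) (F m))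
        ≈⟨ ∑-+ (suc k) _ _ ⟨
      ∑ (suc k) (λ m → (1# - q^ (j ℕ.* (α ⊓ (K ∸ d ℕ.* m)))) * F m + (1# - q^ j) * q^ (α ℕ.* j) * indicator (d ℕ.* m ℕ.<? K ∸ α) (F m))
        ≈⟨ ∑-cong (suc k) term ⟩
      ∑ (suc k) (λ m → (1# - q^ (j ℕ.* (suc α ⊓ (K ∸ d ℕ.* m)))) * F m) ∎
      where
      F : ℕ → Carrier
      F m = q^ (d ℕ.* m ℕ.* suc j) * gf L (suc (suc j)) (K ∸ d ℕ.* m)

      term : ∀ m → (1# - q^ (j ℕ.* (α ⊓ (K ∸ d ℕ.* m)))) * F m + (1# - q^ j) * q^ (α ℕ.* j) * indicator (d ℕ.* m ℕ.<? K ∸ α) (F m)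
                 ≈ (1# - q^ (j ℕ.* (suc α ⊓ (K ∸ d ℕ.* m)))) * F m
      -- The new multiplicity `α` of j is compatible with d m parts j + 1 exactly if α < K - d m,
      -- and only then does the minimum grow.
      term m with ℕ.<-≤-connex α (K ∸ d ℕ.* m)
      ... | inj₁ α<c = begin
        (1# - q^ (j ℕ.* (α ⊓ (K ∸ d ℕ.* m)))) * F m + (1# - q^ j) * q^ (α ℕ.* j) * indicator (d ℕ.* m ℕ.<? K ∸ α) (F m)
          ≈⟨ +-cong (*-congʳ (+-congˡ (-‿cong (q^-cong (≡.trans (≡.cong (j ℕ.*_) (ℕ.m≤n⇒m⊓n≡m (ℕ.<⇒≤ α<c))) (ℕ.*-comm j α))))))
                    (*-congˡ (indicator-yes (d ℕ.* m ℕ.<? K ∸ α) (<-∸-swap α<c))) ⟩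
        (1# - q^ (α ℕ.* j)) * F m + (1# - q^ j) * q^ (α ℕ.* j) * F m
          ≈⟨ solve 3 (λ a j f → (:1 :- a) :* f :+ (:1 :- j) :* a :* f := (:1 :- j :* a) :* f) refl _ _ _ ⟩
        (1# - q^ j * q^ (α ℕ.* j)) * F m
          ≈⟨ *-congʳ (+-congˡ (-‿cong (q^-split j (α ℕ.* j) (≡.trans (≡.cong (j ℕ.*_) (ℕ.m≤n⇒m⊓n≡m α<c)) (ℕ.*-comm j (suc α)))))) ⟨
        (1# - q^ (j ℕ.* (suc α ⊓ (K ∸ d ℕ.* m)))) * F m ∎
      ... | inj₂ c≤α = trans
        (+-cong (*-congʳ (+-congˡ (-‿cong (q^-cong (≡.cong (j ℕ.*_) (≡.trans (ℕ.m≥n⇒m⊓n≡n c≤α) (≡.sym (ℕ.m≥n⇒m⊓n≡n (ℕ.m≤n⇒m≤1+n c≤α)))))))))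
                (trans (*-congˡ (indicator-no (d ℕ.* m ℕ.<? K ∸ α) λ dm<K∸α → ℕ.≤⇒≯ c≤α (<-∸-swap dm<K∸α))) (zeroʳ _)))
        (+-identityʳ _)

    -- The recursion and its solution by theta sums

    private
      V′ : ℕ → ℕ → Carrier
      V′ s A = V s A (M ∸ A)

      V≈V′ : ∀ s A B → A ℕ.+ B ≡ M → V s A B ≈ V′ s A
      V≈V′ s A B A+B≡M = reflexive (≡.cong (V s A) (≡.trans (≡.sym (ℕ.m+n∸m≡n A B)) (≡.cong (_∸ A) A+B≡M)))

      V′-step : ∀ s A A′ → A ℕ.+ A′ ≡ K →
        V′ s (A ℕ.+ d) ≈ V′ s A + q^ (suc s ℕ.* A) * ((1# - q^ (suc s ℕ.* d)) * V′ (suc s) A′)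
      V′-step s A A′ eq = trans (sym (V≈V′ s (A ℕ.+ d) (K ℕ.+ A′) (e₁ K eq))) (trans (V-step s A A′ eq)
        (+-cong (V≈V′ s A (K ℕ.+ A′ ℕ.+ d) (e₂ K eq)) (*-congˡ (*-congˡ (V≈V′ (suc s) A′ (K ℕ.+ d ℕ.+ A) (e₃ K eq))))))
        where
        e₁′ : ∀ A A′ d → A ℕ.+ d ℕ.+ (A ℕ.+ A′ ℕ.+ A′) ≡ 2 ℕ.* (A ℕ.+ A′) ℕ.+ d
        e₁′ = solve-∀
        e₁ : ∀ K → A ℕ.+ A′ ≡ K → A ℕ.+ d ℕ.+ (K ℕ.+ A′) ≡ 2 ℕ.* K ℕ.+ d
        e₁ _ ≡.refl = e₁′ A A′ d
        e₂′ : ∀ A A′ d → A ℕ.+ (A ℕ.+ A′ ℕ.+ A′ ℕ.+ d) ≡ 2 ℕ.* (A ℕ.+ A′) ℕ.+ d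
        e₂′ = solve-∀
        e₂ : ∀ K → A ℕ.+ A′ ≡ K → A ℕ.+ (K ℕ.+ A′ ℕ.+ d) ≡ 2 ℕ.* K ℕ.+ d
        e₂ _ ≡.refl = e₂′ A A′ d
        e₃′ : ∀ A A′ d → A′ ℕ.+ (A ℕ.+ A′ ℕ.+ d ℕ.+ A) ≡ 2 ℕ.* (A ℕ.+ A′) ℕ.+ d
        e₃′ = solve-∀
        e₃ : ∀ K → A ℕ.+ A′ ≡ K → A′ ℕ.+ (K ℕ.+ d ℕ.+ A) ≡ 2 ℕ.* K ℕ.+ d
        e₃ _ ≡.refl = e₃′ A A′ d

      -- Telescoping `V′-step` along A = 0, d, 2d, ..., from the value 0 at A = 0.
      V′-multiples : ∀ s b → b ≤ suc k →
        V′ s (d ℕ.* b) ≈ (1# - q^ (suc s ℕ.* d)) * ∑ b (λ m → q^ (suc s ℕ.* (d ℕ.* m)) * V′ (suc s) (K ∸ d ℕ.* m))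
      V′-multiples s zero    _          = trans (reflexive (≡.cong (V′ s) (ℕ.*-zeroʳ d))) (trans (V-zero s) (sym (zeroʳ _)))
      V′-multiples s (suc b) (s≤s b≤k) = begin
        V′ s (d ℕ.* suc b)
          ≡⟨ ≡.cong (V′ s) (≡.trans (ℕ.*-suc d b) (ℕ.+-comm d _)) ⟩
        V′ s (d ℕ.* b ℕ.+ d)
          ≈⟨ V′-step s (d ℕ.* b) (K ∸ d ℕ.* b) (ℕ.m+[n∸m]≡n (ℕ.≤-trans (ℕ.*-monoʳ-≤ d b≤k) (ℕ.m≤m+n _ e))) ⟩
        V′ s (d ℕ.* b) + q^ (suc s ℕ.* (d ℕ.* b)) * ((1# - q^ (suc s ℕ.* d)) * V′ (suc s) (K ∸ d ℕ.* b))
          ≈⟨ +-congʳ (V′-multiples s b (ℕ.m≤n⇒m≤1+n b≤k)) ⟩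
        (1# - q^ (suc s ℕ.* d)) * ∑ b (λ m → q^ (suc s ℕ.* (d ℕ.* m)) * V′ (suc s) (K ∸ d ℕ.* m))
          + q^ (suc s ℕ.* (d ℕ.* b)) * ((1# - q^ (suc s ℕ.* d)) * V′ (suc s) (K ∸ d ℕ.* b))
          ≈⟨ solve 4 (λ c x p v → c :* x :+ p :* (c :* v) := c :* (x :+ p :* v)) refl _ _ _ _ ⟩
        (1# - q^ (suc s ℕ.* d)) * ∑ (suc b) (λ m → q^ (suc s ℕ.* (d ℕ.* m)) * V′ (suc s) (K ∸ d ℕ.* m)) ∎

      -- d(k + 1) equals K if e = d, and K + e if 2e = d. In the second case 1 - q^((s+1)d) is a
      -- difference of squares, and its factor 1 + q^((s+1)e) cancels against that of `V-half`.
      V′-e : ∀ s → V′ s e ≈ (1# - q^ (suc s ℕ.* e)) * V′ (suc s) (d ℕ.* suc k)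
      V′-e s = cases e-cond
        where
        cases : (e ≡ d) ⊎ (2 ℕ.* e ≡ d) → V′ s e ≈ (1# - q^ (suc s ℕ.* e)) * V′ (suc s) (d ℕ.* suc k)
        cases (inj₁ e≡d) = begin
          V′ s e
            ≡⟨ ≡.cong (V′ s) e≡d ⟩
          V′ s (0 ℕ.+ d)
            ≈⟨ V′-step s 0 K ≡.refl ⟩
          V′ s 0 + q^ (suc s ℕ.* 0) * ((1# - q^ (suc s ℕ.* d)) * V′ (suc s) K)
            ≈⟨ +-cong (V-zero s) (*-congʳ (trans (q^-cong (ℕ.*-zeroʳ s)) q^-0)) ⟩
          0# + 1# * ((1# - q^ (suc s ℕ.* d)) * V′ (suc s) K)
            ≈⟨ trans (+-identityˡ _) (*-identityˡ _) ⟩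
          (1# - q^ (suc s ℕ.* d)) * V′ (suc s) K
            ≡⟨ ≡.cong₂ (λ x y → (1# - q^ (suc s ℕ.* x)) * V′ (suc s) y) (≡.sym e≡d)
                 (≡.trans (ℕ.+-comm (d ℕ.* k) e) (≡.trans (≡.cong (ℕ._+ d ℕ.* k) e≡d) (≡.sym (ℕ.*-suc d k)))) ⟩
          (1# - q^ (suc s ℕ.* e)) * V′ (suc s) (d ℕ.* suc k) ∎
        cases (inj₂ 2e≡d) = 1+q^-cancel (suc s ℕ.* e) _ _ (ℕ.≤-trans 1≤e (ℕ.m≤m+n e _)) (begin
          (1# + q^ (suc s ℕ.* e)) * V′ s e
            ≈⟨ *-congˡ (V≈V′ s e (2 ℕ.* K ℕ.+ e) (e₁ d 2e≡d)) ⟨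
          (1# + q^ (suc s ℕ.* e)) * V s e (2 ℕ.* K ℕ.+ e)
            ≈⟨ V-half s e 2e≡d ⟩
          (1# - q^ (suc s ℕ.* d)) * V (suc s) (K ℕ.+ e) (K ℕ.+ e)
            ≈⟨ *-cong (+-congˡ (-‿cong (q^-split _ _ (e₂ d 2e≡d)))) (trans (V≈V′ (suc s) (K ℕ.+ e) (K ℕ.+ e) (e₃ d 2e≡d)) (reflexive (≡.cong (V′ (suc s)) (e₄ d 2e≡d)))) ⟩
          (1# - q^ (suc s ℕ.* e) * q^ (suc s ℕ.* e)) * V′ (suc s) (d ℕ.* suc k)
            ≈⟨ solve 2 (λ y v → (:1 :- y :* y) :* v := (:1 :+ y) :* ((:1 :- y) :* v)) refl _ _ ⟩
          (1# + q^ (suc s ℕ.* e)) * ((1# - q^ (suc s ℕ.* e)) * V′ (suc s) (d ℕ.* suc k)) ∎)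
          where
          e₁′ : ∀ e K → e ℕ.+ (2 ℕ.* K ℕ.+ e) ≡ 2 ℕ.* K ℕ.+ 2 ℕ.* e
          e₁′ = solve-∀
          e₁ : ∀ d → 2 ℕ.* e ≡ d → e ℕ.+ (2 ℕ.* K ℕ.+ e) ≡ 2 ℕ.* K ℕ.+ d
          e₁ _ ≡.refl = e₁′ e K
          e₂′ : ∀ s e → suc s ℕ.* (2 ℕ.* e) ≡ suc s ℕ.* e ℕ.+ suc s ℕ.* e
          e₂′ = solve-∀
          e₂ : ∀ d → 2 ℕ.* e ≡ d → suc s ℕ.* d ≡ suc s ℕ.* e ℕ.+ suc s ℕ.* e
          e₂ _ ≡.refl = e₂′ s e
          e₃′ : ∀ e K → K ℕ.+ e ℕ.+ (K ℕ.+ e) ≡ 2 ℕ.* K ℕ.+ 2 ℕ.* e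
          e₃′ = solve-∀
          e₃ : ∀ d → 2 ℕ.* e ≡ d → K ℕ.+ e ℕ.+ (K ℕ.+ e) ≡ 2 ℕ.* K ℕ.+ d
          e₃ _ ≡.refl = e₃′ e K
          e₄′ : ∀ e k → 2 ℕ.* e ℕ.* k ℕ.+ e ℕ.+ e ≡ 2 ℕ.* e ℕ.* suc k
          e₄′ = solve-∀
          e₄ : ∀ d → 2 ℕ.* e ≡ d → d ℕ.* k ℕ.+ e ℕ.+ e ≡ d ℕ.* suc k
          e₄ _ ≡.refl = e₄′ e k

      -- The counterpart of `gf-odd` for j = s + 1. Raising a by one adds, through `V′-step` and
      -- `V′-multiples`, a sum over m < k - a; these are exactly the m with K - d m > da + e, for
      -- which the minimum grows by d.
      V′-expansion : ∀ s a → a ≤ k →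
        V′ s (d ℕ.* a ℕ.+ e) ≈ (1# - q^ (suc (suc s) ℕ.* d)) * ∑ (suc k) (λ m →
          (1# - q^ (suc s ℕ.* ((d ℕ.* a ℕ.+ e) ⊓ (K ∸ d ℕ.* m)))) * (q^ (suc (suc s) ℕ.* (d ℕ.* m)) * V′ (suc (suc s)) (K ∸ d ℕ.* m)))
      V′-expansion s zero    _ = begin
        V′ s (d ℕ.* 0 ℕ.+ e)
          ≡⟨ ≡.cong (λ z → V′ s (z ℕ.+ e)) (ℕ.*-zeroʳ d) ⟩
        V′ s e
          ≈⟨ V′-e s ⟩
        (1# - q^ (suc s ℕ.* e)) * V′ (suc s) (d ℕ.* suc k)
          ≈⟨ *-congˡ (V′-multiples (suc s) (suc k) ℕ.≤-refl) ⟩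
        (1# - q^ (suc s ℕ.* e)) * ((1# - q^ (suc (suc s) ℕ.* d)) * ∑ (suc k) F)
          ≈⟨ solve 3 (λ a b c → a :* (b :* c) := b :* (a :* c)) refl _ _ _ ⟩
        (1# - q^ (suc (suc s) ℕ.* d)) * ((1# - q^ (suc s ℕ.* e)) * ∑ (suc k) F)
          ≈⟨ *-congˡ (trans (∑-* (suc k) _ F) (∑-cong< (suc k) λ { m (s≤s m≤k) → *-congʳ (+-congˡ (-‿cong (q^-cong (≡.cong (suc s ℕ.*_) (≡.sym (e⊓ m m≤k)))))) })) ⟩
        _ ∎
        where
        F : ℕ → Carrier
        F m = q^ (suc (suc s) ℕ.* (d ℕ.* m)) * V′ (suc (suc s)) (K ∸ d ℕ.* m)
        e⊓ : ∀ m → m ≤ k → (d ℕ.* 0 ℕ.+ e) ⊓ (K ∸ d ℕ.* m) ≡ e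
        e⊓ m m≤k = ≡.trans (≡.cong₂ _⊓_ (≡.cong (ℕ._+ e) (ℕ.*-zeroʳ d)) (K∸d* m m≤k)) (ℕ.m≤n⇒m⊓n≡m (ℕ.m≤n+m e _))
      V′-expansion s (suc a) a<k = begin
        V′ s (d ℕ.* suc a ℕ.+ e)
          ≡⟨ ≡.cong (V′ s) (e₁ d a e) ⟩
        V′ s (d ℕ.* a ℕ.+ e ℕ.+ d)
          ≈⟨ V′-step s (d ℕ.* a ℕ.+ e) (d ℕ.* (k ∸ a)) (≡.trans (e₂ d a e (k ∸ a)) (≡.cong (λ z → d ℕ.* z ℕ.+ e) (ℕ.m+[n∸m]≡n a≤k))) ⟩
        V′ s (d ℕ.* a ℕ.+ e) + y * ((1# - x) * V′ (suc s) (d ℕ.* (k ∸ a)))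
          ≈⟨ +-cong (V′-expansion s a a≤k) (*-congˡ (*-congˡ (V′-multiples (suc s) (k ∸ a) k∸a≤))) ⟩
        c * ∑ (suc k) (λ m → T a m * F m) + y * ((1# - x) * (c * ∑ (k ∸ a) F))
          ≈⟨ solve 5 (λ c t y x f → c :* t :+ y :* ((:1 :- x) :* (c :* f)) := c :* (t :+ (y :- y :* x) :* f)) refl c _ y x _ ⟩
        c * (∑ (suc k) (λ m → T a m * F m) + (y - y * x) * ∑ (k ∸ a) F)
          ≈⟨ *-congˡ (+-congˡ (trans (*-congˡ (sym (∑-indicator-< (k ∸ a) (suc k) F k∸a≤))) (∑-* (suc k) _ _))) ⟩
        c * (∑ (suc k) (λ m → T a m * F m) + ∑ (suc k) (λ m → (y - y * x) * indicator (m ℕ.<? k ∸ a) (F m)))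
          ≈⟨ *-congˡ (sym (∑-+ (suc k) _ _)) ⟩
        c * ∑ (suc k) (λ m → T a m * F m + (y - y * x) * indicator (m ℕ.<? k ∸ a) (F m))
          ≈⟨ *-congˡ (∑-cong< (suc k) λ { m (s≤s m≤k) → term m m≤k }) ⟩
        c * ∑ (suc k) (λ m → T (suc a) m * F m) ∎
        where
        a≤k = ℕ.<⇒≤ a<k
        F T′ : ℕ → Carrier
        F m = q^ (suc (suc s) ℕ.* (d ℕ.* m)) * V′ (suc (suc s)) (K ∸ d ℕ.* m)
        T′ A = 1# - q^ (suc s ℕ.* A)
        T : ℕ → ℕ → Carrier
        T a m = T′ ((d ℕ.* a ℕ.+ e) ⊓ (K ∸ d ℕ.* m))
        x = q^ (suc s ℕ.* d)
        y = q^ (suc s ℕ.* (d ℕ.* a ℕ.+ e))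
        c = 1# - q^ (suc (suc s) ℕ.* d)

        e₁ : ∀ d a e → d ℕ.* suc a ℕ.+ e ≡ d ℕ.* a ℕ.+ e ℕ.+ d
        e₁ = solve-∀
        e₂ : ∀ d a e b → d ℕ.* a ℕ.+ e ℕ.+ d ℕ.* b ≡ d ℕ.* (a ℕ.+ b) ℕ.+ e
        e₂ = solve-∀
        k∸a≤ : k ∸ a ≤ suc k
        k∸a≤ = ℕ.m≤n⇒m≤1+n (ℕ.m∸n≤m k a)

        mono : ∀ {a b} → a ≤ b → d ℕ.* a ℕ.+ e ≤ d ℕ.* b ℕ.+ e
        mono a≤b = ℕ.+-monoˡ-≤ e (ℕ.*-monoʳ-≤ d a≤b)

        T-low : ∀ b m → m ≤ k → b ≤ k ∸ m → T b m ≈ T′ (d ℕ.* b ℕ.+ e)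
        T-low b m m≤k b≤ = reflexive (≡.cong T′ (≡.trans (≡.cong ((d ℕ.* b ℕ.+ e) ⊓_) (K∸d* m m≤k)) (ℕ.m≤n⇒m⊓n≡m (mono b≤))))

        T-high : ∀ b m → m ≤ k → k ∸ m ≤ b → T b m ≈ T′ (d ℕ.* (k ∸ m) ℕ.+ e)
        T-high b m m≤k ≤b = reflexive (≡.cong T′ (≡.trans (≡.cong ((d ℕ.* b ℕ.+ e) ⊓_) (K∸d* m m≤k)) (ℕ.m≥n⇒m⊓n≡n (mono ≤b))))

        term : ∀ m → m ≤ k → T a m * F m + (y - y * x) * indicator (m ℕ.<? k ∸ a) (F m) ≈ T (suc a) m * F m
        term m m≤k with ℕ.<-≤-connex m (k ∸ a)
        ... | inj₁ m<k∸a = begin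
          T a m * F m + (y - y * x) * indicator (m ℕ.<? k ∸ a) (F m)
            ≈⟨ +-cong (*-congʳ (T-low a m m≤k (ℕ.<⇒≤ a<k∸m))) (*-congˡ (indicator-yes (m ℕ.<? k ∸ a) m<k∸a)) ⟩
          (1# - y) * F m + (y - y * x) * F m
            ≈⟨ solve 3 (λ x y f → (:1 :- y) :* f :+ (y :- y :* x) :* f := (:1 :- y :* x) :* f) refl x y (F m) ⟩
          (1# - y * x) * F m
            ≈⟨ *-congʳ (+-congˡ (-‿cong (sym (q^-split _ _ (≡.trans (≡.cong (suc s ℕ.*_) (e₁ d a e)) (ℕ.*-distribˡ-+ (suc s) _ d)))))) ⟩
          T′ (d ℕ.* suc a ℕ.+ e) * F m
            ≈⟨ *-congʳ (T-low (suc a) m m≤k a<k∸m) ⟨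
          T (suc a) m * F m ∎
          where
          a<k∸m : a < k ∸ m
          a<k∸m = <-∸-swap m<k∸a
        ... | inj₂ k∸a≤m = trans (+-cong (*-congʳ (T-high a m m≤k k∸m≤a)) (trans (*-congˡ (indicator-no (m ℕ.<? k ∸ a) (ℕ.≤⇒≯ k∸a≤m))) (zeroʳ _)))
          (trans (+-identityʳ _) (*-congʳ (sym (T-high (suc a) m m≤k (ℕ.m≤n⇒m≤1+n k∸m≤a)))))
          where
          k∸m≤a : k ∸ m ≤ a
          k∸m≤a = ℕ.m≤n+o⇒m∸n≤o k m (ℕ.≤-trans (ℕ.≤-trans (ℕ.m≤n+m∸n k a) (ℕ.+-monoʳ-≤ a k∸a≤m)) (ℕ.≤-reflexive (ℕ.+-comm a m)))

    private
      -- The denominators contributed by the parts 2t + 1, with arbitrary multiplicity, and 2t + 2,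
      -- with multiplicity divisible by d.
      factor : ℕ → Carrier
      factor t = (1# - q^ (suc (double t))) * (1# - q^ (suc (suc (double t)) ℕ.* d))

      factors : ℕ → ℕ → Carrier
      factors i j = ∏ i (λ t → factor (t ℕ.+ j))

      factors-suc : ∀ i j → factors (suc i) j ≈ factor j * factors i (suc j)
      factors-suc i j = trans (∏-head i _) (*-congˡ (∏-cong i (λ t → reflexive (≡.cong factor (≡.sym (ℕ.+-suc t j))))))

      factors-gf : ∀ i j α → factors (suc i) j * gf (double (suc i)) (suc (double j)) α ≈
        (1# - q^ (suc (suc (double j)) ℕ.* d)) * ∑ (suc k) (λ m →
          (1# - q^ (suc (double j) ℕ.* (α ⊓ (K ∸ d ℕ.* m)))) *
            (q^ (suc (suc (double j)) ℕ.* (d ℕ.* m)) * (factors i (suc j) * gf (double i) (suc (double (suc j))) (K ∸ d ℕ.* m))))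
      factors-gf i j α = begin
        factors (suc i) j * gf (double (suc i)) (suc s) α
          ≈⟨ *-congʳ (factors-suc i j) ⟩
        (1# - q^ (suc s)) * c * factors i (suc j) * gf (double (suc i)) (suc s) α
          ≈⟨ solve 4 (λ a b x g → a :* b :* x :* g := b :* (x :* (a :* g))) refl _ _ _ _ ⟩
        c * (factors i (suc j) * ((1# - q^ (suc s)) * gf (double (suc i)) (suc s) α))
          ≈⟨ *-congˡ (trans (*-congˡ (gf-odd (double i) (suc s) α (2∤1+double j) (2∣double (suc j)))) (∑-* (suc k) _ _)) ⟩
        c * ∑ (suc k) (λ m → factors i (suc j) * ((1# - q^ (suc s ℕ.* (α ⊓ (K ∸ d ℕ.* m)))) *
            (q^ (d ℕ.* m ℕ.* suc (suc s)) * gf (double i) (suc (double (suc j))) (K ∸ d ℕ.* m))))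
          ≈⟨ *-congˡ (∑-cong (suc k) (λ m → trans
               (solve 4 (λ x t p g → x :* (t :* (p :* g)) := t :* (p :* (x :* g))) refl _ _ _ _)
               (*-congˡ (*-congʳ (q^-cong (ℕ.*-comm (d ℕ.* m) (suc (suc s)))))))) ⟩
        c * ∑ (suc k) (λ m → (1# - q^ (suc s ℕ.* (α ⊓ (K ∸ d ℕ.* m)))) *
            (q^ (suc (suc s) ℕ.* (d ℕ.* m)) * (factors i (suc j) * gf (double i) (suc (double (suc j))) (K ∸ d ℕ.* m)))) ∎
        where
        s = double j
        c = 1# - q^ (suc (suc s) ℕ.* d)

      gf-zero : ∀ j α → 1 ≤ α → gf 0 j α ≈ 1#
      gf-zero j (suc α) _ = refl

      -- Both sides obey one recursion, by `factors-gf` and by `V′-expansion` at s = 2j. The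
      -- induction is on the number i of remaining pairs of parts while j increases; at i = 0 the
      -- bound gives j ≥ N and both sides are 1.
      factors-gf≈V′ : ∀ i j a → N ≤ i ℕ.+ j → a ≤ k →
        factors i j * gf (double i) (suc (double j)) (d ℕ.* a ℕ.+ e) ≈ V′ (double j) (d ℕ.* a ℕ.+ e)
      factors-gf≈V′ zero    j a N≤j a≤k = trans
        (trans (*-identityˡ _) (gf-zero _ (d ℕ.* a ℕ.+ e) 1≤A))
        (sym (V-large (double j) (d ℕ.* a ℕ.+ e) (M ∸ (d ℕ.* a ℕ.+ e)) (ℕ.≤-trans N≤j (m≤double j)) 1≤A))
        where
        1≤A : 1 ≤ d ℕ.* a ℕ.+ e
        1≤A = ℕ.≤-trans 1≤e (ℕ.m≤n+m e _)
      factors-gf≈V′ (suc i) j a N≤ a≤k = begin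
        factors (suc i) j * gf (double (suc i)) (suc (double j)) (d ℕ.* a ℕ.+ e)
          ≈⟨ factors-gf i j (d ℕ.* a ℕ.+ e) ⟩
        _ ≈⟨ *-congˡ (∑-cong< (suc k) λ { m (s≤s m≤k) → *-congˡ (*-congˡ (hypothesis m m≤k)) }) ⟩
        _ ≈⟨ V′-expansion (double j) a a≤k ⟨
        V′ (double j) (d ℕ.* a ℕ.+ e) ∎
        where
        hypothesis : ∀ m → m ≤ k → factors i (suc j) * gf (double i) (suc (double (suc j))) (K ∸ d ℕ.* m) ≈ V′ (double (suc j)) (K ∸ d ℕ.* m)
        hypothesis m m≤k = ≡.subst (λ z → factors i (suc j) * gf (double i) (suc (double (suc j))) z ≈ V′ (double (suc j)) z)
          (≡.sym (K∸d* m m≤k))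
          (factors-gf≈V′ i (suc j) (k ∸ m) (ℕ.≤-trans N≤ (ℕ.≤-reflexive (≡.sym (ℕ.+-suc i j)))) (ℕ.m∸n≤m k m))

    -- The numerator as a function of the bound on φ_1

    numerator : ℕ → Carrier
    numerator α = qpoch 2 1 (suc N) * qpoch (2 ℕ.* d) (2 ℕ.* d) (suc N) * gf (double (suc N)) 1 α

    private
      factors≈ : ∀ i → factors i 0 ≈ qpoch 2 1 i * qpoch (2 ℕ.* d) (2 ℕ.* d) i
      factors≈ i = trans (∏-cong i (λ t → *-cong
          (+-congˡ (-‿cong (q^-cong (≡.cong suc (≡.trans (≡.cong double (ℕ.+-identityʳ t)) (double≡2* t))))))
          (+-congˡ (-‿cong (q^-cong (≡.trans (≡.cong (λ z → suc (suc z) ℕ.* d) (≡.trans (≡.cong double (ℕ.+-identityʳ t)) (double≡2* t))) (e′ t d)))))))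
        (∏-* i _ _)
        where
        e′ : ∀ t d → suc (suc (2 ℕ.* t)) ℕ.* d ≡ 2 ℕ.* d ℕ.+ 2 ℕ.* d ℕ.* t
        e′ = solve-∀

      weights : ℕ → Carrier
      weights m = (1# - q^ (2 ℕ.* d)) * (q^ (2 ℕ.* (d ℕ.* m)) * (factors N 1 * gf (double N) 3 (K ∸ d ℕ.* m)))

      numerator-sum : ∀ α → numerator α ≈ ∑ (suc k) (λ m → (1# - q^ (α ⊓ (K ∸ d ℕ.* m))) * weights m)
      numerator-sum α = begin
        numerator α
          ≈⟨ *-congʳ (factors≈ (suc N)) ⟨
        factors (suc N) 0 * gf (double (suc N)) 1 α
          ≈⟨ factors-gf N 0 α ⟩
        _ ≈⟨ ∑-* (suc k) _ _ ⟩
        _ ≈⟨ ∑-cong (suc k) (λ m → trans (solve 3 (λ c t w → c :* (t :* w) := t :* (c :* w)) refl _ _ _)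
               (*-congʳ (+-congˡ (-‿cong (q^-cong (ℕ.*-identityˡ _)))))) ⟩
        ∑ (suc k) (λ m → (1# - q^ (α ⊓ (K ∸ d ℕ.* m))) * weights m) ∎

      ⊓-low : ∀ A m → m ≤ k → A ≤ d ℕ.* (k ∸ m) ℕ.+ e → A ⊓ (K ∸ d ℕ.* m) ≡ A
      ⊓-low A m m≤k A≤ = ℕ.m≤n⇒m⊓n≡m (ℕ.≤-trans A≤ (ℕ.≤-reflexive (≡.sym (K∸d* m m≤k))))

      ⊓-high : ∀ A m → m ≤ k → d ℕ.* (k ∸ m) ℕ.+ e ≤ A → A ⊓ (K ∸ d ℕ.* m) ≡ K ∸ d ℕ.* m
      ⊓-high A m m≤k ≤A = ℕ.m≥n⇒m⊓n≡n (ℕ.≤-trans (ℕ.≤-reflexive (K∸d* m m≤k)) ≤A)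

    numerator-product : ∀ a B → a ≤ k → 1 ≤ B → d ℕ.* a ℕ.+ e ℕ.+ B ≡ M →
      numerator (d ℕ.* a ℕ.+ e) ≈ qpoch M (d ℕ.* a ℕ.+ e) N * (qpoch M B N * qpoch M (M ℕ.* 1) (suc N))
    numerator-product a B a≤k 1≤B A+B≡M = begin
      numerator A                                       ≈⟨ *-congʳ (factors≈ (suc N)) ⟨
      factors (suc N) 0 * gf (double (suc N)) 1 A       ≈⟨ factors-gf≈V′ (suc N) 0 a (ℕ.≤-trans (ℕ.n≤1+n N) (ℕ.m≤m+n _ 0)) a≤k ⟩
      V′ 0 A                                            ≈⟨ V≈V′ 0 A B A+B≡M ⟨
      V 0 A B                                           ≈⟨ V-product A B (ℕ.≤-trans 1≤e (ℕ.m≤n+m e _)) 1≤B A+B≡M ⟩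
      qpoch M A N * (qpoch M B N * qpoch M (M ℕ.* 1) (suc N)) ∎
      where A = d ℕ.* a ℕ.+ e

    -- From α = K on, every minimum is K - d m: the bound on φ_1 has become a consequence of φ_1 +
    -- φ_2 < K.
    numerator-top : numerator (d ℕ.* suc k ℕ.+ e) ≈ numerator (d ℕ.* k ℕ.+ e)
    numerator-top = trans (numerator-sum _) (trans
      (∑-cong< (suc k) λ { m (s≤s m≤k) → *-congʳ (+-congˡ (-‿cong (q^-cong (≡.trans
        (⊓-high (d ℕ.* suc k ℕ.+ e) m m≤k (ℕ.+-monoˡ-≤ e (ℕ.*-monoʳ-≤ d (ℕ.≤-trans (ℕ.m∸n≤m k m) (ℕ.n≤1+n k)))))
        (≡.sym (⊓-high (d ℕ.* k ℕ.+ e) m m≤k (ℕ.+-monoˡ-≤ e (ℕ.*-monoʳ-≤ d (ℕ.m∸n≤m k m))))))))) })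
      (sym (numerator-sum _)))

    -- No value of K - d m lies strictly between d a + e and d (a + 1) + e, so q^min(α, K - d m) is,
    -- for α in that range, an affine function of q^α.
    numerator-interpolation : ∀ a g → g ≤ d →
      (1# - q^ d) * numerator (d ℕ.* a ℕ.+ e ℕ.+ g) ≈
        (1# - q^ g) * numerator (d ℕ.* suc a ℕ.+ e) + (q^ g - q^ d) * numerator (d ℕ.* a ℕ.+ e)
    numerator-interpolation a g g≤d = begin
      (1# - q^ d) * numerator (A ℕ.+ g)
        ≈⟨ trans (*-congˡ (numerator-sum _)) (∑-* (suc k) _ _) ⟩
      ∑ (suc k) (λ m → (1# - q^ d) * (x (A ℕ.+ g) m * weights m))
        ≈⟨ ∑-cong< (suc k) (λ { m (s≤s m≤k) → term m m≤k }) ⟩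
      ∑ (suc k) (λ m → (1# - q^ g) * (x A⁺ m * weights m) + (q^ g - q^ d) * (x A m * weights m))
        ≈⟨ ∑-+ (suc k) _ _ ⟩
      ∑ (suc k) (λ m → (1# - q^ g) * (x A⁺ m * weights m)) + ∑ (suc k) (λ m → (q^ g - q^ d) * (x A m * weights m))
        ≈⟨ +-cong (trans (*-congˡ (numerator-sum _)) (∑-* (suc k) _ _)) (trans (*-congˡ (numerator-sum _)) (∑-* (suc k) _ _)) ⟨
      (1# - q^ g) * numerator A⁺ + (q^ g - q^ d) * numerator A ∎
      where
      A A⁺ : ℕ
      A  = d ℕ.* a ℕ.+ e
      A⁺ = d ℕ.* suc a ℕ.+ e

      x : ℕ → ℕ → Carrier
      x α m = 1# - q^ (α ⊓ (K ∸ d ℕ.* m))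

      A⁺≡ : ∀ d a e → d ℕ.* suc a ℕ.+ e ≡ d ℕ.* a ℕ.+ e ℕ.+ d
      A⁺≡ = solve-∀

      A+g≤A⁺ : A ℕ.+ g ≤ A⁺
      A+g≤A⁺ = ℕ.≤-trans (ℕ.+-monoʳ-≤ A g≤d) (ℕ.≤-reflexive (≡.sym (A⁺≡ d a e)))

      x-low : ∀ α m → m ≤ k → α ≤ d ℕ.* (k ∸ m) ℕ.+ e → x α m ≈ 1# - q^ α
      x-low α m m≤k α≤ = +-congˡ (-‿cong (q^-cong (⊓-low α m m≤k α≤)))

      x-high : ∀ α m → m ≤ k → d ℕ.* (k ∸ m) ℕ.+ e ≤ α → x α m ≈ 1# - q^ (K ∸ d ℕ.* m)
      x-high α m m≤k ≤α = +-congˡ (-‿cong (q^-cong (⊓-high α m m≤k ≤α)))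

      term : ∀ m → m ≤ k →
        (1# - q^ d) * (x (A ℕ.+ g) m * weights m) ≈ (1# - q^ g) * (x A⁺ m * weights m) + (q^ g - q^ d) * (x A m * weights m)
      term m m≤k with ℕ.<-≤-connex a (k ∸ m)
      ... | inj₁ a<p = begin
        (1# - q^ d) * (x (A ℕ.+ g) m * weights m)
          ≈⟨ *-congˡ (*-congʳ (trans (x-low (A ℕ.+ g) m m≤k (ℕ.≤-trans A+g≤A⁺ A⁺≤)) (+-congˡ (-‿cong (q^-+ A g))))) ⟩
        (1# - q^ d) * ((1# - q^ A * q^ g) * weights m)
          ≈⟨ solve 4 (λ D z u w → (:1 :- D) :* ((:1 :- z :* u) :* w) := (:1 :- u) :* ((:1 :- z :* D) :* w) :+ (u :- D) :* ((:1 :- z) :* w)) refl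
               (q^ d) (q^ A) (q^ g) (weights m) ⟩
        (1# - q^ g) * ((1# - q^ A * q^ d) * weights m) + (q^ g - q^ d) * ((1# - q^ A) * weights m)
          ≈⟨ +-cong (*-congˡ (*-congʳ (trans (x-low A⁺ m m≤k A⁺≤) (+-congˡ (-‿cong (q^-split A d (A⁺≡ d a e)))))))
                    (*-congˡ (*-congʳ (x-low A m m≤k (ℕ.≤-trans (ℕ.≤-trans (ℕ.m≤m+n A g) A+g≤A⁺) A⁺≤)))) ⟨
        (1# - q^ g) * (x A⁺ m * weights m) + (q^ g - q^ d) * (x A m * weights m) ∎
        where
        A⁺≤ : A⁺ ≤ d ℕ.* (k ∸ m) ℕ.+ e
        A⁺≤ = ℕ.+-monoˡ-≤ e (ℕ.*-monoʳ-≤ d a<p)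
      ... | inj₂ p≤a = begin
        (1# - q^ d) * (x (A ℕ.+ g) m * weights m)
          ≈⟨ *-congˡ (*-congʳ (x-high (A ℕ.+ g) m m≤k (ℕ.≤-trans ≤A (ℕ.m≤m+n A g)))) ⟩
        (1# - q^ d) * (y * weights m)
          ≈⟨ solve 4 (λ D y u w → (:1 :- D) :* (y :* w) := (:1 :- u) :* (y :* w) :+ (u :- D) :* (y :* w)) refl (q^ d) y (q^ g) (weights m) ⟩
        (1# - q^ g) * (y * weights m) + (q^ g - q^ d) * (y * weights m)
          ≈⟨ +-cong (*-congˡ (*-congʳ (x-high A⁺ m m≤k (ℕ.≤-trans ≤A (ℕ.≤-trans (ℕ.m≤m+n A g) A+g≤A⁺)))))
                    (*-congˡ (*-congʳ (x-high A m m≤k ≤A))) ⟨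
        (1# - q^ g) * (x A⁺ m * weights m) + (q^ g - q^ d) * (x A m * weights m) ∎
        where
        y = 1# - q^ (K ∸ d ℕ.* m)
        ≤A : d ℕ.* (k ∸ m) ℕ.+ e ≤ A
        ≤A = ℕ.+-monoˡ-≤ e (ℕ.*-monoʳ-≤ d p≤a)

open import Data.Product.Base using (_×_; _,_; ∃; ∃₂)
open import Defs
open ≡ using (refl; sym; trans; cong; cong₂; subst; module ≡-Reasoning)

-- The ring of power series modulo q^N

tail : Series → Series
tail f n = f (suc n)

Σ<-first : ∀ n F → Σ< (suc n) F ≡ F 0 ℤ.+ Σ< n (λ i → F (suc i))
Σ<-first zero    F = ℤ.+-comm 0ℤ (F 0)
Σ<-first (suc n) F = trans (cong (ℤ._+ F (suc n)) (Σ<-first n F)) (ℤ.+-assoc (F 0) _ (F (suc n)))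

-- Splitting off one constant term lowers the coefficient index, so commutativity and associativity
-- follow by induction on it without exchanging double sums.
⊛-first : ∀ f g n → (f ⊛ g) (suc n) ≡ f 0 ℤ.* g (suc n) ℤ.+ (tail f ⊛ g) n
⊛-first f g n = Σ<-first (suc n) (λ i → f i ℤ.* g (suc n ∸ i))

⊛-last : ∀ f g n → (f ⊛ g) (suc n) ≡ (f ⊛ tail g) n ℤ.+ f (suc n) ℤ.* g 0
⊛-last f g n = cong₂ ℤ._+_
  (Σ<-cong (suc n) λ { i (s≤s i≤n) → cong (λ j → f i ℤ.* g j) (ℕ.+-∸-assoc 1 i≤n) })
  (cong (λ j → f (suc n) ℤ.* g j) (ℕ.n∸n≡0 n))

⊛-comm : ∀ f g n → (f ⊛ g) n ≡ (g ⊛ f) n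
⊛-comm f g zero    = cong (λ z → 0ℤ ℤ.+ z) (ℤ.*-comm (f 0) (g 0))
⊛-comm f g (suc n) = begin
  (f ⊛ g) (suc n)                              ≡⟨ ⊛-first f g n ⟩
  f 0 ℤ.* g (suc n) ℤ.+ (tail f ⊛ g) n         ≡⟨ cong₂ ℤ._+_ (ℤ.*-comm (f 0) (g (suc n))) (⊛-comm (tail f) g n) ⟩
  g (suc n) ℤ.* f 0 ℤ.+ (g ⊛ tail f) n         ≡⟨ ℤ.+-comm (g (suc n) ℤ.* f 0) _ ⟩
  (g ⊛ tail f) n ℤ.+ g (suc n) ℤ.* f 0         ≡⟨ ⊛-last g f n ⟨
  (g ⊛ f) (suc n)                              ∎
  where open ≡-Reasoning

⊛-distribˡ : ∀ f g h n → (f ⊛ (g ⊕ h)) n ≡ ((f ⊛ g) ⊕ (f ⊛ h)) n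
⊛-distribˡ f g h n = trans (Σ<-cong (suc n) (λ i _ → ℤ.*-distribˡ-+ (f i) (g (n ∸ i)) (h (n ∸ i)))) (sym (Σ<-+ (suc n)))

⊛-scale : ∀ c f g n → ((λ i → c ℤ.* f i) ⊛ g) n ≡ c ℤ.* (f ⊛ g) n
⊛-scale c f g n = go (suc n)
  where
  go : ∀ m → Σ< m (λ i → c ℤ.* f i ℤ.* g (n ∸ i)) ≡ c ℤ.* Σ< m (λ i → f i ℤ.* g (n ∸ i))
  go zero    = sym (ℤ.*-zeroʳ c)
  go (suc m) = trans (cong₂ ℤ._+_ (go m) (ℤ.*-assoc c (f m) _)) (sym (ℤ.*-distribˡ-+ c _ _))

⊛-assoc : ∀ f g h n → ((f ⊛ g) ⊛ h) n ≡ (f ⊛ (g ⊛ h)) n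
⊛-assoc f g h zero    = assoc₀ (f 0) (g 0) (h 0)
  where
  assoc₀ : ∀ a b c → 0ℤ ℤ.+ (0ℤ ℤ.+ a ℤ.* b) ℤ.* c ≡ 0ℤ ℤ.+ a ℤ.* (0ℤ ℤ.+ b ℤ.* c)
  assoc₀ = ℤ-solve-∀
⊛-assoc f g h (suc n) = begin
  ((f ⊛ g) ⊛ h) (suc n)
    ≡⟨ ⊛-first (f ⊛ g) h n ⟩
  (f ⊛ g) 0 ℤ.* h (suc n) ℤ.+ (tail (f ⊛ g) ⊛ h) n
    ≡⟨ cong (λ z → (f ⊛ g) 0 ℤ.* h (suc n) ℤ.+ z) (⊛-cong n _ ((λ i → f 0 ℤ.* tail g i) ⊕ (tail f ⊛ g)) h h (λ i _ → ⊛-first f g i) (λ _ _ → refl)) ⟩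
  (f ⊛ g) 0 ℤ.* h (suc n) ℤ.+ (((λ i → f 0 ℤ.* tail g i) ⊕ (tail f ⊛ g)) ⊛ h) n
    ≡⟨ cong (λ z → (f ⊛ g) 0 ℤ.* h (suc n) ℤ.+ z) (⊛-distribʳ (λ i → f 0 ℤ.* tail g i) (tail f ⊛ g) h n) ⟨
  (f ⊛ g) 0 ℤ.* h (suc n) ℤ.+ (((λ i → f 0 ℤ.* tail g i) ⊛ h) n ℤ.+ ((tail f ⊛ g) ⊛ h) n)
    ≡⟨ cong (λ z → (f ⊛ g) 0 ℤ.* h (suc n) ℤ.+ z) (cong₂ ℤ._+_ (⊛-scale (f 0) (tail g) h n) (⊛-assoc (tail f) g h n)) ⟩
  (f ⊛ g) 0 ℤ.* h (suc n) ℤ.+ (f 0 ℤ.* (tail g ⊛ h) n ℤ.+ (tail f ⊛ (g ⊛ h)) n)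
    ≡⟨ regroup (f 0) (g 0) (h (suc n)) ((tail g ⊛ h) n) ((tail f ⊛ (g ⊛ h)) n) ⟩
  f 0 ℤ.* (g 0 ℤ.* h (suc n) ℤ.+ (tail g ⊛ h) n) ℤ.+ (tail f ⊛ (g ⊛ h)) n
    ≡⟨ cong (λ z → f 0 ℤ.* z ℤ.+ (tail f ⊛ (g ⊛ h)) n) (⊛-first g h n) ⟨
  f 0 ℤ.* (g ⊛ h) (suc n) ℤ.+ (tail f ⊛ (g ⊛ h)) n
    ≡⟨ ⊛-first f (g ⊛ h) n ⟨
  (f ⊛ (g ⊛ h)) (suc n) ∎
  where
  open ≡-Reasoning
  regroup : ∀ a b c x y → (0ℤ ℤ.+ a ℤ.* b) ℤ.* c ℤ.+ (a ℤ.* x ℤ.+ y) ≡ a ℤ.* (b ℤ.* c ℤ.+ x) ℤ.+ y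
  regroup = ℤ-solve-∀

q^-coefficient-≢ : ∀ {m n} → ¬ m ≡ n → (q^ m) n ≡ 0ℤ
q^-coefficient-≢ {m} {n} m≢n = cong (λ b → if b then 1ℤ else 0ℤ) (dec-false (m ℕ.≟ n) m≢n)

q^suc-⊛ : ∀ m f n → (q^ suc m ⊛ f) (suc n) ≡ (q^ m ⊛ f) n
q^suc-⊛ m f n = trans (⊛-first (q^ suc m) f n) (trans (cong (ℤ._+ (tail (q^ suc m) ⊛ f) n) (ℤ.*-zeroˡ (f (suc n))))
  (ℤ.+-identityˡ _))

q^-⊛-shift : ∀ m f n → (q^ m ⊛ f) (m ℕ.+ n) ≡ f n
q^-⊛-shift zero    f n = ⊛-identityˡ f n
q^-⊛-shift (suc m) f n = trans (q^suc-⊛ m f (m ℕ.+ n)) (q^-⊛-shift m f n)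

q^-⊛-below : ∀ m f n → n < m → (q^ m ⊛ f) n ≡ 0ℤ
q^-⊛-below (suc m) f zero    _         = cong (λ z → 0ℤ ℤ.+ z) (ℤ.*-zeroˡ (f 0))
q^-⊛-below (suc m) f (suc n) (s≤s n<m) = trans (q^suc-⊛ m f n) (q^-⊛-below m f n n<m)

q^-+ : ∀ m n → q^ (m ℕ.+ n) ≈ q^ m ⊛ q^ n
q^-+ zero    n i       = sym (⊛-identityˡ (q^ n) i)
q^-+ (suc m) n zero    = sym (q^-⊛-below (suc m) (q^ n) 0 (s≤s z≤n))
q^-+ (suc m) n (suc i) = trans (q^-+ m n i) (sym (q^suc-⊛ m (q^ n) i))

pow-q^ : ∀ M i → pow (q^ M) i ≈ q^ (M ℕ.* i)
pow-q^ M zero    n = cong (λ j → (q^ j) n) (sym (ℕ.*-zeroʳ M))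
pow-q^ M (suc i) n = begin
  (pow (q^ M) i ⊛ q^ M) n       ≡⟨ ⊛-cong n _ (q^ (M ℕ.* i)) _ (q^ M) (λ j _ → pow-q^ M i j) (λ _ _ → refl) ⟩
  (q^ (M ℕ.* i) ⊛ q^ M) n       ≡⟨ q^-+ (M ℕ.* i) M n ⟨
  (q^ (M ℕ.* i ℕ.+ M)) n        ≡⟨ cong (λ j → (q^ j) n) (trans (ℕ.+-comm (M ℕ.* i) M) (sym (ℕ.*-suc M i))) ⟩
  (q^ (M ℕ.* suc i)) n          ∎
  where open ≡-Reasoning

infix 4 _≈[_]_

record _≈[_]_ (f : Series) (N : ℕ) (g : Series) : Set where
  constructor agree
  field below : ∀ n → n < N → f n ≡ g n

open _≈[_]_

≈⇒≈[] : ∀ {f g N} → f ≈ g → f ≈[ N ] g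
≈⇒≈[] f≈g = agree (λ n _ → f≈g n)

≈[]⇒≈ : ∀ f g → (∀ N → f ≈[ N ] g) → f ≈ g
≈[]⇒≈ f g h n = below (h (suc n)) n ℕ.≤-refl

-- The quotient by q^N is a setoid: the series and operations stay the same and only equality
-- becomes coarser, so a ring identity for all N is directly one of series.
truncatedRing : ℕ → CommutativeRing 0ℓ 0ℓ
truncatedRing N = record
  { Carrier = Series
  ; _≈_     = _≈[ N ]_
  ; _+_     = _⊕_
  ; _*_     = _⊛_
  ; -_      = λ f n → ℤ.- f n
  ; 0#      = λ _ → 0ℤ
  ; 1#      = 𝟙
  ; isCommutativeRing = record
    { isRing = record
      { +-isAbelianGroup = record
        { isGroup = record
          { isMonoid = record
            { isSemigroup = record
              { isMagma = record
                { isEquivalence = record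
                  { refl  = agree λ _ _ → refl
                  ; sym   = λ p → agree λ n n<N → sym (below p n n<N)
                  ; trans = λ p q → agree λ n n<N → trans (below p n n<N) (below q n n<N)
                  }
                ; ∙-cong = λ p q → agree λ n n<N → cong₂ ℤ._+_ (below p n n<N) (below q n n<N)
                }
              ; assoc = λ f g h → agree λ n _ → ℤ.+-assoc (f n) (g n) (h n)
              }
            ; identity = (λ f → agree λ n _ → ℤ.+-identityˡ (f n)) , (λ f → agree λ n _ → ℤ.+-identityʳ (f n))
            }
          ; inverse = (λ f → agree λ n _ → ℤ.+-inverseˡ (f n)) , (λ f → agree λ n _ → ℤ.+-inverseʳ (f n))
          ; ⁻¹-cong = λ p → agree λ n n<N → cong ℤ.-_ (below p n n<N)
          }
        ; comm = λ f g → agree λ n _ → ℤ.+-comm (f n) (g n)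
        }
      ; *-cong = λ {f} {f′} {g} {g′} p q → agree λ n n<N → ⊛-cong n f f′ g g′
          (λ i i≤n → below p i (ℕ.≤-<-trans i≤n n<N)) (λ i i≤n → below q i (ℕ.≤-<-trans i≤n n<N))
      ; *-assoc = λ f g h → agree λ n _ → ⊛-assoc f g h n
      ; *-identity = (λ f → agree λ n _ → ⊛-identityˡ f n) , (λ f → agree λ n _ → ⊛-identityʳ f n)
      ; distrib = (λ f g h → agree λ n _ → ⊛-distribˡ f g h n) , (λ f g h → agree λ n _ → sym (⊛-distribʳ g h f n))
      }
    ; *-comm = λ f g → agree λ n _ → ⊛-comm f g n
    }
  }

module Truncated (N : ℕ) where
  open CommutativeRing (truncatedRing N) using (_-_; *-cong; *-congˡ) renaming (refl to ≈-refl; sym to ≈-sym; trans to ≈-trans)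

  powers : TruncatedPowers (truncatedRing N) N
  powers = record
    { q^_         = q^_
    ; q^-0        = ≈-refl
    ; q^-+        = λ m n → ≈⇒≈[] (q^-+ m n)
    ; q^-vanishes = λ m N≤m → agree λ n n<N → q^-coefficient-≢ {m} {n} λ { refl → ℕ.≤⇒≯ N≤m n<N }
    }

  open TruncatedSeries (truncatedRing N) N powers public

  ⊖≈- : ∀ {f g g′} → g ≈[ N ] g′ → f ⊖ g ≈[ N ] f - g′
  ⊖≈- {f} p = agree λ n n<N → cong (λ z → f n ℤ.- z) (below p n n<N)

  poch≈qpoch : ∀ M a n → poch (q^ a) (q^ M) n ≈[ N ] qpoch M a n
  poch≈qpoch M a zero    = ≈-refl
  poch≈qpoch M a (suc n) = *-cong
    {poch (q^ a) (q^ M) n} {qpoch M a n} {𝟙 ⊖ q^ a ⊛ pow (q^ M) n} {𝟙 - q^ (a ℕ.+ M ℕ.* n)}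
    (poch≈qpoch M a n)
    (⊖≈- {𝟙} {q^ a ⊛ pow (q^ M) n} {q^ (a ℕ.+ M ℕ.* n)} (≈-trans
      (*-congˡ {q^ a} {pow (q^ M) n} {q^ (M ℕ.* n)} (≈⇒≈[] (pow-q^ M n)))
      (≈-sym (≈⇒≈[] (q^-+ a (M ℕ.* n))))))

  poch∞≈qpoch : ∀ M a n → 1 ≤ M → N ≤ n → poch∞ (q^ a) (q^ M) ≈[ N ] qpoch M a n
  -- With a successor, the constant term of q^M computes to 0, as convergence demands.
  poch∞≈qpoch (suc M) a n _ N≤n = ≈-trans
    (agree λ i i<N → sym (lim-limit (poch-convergent (q^ a) (q^ suc M) refl) (ℕ.<-≤-trans i<N N≤n)))
    (poch≈qpoch (suc M) a n)

-- Enumeration of the partitions by smallest part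

select : {P A : Set} → Dec P → List A → List A
select P? xs = if does P? then xs else []

∈-select⁻ : ∀ {P A : Set} (P? : Dec P) {xs} {x : A} → x ∈ select P? xs → P × x ∈ xs
∈-select⁻ (yes p) x∈ = p , x∈

∈-select⁺ : ∀ {P A : Set} (P? : Dec P) {xs} {x : A} → P → x ∈ xs → x ∈ select P? xs
∈-select⁺ (yes _) _ x∈ = x∈
∈-select⁺ (no ¬p) p _  = contradiction p ¬p

select-unique : ∀ {P A : Set} (P? : Dec P) {xs : List A} → Unique xs → Unique (select P? xs)
select-unique (yes _) xs! = xs!
select-unique (no _)  _   = []

φ-++ : ∀ i xs ys → φ i (xs ++ ys) ≡ φ i xs ℕ.+ φ i ys
φ-++ i xs ys = trans (cong length (filter-++ (ℕ._≟ i) xs ys)) (length-++ (filter (ℕ._≟ i) xs))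

φ-none : ∀ i {xs} → All (_≢ i) xs → φ i xs ≡ 0
φ-none i ≢i = cong length (filter-none (ℕ._≟ i) ≢i)

φ-replicate : ∀ m j → φ j (replicate m j) ≡ m
φ-replicate m j = trans (cong length (filter-all (ℕ._≟ j) (All.replicate⁺ m refl))) (length-replicate m)

sum-replicate : ∀ m j → sum (replicate m j) ≡ m ℕ.* j
sum-replicate zero    j = refl
sum-replicate (suc m) j = cong (j ℕ.+_) (sum-replicate m j)

sum-append : ∀ p m j → sum (p ++ replicate m j) ≡ sum p ℕ.+ m ℕ.* j
sum-append p m j = trans (sum-++ p _) (cong (sum p ℕ.+_) (sum-replicate m j))

parts≤sum : ∀ p → All (_≤ sum p) p
parts≤sum []      = []
parts≤sum (x ∷ p) = ℕ.m≤m+n x (sum p) ∷ All.map (λ y≤ → ℕ.≤-trans y≤ (ℕ.m≤n+m (sum p) x)) (parts≤sum p)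

φ-smallest : ∀ {j p} m → All (j <_) p → φ j (p ++ replicate m j) ≡ m
φ-smallest {j} {p} m j<p = trans (φ-++ j p _) (cong₂ ℕ._+_ (φ-none j (All.map (≡.≢-sym ∘ ℕ.<⇒≢) j<p)) (φ-replicate m j))

φ-larger : ∀ {i j} p m → j < i → φ i (p ++ replicate m j) ≡ φ i p
φ-larger {i} p m j<i = trans (φ-++ i p _) (trans (cong (φ i p ℕ.+_) (φ-none i (All.replicate⁺ m (ℕ.<⇒≢ j<i)))) (ℕ.+-identityʳ _))

-- In a descending list all copies of the least possible part form a final segment, hence the
-- representation as `p′ ++ replicate m j`.
split-smallest : ∀ j p → AllPairs _≥_ p → All (j ≤_) p →
  ∃₂ λ p′ m → p ≡ p′ ++ replicate m j × All (j <_) p′ × AllPairs _≥_ p′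
split-smallest j []      _             _            = [] , 0 , refl , [] , []
split-smallest j (x ∷ p) (x≥p ∷ p≥) (j≤x ∷ j≤p) with ℕ.m≤n⇒m<n∨m≡n j≤x
... | inj₂ refl = [] , suc (length p) , cong (j ∷_) (constant p x≥p j≤p) , [] , []
  where
  constant : ∀ p → All (j ≥_) p → All (j ≤_) p → p ≡ replicate (length p) j
  constant []      _            _            = refl
  constant (y ∷ p) (y≤j ∷ p≤j) (j≤y ∷ j≤p) = cong₂ _∷_ (ℕ.≤-antisym y≤j j≤y) (constant p p≤j j≤p)
... | inj₁ j<x with split-smallest j p p≥ j≤p
...   | p′ , m , refl , j<p′ , p′≥ = x ∷ p′ , m , refl , j<x ∷ j<p′ , All.++⁻ˡ p′ x≥p ∷ p′≥

module BoundedParts (d κ : ℕ) (0<κ : 0 < κ) where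

  -- The partitions counted by `gf L j α`. All conditions on multiplicities start at index j, so
  -- removing the parts j leaves a condition of the same kind for j + 1.
  record Valid (L j α n : ℕ) (p : List ℕ) : Set where
    constructor valid
    field
      descending : AllPairs _≥_ p
      lower      : All (j ≤_) p
      upper      : All (_< j ℕ.+ L) p
      total      : sum p ≡ n
      adjacent   : ∀ i → j ≤ i → φ i p ℕ.+ φ (suc i) p < κ
      smallest   : φ j p < α
      allowed    : ∀ i → j ≤ i → Allowed d i (φ i p)

  -- The adjacency condition at index j, m + φ_(j+1) < κ, is precisely the bound κ - m on the
  -- smallest part of the shorter partition; `restrict` reads it in the other direction.
  extend : ∀ {L j n m p} → Valid L (suc j) (κ ∸ m) (n ∸ m ℕ.* j) p → m ℕ.* j ≤ n → Allowed d j m →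
    Valid (suc L) j (suc m) n (p ++ replicate m j)
  extend {L} {j} {n} {m} {p} (valid p≥ j<p p< Σp adj small ok) mj≤n ok-j = valid
    (AllPairs.++⁺ p≥ (replicate-≥ m) (All.map (λ j<x → All.replicate⁺ m (ℕ.<⇒≤ j<x)) j<p))
    (All.++⁺ (All.map ℕ.<⇒≤ j<p) (All.replicate⁺ m ℕ.≤-refl))
    (All.++⁺ (All.map (λ x< → ℕ.<-≤-trans x< (ℕ.≤-reflexive (sym (ℕ.+-suc j L)))) p<) (All.replicate⁺ m (ℕ.m<m+n j (s≤s z≤n))))
    (trans (sum-append p m j) (trans (cong (ℕ._+ m ℕ.* j) Σp) (ℕ.m∸n+n≡m mj≤n)))
    adj′
    (s≤s (ℕ.≤-reflexive (φ-smallest m j<p)))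
    ok′
    where
    replicate-≥ : ∀ m → AllPairs _≥_ (replicate m j)
    replicate-≥ zero    = []
    replicate-≥ (suc m) = All.replicate⁺ m ℕ.≤-refl ∷ replicate-≥ m

    adj′ : ∀ i → j ≤ i → φ i (p ++ replicate m j) ℕ.+ φ (suc i) (p ++ replicate m j) < κ
    adj′ i j≤i with ℕ.m≤n⇒m<n∨m≡n j≤i
    ... | inj₁ j<i  rewrite φ-larger p m j<i | φ-larger p m (ℕ.m<n⇒m<1+n j<i) = adj i j<i
    ... | inj₂ refl rewrite φ-smallest m j<p | φ-larger p m (ℕ.n<1+n j) =
      ℕ.≤-trans (ℕ.≤-reflexive (cong suc (ℕ.+-comm m _)))
        (ℕ.m≤o∸n⇒m+n≤o (suc (φ (suc j) p)) (ℕ.<⇒≤ (ℕ.m∸n≢0⇒n<m λ κ∸m≡0 → ℕ.n≮0 (subst (φ (suc j) p <_) κ∸m≡0 small))) small)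

    ok′ : ∀ i → j ≤ i → Allowed d i (φ i (p ++ replicate m j))
    ok′ i j≤i with ℕ.m≤n⇒m<n∨m≡n j≤i
    ... | inj₁ j<i  rewrite φ-larger p m j<i = ok i j<i
    ... | inj₂ refl rewrite φ-smallest m j<p = ok-j

  restrict : ∀ {L j n α} p m → All (j <_) p → AllPairs _≥_ p → Valid (suc L) j α n (p ++ replicate m j) →
    m < α × Allowed d j m × m ℕ.* j ≤ n × Valid L (suc j) (κ ∸ m) (n ∸ m ℕ.* j) p
  restrict {L} {j} {n} {α} p m j<p p≥ (valid _ _ p< Σp adj small ok) =
    subst (_< α) (φ-smallest m j<p) small ,
    subst (Allowed d j) (φ-smallest m j<p) (ok j ℕ.≤-refl) ,
    ℕ.≤-trans (ℕ.m≤n+m _ (sum p)) (ℕ.≤-reflexive Σp+mj) ,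
    valid p≥ j<p
      (All.map (λ x< → ℕ.<-≤-trans x< (ℕ.≤-reflexive (ℕ.+-suc j L))) (All.++⁻ˡ p p<))
      (trans (sym (ℕ.m+n∸n≡m (sum p) (m ℕ.* j))) (cong (_∸ m ℕ.* j) Σp+mj))
      (λ i j<i → subst (_< κ) (cong₂ ℕ._+_ (φ-larger p m j<i) (φ-larger p m (ℕ.m<n⇒m<1+n j<i))) (adj i (ℕ.<⇒≤ j<i)))
      (ℕ.m+n≤o⇒m≤o∸n (suc (φ (suc j) p)) (ℕ.≤-trans (ℕ.≤-reflexive (cong suc (ℕ.+-comm _ m)))
        (subst (_< κ) (cong₂ ℕ._+_ (φ-smallest m j<p) (φ-larger p m (ℕ.n<1+n j))) (adj j ℕ.≤-refl))))
      (λ i j<i → subst (Allowed d i) (φ-larger p m j<i) (ok i (ℕ.<⇒≤ j<i)))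
    where
    Σp+mj : sum p ℕ.+ m ℕ.* j ≡ n
    Σp+mj = trans (sym (sum-append p m j)) Σp

  weaken : ∀ {L j α n p} → Valid L j α n p → Valid L j (suc α) n p
  weaken (valid a b c d e f g) = valid a b c d e (ℕ.m<n⇒m<1+n f) g

  block : ℕ → ℕ → ℕ → List (List ℕ) → List (List ℕ)
  block j m n ps = select (allowed? d j m) (select (m ℕ.* j ℕ.≤? n) (map (_++ replicate m j) ps))

  ∈-block⁻ : ∀ j m n {ps p} → p ∈ block j m n ps →
    Allowed d j m × m ℕ.* j ≤ n × ∃ λ p′ → p′ ∈ ps × p ≡ p′ ++ replicate m j
  ∈-block⁻ j m n p∈ =
    let ok   , p∈′ = ∈-select⁻ (allowed? d j m) p∈
        mj≤n , p∈″ = ∈-select⁻ (m ℕ.* j ℕ.≤? n) p∈′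
    in  ok , mj≤n , ∈-map⁻ (_++ replicate m j) p∈″

  -- Its clauses mirror those of `gf`, so that lengths can be matched with coefficients one clause
  -- at a time.
  enumerate : ℕ → ℕ → ℕ → ℕ → List (List ℕ)
  enumerate zero    j zero    n       = []
  enumerate zero    j (suc α) zero    = [] ∷ []
  enumerate zero    j (suc α) (suc n) = []
  enumerate (suc L) j zero    n       = []
  enumerate (suc L) j (suc α) n       =
    enumerate (suc L) j α n ++ block j α n (enumerate L (suc j) (κ ∸ α) (n ∸ α ℕ.* j))

  block-sound : ∀ {L j m n ps p} → (∀ {p} → p ∈ ps → Valid L (suc j) (κ ∸ m) (n ∸ m ℕ.* j) p) →
    p ∈ block j m n ps → Valid (suc L) j (suc m) n p
  block-sound {j = j} {m} {n} sound p∈ with ∈-block⁻ j m n p∈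
  ... | ok , mj≤n , p′ , p′∈ , refl = extend (sound p′∈) mj≤n ok

  enumerate-sound : ∀ L j α n {p} → p ∈ enumerate L j α n → Valid L j α n p
  enumerate-sound zero    j (suc α) zero (here refl) = valid [] [] [] refl (λ _ _ → 0<κ) (s≤s z≤n) (λ _ _ _ → divides 0 refl)
  enumerate-sound (suc L) j (suc α) n p∈ =
    [ (λ p∈₁ → weaken (enumerate-sound (suc L) j α n p∈₁))
    , block-sound (λ p′∈ → enumerate-sound L (suc j) (κ ∸ α) (n ∸ α ℕ.* j) p′∈)
    ]′ (∈-++⁻ (enumerate (suc L) j α n) p∈)

  enumerate-complete-split : ∀ L j α n p m → All (j <_) p → m < α → Allowed d j m → m ℕ.* j ≤ n →
    p ∈ enumerate L (suc j) (κ ∸ m) (n ∸ m ℕ.* j) → p ++ replicate m j ∈ enumerate (suc L) j α n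
  enumerate-complete-split L j (suc α) n p m j<p (s≤s m≤α) ok mj≤n p∈ with ℕ.m≤n⇒m<n∨m≡n m≤α
  ... | inj₁ m<α  = ∈-++⁺ˡ (enumerate-complete-split L j α n p m j<p m<α ok mj≤n p∈)
  ... | inj₂ refl = ∈-++⁺ʳ (enumerate (suc L) j α n)
    (∈-select⁺ (allowed? d j α) ok (∈-select⁺ (α ℕ.* j ℕ.≤? n) mj≤n (∈-map⁺ (_++ replicate α j) p∈)))

  enumerate-complete : ∀ L j α n p → Valid L j α n p → p ∈ enumerate L j α n
  enumerate-complete zero j (suc α) .0 [] (valid _ _ _ refl _ _ _) = here refl
  enumerate-complete zero j α n (x ∷ p) (valid _ (j≤x ∷ _) (x< ∷ _) _ _ _ _) =
    contradiction (ℕ.<-≤-trans x< (ℕ.≤-reflexive (ℕ.+-identityʳ j))) (ℕ.≤⇒≯ j≤x)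
  enumerate-complete (suc L) j α n p v with split-smallest j p (Valid.descending v) (Valid.lower v)
  ... | p′ , m , refl , j<p′ , p′≥ with restrict p′ m j<p′ p′≥ v
  ...   | m<α , ok , mj≤n , v′ = enumerate-complete-split L j α n p′ m j<p′ m<α ok mj≤n (enumerate-complete L (suc j) (κ ∸ m) (n ∸ m ℕ.* j) p′ v′)

  enumerate-unique : ∀ L j α n → Unique (enumerate L j α n)
  enumerate-unique zero    j zero    n       = []
  enumerate-unique zero    j (suc α) zero    = [] ∷ []
  enumerate-unique zero    j (suc α) (suc n) = []
  enumerate-unique (suc L) j zero    n       = []
  enumerate-unique (suc L) j (suc α) n       = Unique.++⁺
    (enumerate-unique (suc L) j α n)
    (select-unique (allowed? d j α) (select-unique (α ℕ.* j ℕ.≤? n)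
      (Unique.map⁺ (++-cancelʳ (replicate α j) _ _) (enumerate-unique L (suc j) (κ ∸ α) (n ∸ α ℕ.* j)))))
    disjoint
    where
    -- The part j occurs fewer than `α` times on the left and exactly `α` times in the block.
    disjoint : ∀ {p} → ¬ (p ∈ enumerate (suc L) j α n × p ∈ block j α n (enumerate L (suc j) (κ ∸ α) (n ∸ α ℕ.* j)))
    disjoint (p∈₁ , p∈₂) with ∈-block⁻ j α n p∈₂
    ... | _ , _ , p′ , p′∈ , refl = ℕ.<-irrefl
      (φ-smallest α (Valid.lower (enumerate-sound L (suc j) (κ ∸ α) (n ∸ α ℕ.* j) p′∈)))
      (Valid.smallest (enumerate-sound (suc L) j α n p∈₁))

  admissible⇒valid : ∀ {L α n p} → n ≤ L → Admissible d κ α n p → Valid L 1 α n p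
  admissible⇒valid {L} {α} {n} {p} n≤L (admissible (p≥ , p>0 , Σp) adj ones evens) = valid
    (Linked⇒AllPairs (λ x≥y y≥z → ℕ.≤-trans y≥z x≥y) p≥)
    p>0
    (All.map (λ x≤ → s≤s (ℕ.≤-trans x≤ (ℕ.≤-trans (ℕ.≤-reflexive Σp) n≤L))) (parts≤sum p))
    Σp
    (λ i 1≤i → subst (λ z → φ i p ℕ.+ φ z p < κ) (ℕ.+-comm i 1) (adj i 1≤i))
    ones
    even
    where
    even : ∀ i → 1 ≤ i → Allowed d i (φ i p)
    even .(zero ℕ.* 2)  () (divides zero refl)
    even .(suc t ℕ.* 2) _ (divides (suc t) refl) = subst (λ z → d ∣ φ z p) (ℕ.*-comm 2 (suc t)) (evens (suc t) (s≤s z≤n))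

  valid⇒admissible : ∀ {L α n p} → Valid L 1 α n p → Admissible d κ α n p
  valid⇒admissible {p = p} (valid p≥ p>0 _ Σp adj ones ok) = admissible
    (AllPairs⇒Linked p≥ , p>0 , Σp)
    (λ i 1≤i → subst (λ z → φ i p ℕ.+ φ z p < κ) (ℕ.+-comm 1 i) (adj i 1≤i))
    ones
    (λ i 1≤i → ok (2 ℕ.* i) (ℕ.≤-trans 1≤i (ℕ.m≤m+n i _)) (divides i (ℕ.*-comm 2 i)))

  -- Two duplicate-free lists with the same members are permutations of each other. The bound
  -- `L ≥ n` suffices because no part exceeds the sum.
  B≡length : ∀ L α n → n ≤ L → B d κ α n ≡ length (enumerate L 1 α n)
  B≡length L α n n≤L = ↭-length (∼bag⇒↭ (unique∧set⇒bag unique (enumerate-unique L 1 α n) (λ {p} → mk⇔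
    (λ p∈ → enumerate-complete L 1 α n p (admissible⇒valid n≤L (Equivalence.to (complete p) p∈)))
    (λ p∈ → Equivalence.from (complete p) (valid⇒admissible (enumerate-sound L 1 α n p∈))))))
    where open Enumeration (enumeration d κ α n)

open import Data.Nat.Base using (_+_; _*_)
open Algebra.Properties.CommutativeSemigroup using (x∙yz≈y∙xz)

-- Product formulas for the counting series

module ProductFormulas (k d e : ℕ) (1≤d : 1 ≤ d) (1≤e : 1 ≤ e) (e≤d : e ≤ d) (e-cond : (e ≡ d) ⊎ (2 * e ≡ d)) where

  κ : ℕ
  κ = d * k + e

  open BoundedParts d κ (ℕ.≤-trans 1≤e (ℕ.m≤n+m e (d * k)))

  denom : Series
  denom = poch∞ (q^ (2 * d)) (q^ (2 * d)) ⊛ poch∞ (q^ 1) (q^ 2)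

  denom₀ : denom 0 ≡ 1ℤ
  denom₀ = constant-term d 1≤d
    where
    constant-term : ∀ d → 1 ≤ d → (poch∞ (q^ (2 * d)) (q^ (2 * d)) ⊛ poch∞ (q^ 1) (q^ 2)) 0 ≡ 1ℤ
    constant-term (suc d) _ = refl

  1-q^d₀ : (𝟙 ⊖ q^ d) 0 ≡ 1ℤ
  1-q^d₀ = cong (λ z → 1ℤ ℤ.- z) (q^-coefficient-≢ (≡.≢-sym (ℕ.<⇒≢ 1≤d)))

  G : ℕ → Series
  G α = genFun (B d κ α)

  product : ℕ → ℕ → ℕ → Series
  product M A A′ = pochs∞ (q^ A ∷ q^ A′ ∷ q^ M ∷ []) (q^ M)

  module Modulo (N : ℕ) where
    open CommutativeRing (truncatedRing N) using (+-cong; *-cong; *-congˡ; *-identityʳ; *-comm; *-commutativeSemigroup)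
      renaming (sym to ≈-sym; trans to ≈-trans; _*_ to _*ᴿ_)
    open Truncated N
    open GeneratingFunctions k d e 1≤d 1≤e e≤d e-cond using (gf; numerator; numerator-product; numerator-top; numerator-interpolation)

    -- Multiplication by q^c shifts coefficients, and the test `c ≤ n` accounts for the zeros below
    -- the shift.
    length-block : ∀ {P : Set} c n (P? : Dec P) (c≤n? : Dec (c ≤ n)) (xs : List (List ℕ)) f →
      (c ≤ n → + length xs ≡ f (n ∸ c)) →
      + length (select P? (select c≤n? xs)) ≡ indicator P? (q^ c ⊛ f) n
    length-block c n (no _)  _         xs f h = refl
    length-block c n (yes _) (no c≰n)  xs f h = sym (q^-⊛-below c f n (ℕ.≰⇒> c≰n))
    length-block c n (yes _) (yes c≤n) xs f h =
      trans (h c≤n) (trans (sym (q^-⊛-shift c f (n ∸ c))) (cong (q^ c ⊛ f) (ℕ.m+[n∸m]≡n c≤n)))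

    length-enumerate : ∀ L j α n → n < N → + length (enumerate L j α n) ≡ gf L j α n
    length-enumerate zero    j zero    n       _   = refl
    length-enumerate zero    j (suc α) zero    _   = refl
    length-enumerate zero    j (suc α) (suc n) _   = refl
    length-enumerate (suc L) j zero    n       _   = refl
    length-enumerate (suc L) j (suc α) n       n<N = trans
      (cong +_ (length-++ (enumerate (suc L) j α n)))
      (cong₂ ℤ._+_ (length-enumerate (suc L) j α n n<N)
        (length-block (α * j) n (allowed? d j α) (α * j ℕ.≤? n) _ (gf L (suc j) (κ ∸ α))
          (λ _ → trans (cong +_ (length-map _ (enumerate L (suc j) (κ ∸ α) (n ∸ α * j))))
                       (length-enumerate L (suc j) (κ ∸ α) (n ∸ α * j) (ℕ.≤-<-trans (ℕ.m∸n≤m n (α * j)) n<N)))))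

    G≈gf : ∀ α → G α ≈[ N ] gf (double (suc N)) 1 α
    G≈gf α = agree λ n n<N → trans
      (cong +_ (B≡length (double (suc N)) α n (ℕ.≤-trans (ℕ.<⇒≤ n<N) (ℕ.≤-trans (ℕ.n≤1+n N) (m≤double (suc N))))))
      (length-enumerate (double (suc N)) 1 α n n<N)

    denom⊛G≈numerator : ∀ α → denom ⊛ G α ≈[ N ] numerator α
    denom⊛G≈numerator α = *-cong {denom} {qpoch 2 1 (suc N) ⊛ qpoch (2 * d) (2 * d) (suc N)} {G α} {gf (double (suc N)) 1 α}
      (≈-trans {denom} {qpoch (2 * d) (2 * d) (suc N) ⊛ qpoch 2 1 (suc N)}
        (*-cong {poch∞ (q^ (2 * d)) (q^ (2 * d))} {qpoch (2 * d) (2 * d) (suc N)} {poch∞ (q^ 1) (q^ 2)} {qpoch 2 1 (suc N)}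
          (poch∞≈qpoch (2 * d) (2 * d) (suc N) (ℕ.≤-trans 1≤d (ℕ.m≤m+n d _)) (ℕ.n≤1+n N))
          (poch∞≈qpoch 2 1 (suc N) (s≤s z≤n) (ℕ.n≤1+n N)))
        (*-comm (qpoch (2 * d) (2 * d) (suc N)) (qpoch 2 1 (suc N))))
      (G≈gf α)

    product≈ : ∀ M A A′ → 1 ≤ M →
      product M A A′ ≈[ N ] qpoch M A N *ᴿ (qpoch M A′ N *ᴿ qpoch M (M * 1) (suc N))
    product≈ M A A′ 1≤M =
      *-cong {poch∞ (q^ A) (q^ M)} {qpoch M A N} {poch∞ (q^ A′) (q^ M) ⊛ (poch∞ (q^ M) (q^ M) ⊛ 𝟙)} {qpoch M A′ N ⊛ qpoch M (M * 1) (suc N)}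
        (poch∞≈qpoch M A N 1≤M ℕ.≤-refl)
        (*-cong {poch∞ (q^ A′) (q^ M)} {qpoch M A′ N} {poch∞ (q^ M) (q^ M) ⊛ 𝟙} {qpoch M (M * 1) (suc N)}
          (poch∞≈qpoch M A′ N 1≤M ℕ.≤-refl)
          (≈-trans (*-identityʳ (poch∞ (q^ M) (q^ M)))
            (subst (λ z → poch∞ (q^ M) (q^ M) ≈[ N ] qpoch M z (suc N)) (sym (ℕ.*-identityʳ M))
              (poch∞≈qpoch M M (suc N) 1≤M (ℕ.n≤1+n N)))))

    denom⊛G≈product : ∀ a A′ → a ≤ k → 1 ≤ A′ → d * a + e + A′ ≡ 2 * κ + d →
      denom ⊛ G (d * a + e) ≈[ N ] product (2 * κ + d) (d * a + e) A′
    denom⊛G≈product a A′ a≤k 1≤A′ eq = ≈-trans (denom⊛G≈numerator (d * a + e))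
      (≈-trans (numerator-product a A′ a≤k 1≤A′ eq)
        (≈-sym (product≈ (2 * κ + d) (d * a + e) A′ (ℕ.≤-trans 1≤d (ℕ.m≤n+m d _)))))

    denom⊛G-top : denom ⊛ G (d * suc k + e) ≈[ N ] denom ⊛ G (d * k + e)
    denom⊛G-top = ≈-trans (denom⊛G≈numerator (d * suc k + e)) (≈-trans numerator-top (≈-sym (denom⊛G≈numerator (d * k + e))))

    interpolation : ∀ a g → g ≤ d → (𝟙 ⊖ q^ d) ⊛ (denom ⊛ G (d * a + e + g)) ≈[ N ]
      (𝟙 ⊖ q^ g) ⊛ (denom ⊛ G (d * suc a + e)) ⊕ (q^ g ⊖ q^ d) ⊛ (denom ⊛ G (d * a + e))
    interpolation a g g≤d = ≈-trans
      (*-congˡ {𝟙 ⊖ q^ d} {denom ⊛ G (d * a + e + g)} {numerator (d * a + e + g)} (denom⊛G≈numerator (d * a + e + g)))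
      (≈-trans (numerator-interpolation a g g≤d) (≈-sym
        (+-cong {(𝟙 ⊖ q^ g) ⊛ (denom ⊛ G (d * suc a + e))} {(𝟙 ⊖ q^ g) ⊛ numerator (d * suc a + e)}
                {(q^ g ⊖ q^ d) ⊛ (denom ⊛ G (d * a + e))} {(q^ g ⊖ q^ d) ⊛ numerator (d * a + e)}
          (*-congˡ {𝟙 ⊖ q^ g} {denom ⊛ G (d * suc a + e)} {numerator (d * suc a + e)} (denom⊛G≈numerator (d * suc a + e)))
          (*-congˡ {q^ g ⊖ q^ d} {denom ⊛ G (d * a + e)} {numerator (d * a + e)} (denom⊛G≈numerator (d * a + e))))))

    M : ℕ
    M = 2 * d * k + 2 * e + d

    product-comm : ∀ A A′ → product M A A′ ≈[ N ] product M A′ A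
    product-comm A A′ = x∙yz≈y∙xz *-commutativeSemigroup
      (poch∞ (q^ A) (q^ M)) (poch∞ (q^ A′) (q^ M)) (poch∞ (q^ M) (q^ M) ⊛ 𝟙)

    denom⊛G : ∀ a A A′ → A ≡ d * a + e → a ≤ k → 1 ≤ A′ → A + A′ ≡ M → denom ⊛ G A ≈[ N ] product M A A′
    denom⊛G a A A′ refl a≤k 1≤A′ A+A′≡M = subst (λ M → denom ⊛ G A ≈[ N ] product M A A′) M≡
      (denom⊛G≈product a A′ a≤k 1≤A′ (trans A+A′≡M (sym M≡)))
      where
      eq : ∀ d k e → 2 * (d * k + e) + d ≡ 2 * d * k + 2 * e + d
      eq = solve-∀
      M≡ : 2 * κ + d ≡ M
      M≡ = eq d k e

    -- For a = k the parameter is beyond K, so the series is the one for dk + e. As dk + e and d(k +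
    -- 1) + e add up to M, the two products differ only in the order of their factors.
    denom⊛G-suc : ∀ a A A′ → A ≡ d * suc a + e → a ≤ k → 1 ≤ A′ → A + A′ ≡ M → denom ⊛ G A ≈[ N ] product M A A′
    denom⊛G-suc a A A′ refl a≤k 1≤A′ A+A′≡M with ℕ.m≤n⇒m<n∨m≡n a≤k
    ... | inj₁ a<k  = denom⊛G (suc a) A A′ refl a<k 1≤A′ A+A′≡M
    ... | inj₂ refl = ≈-trans {denom ⊛ G A} {denom ⊛ G (d * a + e)} {product M A A′} denom⊛G-top
      (≈-trans {denom ⊛ G (d * a + e)} {product M A′ A} {product M A A′}
        (subst (λ z → denom ⊛ G (d * a + e) ≈[ N ] product M z A) A₀≡A′
          (denom⊛G a (d * a + e) A refl ℕ.≤-refl (ℕ.≤-trans 1≤e (ℕ.m≤n+m e _)) (eq d a e)))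
        (product-comm A′ A))
      where
      eq : ∀ d a e → d * a + e + (d * suc a + e) ≡ 2 * d * a + 2 * e + d
      eq = solve-∀
      A₀≡A′ : d * a + e ≡ A′
      A₀≡A′ = ℕ.+-cancelˡ-≡ A _ _ (trans (ℕ.+-comm A (d * a + e)) (trans (eq d a e) (sym A+A′≡M)))

    divided : ∀ α P → denom ⊛ G α ≈[ N ] P → G α ≈[ N ] P ⊘ denom
    divided α P h = Division.divide (truncatedRing N) denom (inverse denom) (G α) P
      (≈⇒≈[] (⊛-inverseʳ denom denom₀)) h

    combined : ∀ α x z α₁ α₂ P P′ → denom ⊛ G α₁ ≈[ N ] P → denom ⊛ G α₂ ≈[ N ] P′ →
      (𝟙 ⊖ q^ d) ⊛ (denom ⊛ G α) ≈[ N ] x ⊛ (denom ⊛ G α₁) ⊕ z ⊛ (denom ⊛ G α₂) →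
      G α ≈[ N ] (𝟙 ⊘ denom) ⊛ ((x ⊘ (𝟙 ⊖ q^ d)) ⊛ P ⊕ (z ⊘ (𝟙 ⊖ q^ d)) ⊛ P′)
    combined α x z α₁ α₂ P P′ h₁ h₂ h = Division.divide-combination (truncatedRing N)
      denom (inverse denom) (𝟙 ⊖ q^ d) (inverse (𝟙 ⊖ q^ d)) (G α) x z P P′
      (≈⇒≈[] (⊛-inverseʳ denom denom₀))
      (≈⇒≈[] (⊛-inverseʳ (𝟙 ⊖ q^ d) 1-q^d₀))
      (≈-trans {(𝟙 ⊖ q^ d) ⊛ (denom ⊛ G α)} {x ⊛ (denom ⊛ G α₁) ⊕ z ⊛ (denom ⊛ G α₂)} {x ⊛ P ⊕ z ⊛ P′} h
        (+-cong {x ⊛ (denom ⊛ G α₁)} {x ⊛ P} {z ⊛ (denom ⊛ G α₂)} {z ⊛ P′}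
          (*-congˡ {x} {denom ⊛ G α₁} {P} h₁) (*-congˡ {z} {denom ⊛ G α₂} {P′} h₂)))

theorem3p1 :
    (a k d e f : ℕ) →
    1 ≤ a → a ≤ k → 1 ≤ d → d ≤ k → 1 ≤ f → f ≤ d →
    (e ≡ d) ⊎ (2 * e ≡ d) →
    let M     = 2 * d * k + 2 * e + d
        G     = genFun (B d (d * k + e) (d * a + f))
        denom = poch∞ (q^ (2 * d)) (q^ (2 * d)) ⊛ poch∞ (q^ 1) (q^ 2)
        P₀    = pochs∞ (q^ (d * a + e) ∷ q^ (2 * d * k ∸ d * a + e + d) ∷ q^ M ∷ []) (q^ M)
        P₋    = pochs∞ (q^ (d * (a ∸ 1) + e) ∷ q^ (2 * d * k ∸ d * a + e + 2 * d) ∷ q^ M ∷ []) (q^ M)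
        P₊    = pochs∞ (q^ (d * (a + 1) + e) ∷ q^ (2 * d * k ∸ d * a + e) ∷ q^ M ∷ []) (q^ M)
    in
    (f < e → G ≈ (𝟙 ⊘ denom) ⊛ ( ((𝟙 ⊖ q^ (d ∸ e + f)) ⊘ (𝟙 ⊖ q^ d)) ⊛ P₀
                                ⊕ ((q^ (d ∸ e + f) ⊖ q^ d) ⊘ (𝟙 ⊖ q^ d)) ⊛ P₋ ))
    × (f ≡ e → G ≈ P₀ ⊘ denom)
    × (f > e → G ≈ (𝟙 ⊘ denom) ⊛ ( ((q^ (f ∸ e) ⊖ q^ d) ⊘ (𝟙 ⊖ q^ d)) ⊛ P₀
                                  ⊕ ((𝟙 ⊖ q^ (f ∸ e)) ⊘ (𝟙 ⊖ q^ d)) ⊛ P₊ ))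
-- From here on `a` is the predecessor of the parameter in the statement, so it may be 0, and the
-- index in `P₋` needs no subtraction.
theorem3p1 (suc a) k d e f _ a<k 1≤d d≤k 1≤f f≤d e-cond = Below.proof , equal , Above.proof
  where
  1≤e : 1 ≤ e
  1≤e = case e-cond
    where
    case : (e ≡ d) ⊎ (2 * e ≡ d) → 1 ≤ e
    case (inj₁ refl) = 1≤d
    case (inj₂ refl) = ℕ.n≢0⇒n>0 λ { refl → ℕ.n≮0 1≤d }

  e≤d : e ≤ d
  e≤d = case e-cond
    where
    case : (e ≡ d) ⊎ (2 * e ≡ d) → e ≤ d
    case (inj₁ refl) = ℕ.≤-refl
    case (inj₂ refl) = ℕ.m≤m+n e _

  open ProductFormulas k d e 1≤d 1≤e e≤d e-cond using (G; denom; product; module Modulo)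

  M : ℕ
  M = 2 * d * k + 2 * e + d

  c : ℕ
  c = 2 * d * k ∸ d * suc a

  da+c : d * suc a + c ≡ 2 * d * k
  da+c = ℕ.m+[n∸m]≡n (ℕ.≤-trans (ℕ.*-monoʳ-≤ d a<k) (ℕ.*-monoˡ-≤ k (ℕ.m≤m+n d _)))

  sum≡M : ∀ {x} → x ≡ d * suc a + c + 2 * e + d → x ≡ M
  sum≡M eq = trans eq (cong (λ z → z + 2 * e + d) da+c)

  1≤A′ : ∀ x y → 1 ≤ x + e + y
  1≤A′ x y = ℕ.≤-trans 1≤e (ℕ.≤-trans (ℕ.m≤n+m e x) (ℕ.m≤m+n _ y))

  P₀ P₋ P₊ : Series
  P₀ = product M (d * suc a + e) (c + e + d)
  P₋ = product M (d * a + e) (c + e + 2 * d)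
  P₊ = product M (d * (suc a + 1) + e) (c + e)

  P₀-correct : ∀ N → denom ⊛ G (d * suc a + e) ≈[ N ] P₀
  P₀-correct N = Modulo.denom⊛G N (suc a) (d * suc a + e) (c + e + d) refl a<k (1≤A′ c d) (sum≡M (eq (d * suc a) c e d))
    where
    eq : ∀ x c e d → x + e + (c + e + d) ≡ x + c + 2 * e + d
    eq = solve-∀

  P₋-correct : ∀ N → denom ⊛ G (d * a + e) ≈[ N ] P₋
  P₋-correct N = Modulo.denom⊛G N a (d * a + e) (c + e + 2 * d) refl (ℕ.<⇒≤ a<k) (1≤A′ c (2 * d)) (sum≡M (eq d a c e))
    where
    eq : ∀ d a c e → d * a + e + (c + e + 2 * d) ≡ d * suc a + c + 2 * e + d
    eq = solve-∀

  P₊-correct : ∀ N → denom ⊛ G (d * (suc a + 1) + e) ≈[ N ] P₊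
  P₊-correct N = Modulo.denom⊛G-suc N (suc a) (d * (suc a + 1) + e) (c + e) (cong (λ z → d * z + e) (ℕ.+-comm (suc a) 1)) a<k
    (subst (1 ≤_) (ℕ.+-identityʳ (c + e)) (1≤A′ c 0)) (sum≡M (eq d a c e))
    where
    eq : ∀ d a c e → d * (suc a + 1) + e + (c + e) ≡ d * suc a + c + 2 * e + d
    eq = solve-∀

  module Below (f<e : f < e) where
    g : ℕ
    -- For f < e, the nearest value congruent to e below d(a + 1) + f is da + e, at this distance.
    g = d ∸ e + f

    rhs : Series
    rhs = (𝟙 ⊘ denom) ⊛ ( ((𝟙 ⊖ q^ g) ⊘ (𝟙 ⊖ q^ d)) ⊛ P₀ ⊕ ((q^ g ⊖ q^ d) ⊘ (𝟙 ⊖ q^ d)) ⊛ P₋ )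

    g≤d : g ≤ d
    g≤d = ℕ.≤-trans (ℕ.+-monoʳ-≤ (d ∸ e) (ℕ.<⇒≤ f<e)) (ℕ.≤-reflexive (ℕ.m∸n+n≡m e≤d))

    α≡ : d * a + e + g ≡ d * suc a + f
    α≡ = trans (eq₁ (d * a) e (d ∸ e) f) (trans (cong (λ z → d * a + z + f) (ℕ.m+[n∸m]≡n e≤d)) (eq₂ d a f))
      where
      eq₁ : ∀ x e b f → x + e + (b + f) ≡ x + (e + b) + f
      eq₁ = solve-∀
      eq₂ : ∀ d a f → d * a + d + f ≡ d * suc a + f
      eq₂ = solve-∀

    proof : G (d * suc a + f) ≈ rhs
    proof = ≈[]⇒≈ (G (d * suc a + f)) rhs λ N → subst (λ α → G α ≈[ N ] rhs) α≡
      (Modulo.combined N (d * a + e + g) (𝟙 ⊖ q^ g) (q^ g ⊖ q^ d) (d * suc a + e) (d * a + e) P₀ P₋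
        (P₀-correct N) (P₋-correct N) (Modulo.interpolation N a g g≤d))

  equal : f ≡ e → G (d * suc a + f) ≈ P₀ ⊘ denom
  equal refl = ≈[]⇒≈ (G (d * suc a + e)) (P₀ ⊘ denom) λ N → Modulo.divided N (d * suc a + e) P₀ (P₀-correct N)

  module Above (e<f : e < f) where
    g : ℕ
    g = f ∸ e

    rhs : Series
    rhs = (𝟙 ⊘ denom) ⊛ ( ((q^ g ⊖ q^ d) ⊘ (𝟙 ⊖ q^ d)) ⊛ P₀ ⊕ ((𝟙 ⊖ q^ g) ⊘ (𝟙 ⊖ q^ d)) ⊛ P₊ )

    α≡ : d * suc a + e + g ≡ d * suc a + f
    α≡ = trans (ℕ.+-assoc (d * suc a) e g) (cong (λ z → d * suc a + z) (ℕ.m+[n∸m]≡n (ℕ.<⇒≤ e<f)))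

    interpolation : ∀ N → (𝟙 ⊖ q^ d) ⊛ (denom ⊛ G (d * suc a + e + g)) ≈[ N ]
      (q^ g ⊖ q^ d) ⊛ (denom ⊛ G (d * suc a + e)) ⊕ (𝟙 ⊖ q^ g) ⊛ (denom ⊛ G (d * (suc a + 1) + e))
    interpolation N = subst (λ b → (𝟙 ⊖ q^ d) ⊛ (denom ⊛ G (d * suc a + e + g)) ≈[ N ]
        (q^ g ⊖ q^ d) ⊛ (denom ⊛ G (d * suc a + e)) ⊕ (𝟙 ⊖ q^ g) ⊛ (denom ⊛ G (d * b + e))) (ℕ.+-comm 1 (suc a))
      (CommutativeRing.trans (truncatedRing N)
        (Modulo.interpolation N (suc a) g (ℕ.≤-trans (ℕ.m∸n≤m f e) f≤d))
        (CommutativeRing.+-comm (truncatedRing N)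
          ((𝟙 ⊖ q^ g) ⊛ (denom ⊛ G (d * suc (suc a) + e))) ((q^ g ⊖ q^ d) ⊛ (denom ⊛ G (d * suc a + e)))))

    proof : G (d * suc a + f) ≈ rhs
    proof = ≈[]⇒≈ (G (d * suc a + f)) rhs λ N → subst (λ α → G α ≈[ N ] rhs) α≡
      (Modulo.combined N (d * suc a + e + g) (q^ g ⊖ q^ d) (𝟙 ⊖ q^ g) (d * suc a + e) (d * (suc a + 1) + e) P₀ P₊
        (P₀-correct N) (P₊-correct N) (interpolation N))
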